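{- There is a deterministic logarithmic-space Turing machine $M$ such that for every finite ordered graph $(G,<)$, the relation $\prec$ on the vertices of $G$ defined by: $v\prec w$ iff $M$ accepts the input consisting of the canonical encoding of $(G,<)$ together with (the indices of) $v$ and $w$, is a linear order of the vertex set of $G$ which is a traversal of $G$.
   Context: A finite ordered graph $(G,<)$ is a finite undirected graph with a linear order on its vertices; its canonical encoding is the standard string encoding of the structure relative to the order $<$, vertices being referred to by their index in $<$. A linear order $\prec$ of the vertex set of a graph, listing vertices $v_1\prec\dots\prec v_n$, is a traversal if for each $i\ge2$: whenever some vertex among $v_1,\dots,v_{i-1}$ has a neighbour outside $\{v_1,\dots,v_{i-1}\}$, $v_i$ has a neighbour among $v_1,\dots,v_{i-1}$ (i.e. it is a visiting order of generic graph search). Equivalently: for all $u\prec v\prec w$, if $u$ and $w$ are adjacent then $v$ has a neighbour $x\prec v$. -}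

module Defs where

open import Data.Bool.Base using (Bool; true; false)
open import Data.Digit using (Bit; 0b; 1b; toDigits)
open import Data.Fin.Base using (Fin; zero; suc)
open import Data.List.Base as List
  using (List; []; _∷_; [_]; _++_; length; map; concatMap; filter; reverse; allFin)
import Data.List.Sort as Sort
open import Data.Nat.Base using (ℕ; zero; suc; pred; _+_; _*_; _⊓_; _≤_)
open import Data.Nat.Logarithm using (⌈log₂_⌉)
open import Data.Product.Base using (∃; ∃-syntax; _×_; _,_; proj₁)
open import Data.Sum.Base using (_⊎_)
open import Data.Vec.Base as Vec using (Vec)
open import Function.Bundles using (_↔_; module Inverse)
open import Level using (0ℓ)
open import Relation.Binary.Bundles using (StrictTotalOrder)
open import Relation.Binary.Core using (Rel)
open import Relation.Binary.Definitions using (Decidable; Irreflexive; Symmetric)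
import Relation.Binary.Properties.StrictTotalOrder as StrictTotalOrderProperties
open import Relation.Binary.PropositionalEquality.Core using (_≡_)
open import Relation.Binary.Structures using (IsStrictTotalOrder)
open import Relation.Nullary.Decidable.Core using (does)
open import Relation.Nullary.Negation.Core using (¬_)

------------------------------------------------------------------------
-- Deterministic Turing machines with a read-only input tape

data Direction : Set where
  left stay right : Direction

data State (n : ℕ) : Set where
  running       : Fin n → State n
  accept reject : State n

-- The input word is delimited by two end markers.
data InputCell (Σ : Set) : Set where
  leftEnd rightEnd : InputCell Σ
  symbol           : Σ → InputCell Σ

record Action (states tapes : ℕ) (Γ : Set) : Set where
  constructor action
  field
    next      : State states
    inputMove : Direction
    workMoves : Vec (Γ × Direction) tapes

record TuringMachine (Σ : Set) : Set where
  field
    states : ℕ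
    tapes  : ℕ
    marks  : ℕ

  -- The work alphabet: a blank (zero) and the remaining marks.
  Γ : Set
  Γ = Fin (suc marks)

  field
    start : Fin states
    δ     : Fin states → InputCell Σ → Vec Γ tapes → Action states tapes Γ

-- A two-way infinite work tape. Only the scanned cells are stored, those
-- on either side of the head being listed from the head outwards; all
-- other cells are blank.
record Tape (Γ : Set) : Set where
  constructor tape
  field
    before : List Γ
    head   : Γ
    after  : List Γ

  scannedCells : ℕ
  scannedCells = length before + suc (length after)

module _ {Γ : Set} (blank : Γ) where

  moveHead : Direction → Tape Γ → Tape Γ
  moveHead left  (tape []       a rs) = tape [] blank (a ∷ rs)
  moveHead left  (tape (l ∷ ls) a rs) = tape ls l (a ∷ rs)
  moveHead stay  t                    = t
  moveHead right (tape ls a [])       = tape (a ∷ ls) blank []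
  moveHead right (tape ls a (r ∷ rs)) = tape (a ∷ ls) r rs

  writeAndMove : Γ × Direction → Tape Γ → Tape Γ
  writeAndMove (a , d) (tape ls _ rs) = moveHead d (tape ls a rs)

-- Position 0 holds the left end marker, position 1 + i the i-th letter.
readInput : {Σ : Set} → List Σ → ℕ → InputCell Σ
readInput xs       zero          = leftEnd
readInput []       (suc i)       = rightEnd
readInput (x ∷ xs) (suc zero)    = symbol x
readInput (x ∷ xs) (suc (suc i)) = readInput xs (suc i)

-- The input head cannot go beyond the end markers, so that its position
-- is not an unbounded counter.
moveInput : ℕ → Direction → ℕ → ℕ
moveInput n left  i = pred i
moveInput n stay  i = i
moveInput n right i = suc i ⊓ suc n

module _ {Σ : Set} (M : TuringMachine Σ) where
  open TuringMachine M

  record Configuration : Set where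
    constructor configuration
    field
      state     : State states
      inputHead : ℕ
      workTapes : Vec (Tape Γ) tapes

  open Configuration public

  initial : Configuration
  initial = configuration (running start) 0
                          (Vec.replicate tapes (tape [] zero []))

  perform : List Σ → Configuration → Action states tapes Γ → Configuration
  perform xs (configuration _ i ts) (action q d ws) =
    configuration q (moveInput (length xs) d i)
                  (Vec.zipWith (writeAndMove zero) ws ts)

  step : List Σ → Configuration → Configuration
  step xs c@(configuration (running q) i ts) =
    perform xs c (δ q (readInput xs i) (Vec.map Tape.head ts))
  step xs c@(configuration accept _ _) = c
  step xs c@(configuration reject _ _) = c

  run : List Σ → ℕ → Configuration
  run xs zero    = initial
  run xs (suc t) = step xs (run xs t)

  space : Configuration → ℕ
  space c = Vec.sum (Vec.map Tape.scannedCells (workTapes c))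

  Accepts Rejects Halts : List Σ → Set
  Accepts xs = ∃[ t ] state (run xs t) ≡ accept
  Rejects xs = ∃[ t ] state (run xs t) ≡ reject
  Halts   xs = Accepts xs ⊎ Rejects xs

  -- Scanned cells are never forgotten, so the bound at all times t bounds
  -- the number of work cells scanned during the whole computation.
  IsLogSpace : Set
  IsLogSpace =
    (∀ xs → Halts xs) ×
    (∃[ c ] ∀ xs t → space (run xs t) ≤ c * suc ⌈log₂ length xs ⌉)

------------------------------------------------------------------------
-- Finite ordered graphs

record OrderedGraph : Set₁ where
  infix 4 _~_ _~?_ _<_
  field
    V                  : Set
    size               : ℕ
    finite             : Fin size ↔ V
    _~_                : Rel V 0ℓ
    _~?_               : Decidable _~_
    ~-sym              : Symmetric _~_
    ~-irrefl           : Irreflexive _≡_ _~_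
    _<_                : Rel V 0ℓ
    isStrictTotalOrder : IsStrictTotalOrder _≡_ _<_

  strictTotalOrder : StrictTotalOrder 0ℓ 0ℓ 0ℓ
  strictTotalOrder = record { isStrictTotalOrder = isStrictTotalOrder }

  open IsStrictTotalOrder isStrictTotalOrder public using (_<?_)
  open Sort (StrictTotalOrderProperties.decTotalOrder strictTotalOrder)
    using (sort)

  -- All vertices, in increasing order with respect to _<_. This list does
  -- not depend on the enumeration given by finite.
  vertices : List V
  vertices = sort (map (Inverse.to finite) (allFin size))

  index : V → ℕ
  index v = length (filter (_<? v) vertices)

------------------------------------------------------------------------
-- Encoding

data Symbol : Set where
  bit : Bit → Symbol
  #   : Symbol

boolToBit : Bool → Bit
boolToBit false = 0b
boolToBit true  = 1b

-- Most significant bit first.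
binary : ℕ → List Bit
binary n = reverse (proj₁ (toDigits 2 n))

module _ (G : OrderedGraph) where
  open OrderedGraph G

  -- The adjacency matrix, row by row, with rows and columns in the order
  -- of _<_.
  encodeGraph : List Bit
  encodeGraph =
    concatMap (λ u → map (λ v → boolToBit (does (u ~? v))) vertices) vertices

  encode : V → V → List Symbol
  encode v w =
    map bit encodeGraph ++ [ # ] ++
    map bit (binary (index v)) ++ [ # ] ++
    map bit (binary (index w))

  DefinedBy : TuringMachine Symbol → Rel V 0ℓ
  DefinedBy M v w = Accepts M (encode v w)

------------------------------------------------------------------------
-- Traversals

  -- For v = vᵢ in the listing v₁ ≺ ⋯ ≺ vₙ, the set {v₁,…,vᵢ₋₁} is
  -- {x | x ≺ v}; the premise on u forces i ≥ 2.
  IsTraversal : Rel V 0ℓ → Set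
  IsTraversal _≺_ =
    ∀ v → (∃[ u ] ∃[ w ] u ≺ v × u ~ w × ¬ (w ≺ v)) →
    ∃[ x ] x ≺ v × v ~ x

{-# OPTIONS --safe #-}

-- Repeated from every start vertex s in turn, a deterministic walk from s which
-- covers the component of s lists all vertices; ordering them by their first
-- visit gives a traversal, since a vertex is either reached along an edge or
-- is a start vertex all of whose predecessors lie in exhausted components.
--
-- That such walks can be produced in logarithmic space is Reingold's theorem.
-- Replacing each vertex by a path gives a graph of bounded degree whose edge
-- labels act as permutations. Its spectral gap, at least 1/poly, is amplified
-- by L rounds of a zigzag product followed by powering: over the fibre K of
-- labels, a letter a moves k to h a k along a fixed expander on K and then
-- follows the edge labelled k. As every label acts as a permutation, no
-- rotation maps are needed; a walk upstairs projects to a walk downstairs whose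
-- labels are produced by one finite transducer per level. After L rounds, walks
-- of length L reach every vertex of the component. The expander is a Cayley
-- graph of a power of ℤ/2 with generators of small bias, found by the method of
-- conditional expectations.
--
-- The machine keeps, in cell i of its only work tape, the state of the i-th
-- transducer, the i-th label of the top walk and the i-th bits of all
-- numbers involved, so that every step is a sweep of a finite automaton.
module Submission where

-- No eigenvalues occur: every spectral statement is an inequality between sums of integer squares
-- with denominators cleared, and a squared contraction ratio is kept as m over m + r with r fixed.
-- One level turns m = b ^ (ℓ + 1) into b ^ ℓ, so ℓ levels lead from the ratio b ^ ℓ / (b ^ ℓ + r)
-- to 1 / (1 + r). The number of levels and the length of the top walk both have to equal the bit
-- length L of the vertex names, for a cell to hold one of each. This dictates the constants. The
-- gap at the base is of order 64 ^ (- L), which b = 65536 makes up for in L levels; r = 16 makes 17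
-- ^ L exceed the square of the number 4 ^ L of nodes. The power n must then be at least 64 (b + r)
-- / 49, and there must be an expander of degree |A| on the words of 2n letters over A. Bias 1/8
-- asks for |A| of the order of n log |A|, so a large enough alphabet closes the circle. These sizes
-- must never be unfolded: the machine is built for an arbitrary `Labelling`, and the concrete one
-- is abstract.

-- Integer arithmetic with opaque operations.

module Int where

  open import Data.Integer.Base using (ℤ; 0ℤ; 1ℤ; _≤_) renaming (+_ to pos)
  import Data.Integer.Base as ℤ
  import Data.Integer.Properties as ℤ
  open import Data.Nat.Base as ℕ using (ℕ; zero; suc)
  import Data.Nat.Properties as ℕ
  open import Relation.Binary.PropositionalEquality

  infixl 6 _+_ _-_
  infixl 7 _*_
  infix  8 -_
  infix  9 _²

  -- Opaque copies of the operations: the ones of the library unfold during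
  -- unification, which then fails to infer their arguments.
  opaque
    _+_ _*_ : ℤ → ℤ → ℤ
    _+_ = ℤ._+_
    _*_ = ℤ._*_

    -_ : ℤ → ℤ
    -_ = ℤ.-_

  _-_ : ℤ → ℤ → ℤ
  x - y = x + - y

  _² : ℤ → ℤ
  x ² = x * x

  _^_ : ℤ → ℕ → ℤ
  x ^ zero  = 1ℤ
  x ^ suc n = x * x ^ n

  infixr 8 _^_

  opaque
    unfolding _+_ _*_ -_

    +-identityˡ : ∀ x → 0ℤ + x ≡ x
    +-identityˡ = ℤ.+-identityˡ

    +-identityʳ : ∀ x → x + 0ℤ ≡ x
    +-identityʳ = ℤ.+-identityʳ

    *-identityˡ : ∀ x → 1ℤ * x ≡ x
    *-identityˡ = ℤ.*-identityˡ

    *-identityʳ : ∀ x → x * 1ℤ ≡ x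
    *-identityʳ = ℤ.*-identityʳ

    *-zeroˡ : ∀ x → 0ℤ * x ≡ 0ℤ
    *-zeroˡ = ℤ.*-zeroˡ

    *-zeroʳ : ∀ x → x * 0ℤ ≡ 0ℤ
    *-zeroʳ = ℤ.*-zeroʳ

    +-comm : ∀ x y → x + y ≡ y + x
    +-comm = ℤ.+-comm

    +-assoc : ∀ x y z → (x + y) + z ≡ x + (y + z)
    +-assoc = ℤ.+-assoc

    *-comm : ∀ x y → x * y ≡ y * x
    *-comm = ℤ.*-comm

    *-assoc : ∀ x y z → (x * y) * z ≡ x * (y * z)
    *-assoc = ℤ.*-assoc

    *-distribˡ-+ : ∀ x y z → x * (y + z) ≡ x * y + x * z
    *-distribˡ-+ = ℤ.*-distribˡ-+

    neg-distrib-+ : ∀ x y → - (x + y) ≡ - x + - y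
    neg-distrib-+ = ℤ.neg-distrib-+

    neg-0 : - 0ℤ ≡ 0ℤ
    neg-0 = refl

    pos-+ : ∀ m n → pos (m ℕ.+ n) ≡ pos m + pos n
    pos-+ = ℤ.pos-+

    pos-* : ∀ m n → pos (m ℕ.* n) ≡ pos m * pos n
    pos-* = ℤ.pos-*

    +-mono-≤ : ∀ {x y z w} → x ≤ y → z ≤ w → x + z ≤ y + w
    +-mono-≤ = ℤ.+-mono-≤

    *-monoˡ : ∀ {c x y} → 0ℤ ≤ c → x ≤ y → c * x ≤ c * y
    *-monoˡ {c} p = ℤ.*-monoˡ-≤-nonNeg c {{ℤ.nonNegative p}}

    *-cancelˡ : ∀ {x y} n → pos (suc n) * x ≤ pos (suc n) * y → x ≤ y
    *-cancelˡ n = ℤ.*-cancelˡ-≤-pos _ _ (pos (suc n))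

    cancelˡ : ∀ {c x y} → 0ℤ ℤ.< c → c * x ≤ c * y → x ≤ y
    cancelˡ {c} p = ℤ.*-cancelˡ-≤-pos _ _ c {{ℤ.positive p}}

    *-pos : ∀ {x y} → 0ℤ ℤ.< x → 0ℤ ℤ.< y → 0ℤ ℤ.< x * y
    *-pos {x} {y} p q = subst (ℤ._< x * y) (*-zeroʳ x) (ℤ.*-monoˡ-<-pos x {{ℤ.positive p}} q)

    diff-nonneg : ∀ {a b} → a ≤ b → 0ℤ ≤ b - a
    diff-nonneg = ℤ.i≤j⇒0≤j-i

    square-nonneg : ∀ x → 0ℤ ≤ x ²
    square-nonneg (pos zero)    = ℤ.≤-refl
    square-nonneg (pos (suc n)) = ℤ.+≤+ ℕ.z≤n
    square-nonneg (ℤ.-[1+ n ])  = ℤ.+≤+ ℕ.z≤n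

  pos-^ : ∀ m n → pos (m ℕ.^ n) ≡ pos m ^ n
  pos-^ m zero    = refl
  pos-^ m (suc n) = trans (pos-* m (m ℕ.^ n)) (cong (pos m *_) (pos-^ m n))

  +-monoʳ : ∀ {x y} c → x ≤ y → c + x ≤ c + y
  +-monoʳ c = +-mono-≤ {c} ℤ.≤-refl

  *-monoʳ : ∀ {c x y} → 0ℤ ≤ c → x ≤ y → x * c ≤ y * c
  *-monoʳ {c} {x} {y} p q = subst₂ _≤_ (*-comm c x) (*-comm c y) (*-monoˡ p q)

  +-nonneg : ∀ {x y} → 0ℤ ≤ x → 0ℤ ≤ y → 0ℤ ≤ x + y
  +-nonneg {x} {y} p q = subst (_≤ x + y) (+-identityˡ 0ℤ) (+-mono-≤ p q)

  *-nonneg : ∀ {x y} → 0ℤ ≤ x → 0ℤ ≤ y → 0ℤ ≤ x * y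
  *-nonneg {x} {y} p q = subst (_≤ x * y) (*-zeroʳ x) (*-monoˡ p q)

  pos-nonneg : ∀ n → 0ℤ ≤ pos n
  pos-nonneg n = ℤ.+≤+ ℕ.z≤n

  ^-nonneg : ∀ {x} n → 0ℤ ≤ x → 0ℤ ≤ x ^ n
  ^-nonneg zero    p = pos-nonneg 1
  ^-nonneg (suc n) p = *-nonneg p (^-nonneg n p)

  -- The usual shape of an inequality below: the difference is given as an expression which is
  -- visibly nonnegative, and what remains is an identity, mostly one for the ring solver.
  ≤-by : ∀ {a b} r → 0ℤ ≤ r → b ≡ a + r → a ≤ b
  ≤-by {a} r p refl = subst (_≤ a + r) (+-identityʳ a) (+-monoʳ a p)

  *-mono-≤ : ∀ {a b c d} → 0ℤ ≤ a → 0ℤ ≤ d → a ≤ b → c ≤ d → a * c ≤ b * d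
  *-mono-≤ p q r s = ℤ.≤-trans (*-monoˡ p s) (*-monoʳ q r)

  ^-distribˡ-* : ∀ x y n → (x * y) ^ n ≡ x ^ n * y ^ n
  ^-distribˡ-* x y zero    = sym (*-identityˡ 1ℤ)
  ^-distribˡ-* x y (suc n) = begin
    x * y * (x * y) ^ n       ≡⟨ cong (x * y *_) (^-distribˡ-* x y n) ⟩
    x * y * (x ^ n * y ^ n)   ≡⟨ *-assoc x y _ ⟩
    x * (y * (x ^ n * y ^ n)) ≡⟨ cong (x *_) (*-assoc y _ _) ⟨
    x * (y * x ^ n * y ^ n)   ≡⟨ cong (λ z → x * (z * y ^ n)) (*-comm y _) ⟩
    x * (x ^ n * y * y ^ n)   ≡⟨ cong (x *_) (*-assoc _ y _) ⟩
    x * (x ^ n * (y * y ^ n)) ≡⟨ *-assoc x _ _ ⟨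
    x * x ^ n * (y * y ^ n)   ∎
    where open ≡-Reasoning

  ^-pos : ∀ {x} n → 0ℤ ℤ.< x → 0ℤ ℤ.< x ^ n
  ^-pos zero    p = ℤ.+<+ (ℕ.s≤s ℕ.z≤n)
  ^-pos (suc n) p = *-pos p (^-pos n p)

  ℕ^-distribʳ-* : ∀ t m n → (m ℕ.* n) ℕ.^ t ≡ m ℕ.^ t ℕ.* n ℕ.^ t
  ℕ^-distribʳ-* zero    m n = refl
  ℕ^-distribʳ-* (suc t) m n =
    trans (cong (m ℕ.* n ℕ.*_) (ℕ^-distribʳ-* t m n)) (ℕ.[m*n]*[o*p]≡[m*o]*[n*p] m n (m ℕ.^ t) (n ℕ.^ t))

-- Finite sums and the Cauchy-Schwarz inequality.

module Sums where

  open import Data.Bool.Base using (Bool; true; false)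
  open import Data.Integer.Base using (ℤ; 0ℤ; 1ℤ; _≤_) renaming (+_ to pos)
  import Data.Integer.Properties as ℤ
  open import Data.Integer.Tactic.RingSolver using (solve-∀)
  open import Data.List.Base using (List; []; _∷_; _++_; map; length; cartesianProduct)
  open import Data.List.Membership.Propositional using (_∈_)
  import Data.List.Membership.Propositional.Properties as ∈
  open import Data.List.Relation.Unary.Any using (here; there)
  open import Data.Nat.Base as ℕ using (ℕ; zero; suc)
  open import Data.Product.Base using (_×_; _,_; proj₁; proj₂)
  open import Data.Vec.Base as Vec using (Vec; []; _∷_)
  open import Function.Base using (_∘_)
  open import Relation.Binary.PropositionalEquality
  open Int

  private
    variable
      A B : Set

  ∑ : List A → (A → ℤ) → ℤ
  ∑ []       f = 0ℤ
  ∑ (x ∷ xs) f = f x + ∑ xs f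

  ∑-cong : (xs : List A) {f g : A → ℤ} → (∀ x → f x ≡ g x) → ∑ xs f ≡ ∑ xs g
  ∑-cong []       e = refl
  ∑-cong (x ∷ xs) e = cong₂ _+_ (e x) (∑-cong xs e)

  ∑-0 : (xs : List A) → ∑ xs (λ _ → 0ℤ) ≡ 0ℤ
  ∑-0 []       = refl
  ∑-0 (x ∷ xs) = trans (+-identityˡ _) (∑-0 xs)

  ∑-zero : (xs : List A) {f : A → ℤ} → (∀ x → f x ≡ 0ℤ) → ∑ xs f ≡ 0ℤ
  ∑-zero xs e = trans (∑-cong xs e) (∑-0 xs)

  opaque
    unfolding _+_ _*_ -_
    interchange : ∀ a b c d → (a + b) + (c + d) ≡ (a + c) + (b + d)
    interchange = solve-∀

    suc-* : ∀ c n → c + n * c ≡ (1ℤ + n) * c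
    suc-* = solve-∀

    square-- : ∀ a b → (a - b) * (a - b) ≡ a * a + (pos 2 * (- a * b) + b * b)
    square-- = solve-∀

    cauchy-collect : ∀ n q s → n * q + (pos 2 * (- s * s) + n * q) ≡ pos 2 * (n * q) - pos 2 * (s * s)
    cauchy-collect = solve-∀

    +-cancel-- : ∀ a b → pos 2 * a ≡ pos 2 * b + (pos 2 * a - pos 2 * b)
    +-cancel-- = solve-∀

  ∑-+ : (xs : List A) (f g : A → ℤ) → ∑ xs (λ x → f x + g x) ≡ ∑ xs f + ∑ xs g
  ∑-+ []       f g = sym (+-identityˡ _)
  ∑-+ (x ∷ xs) f g = trans (cong (f x + g x +_) (∑-+ xs f g)) (interchange (f x) (g x) _ _)

  ∑-*ˡ : (xs : List A) (c : ℤ) (f : A → ℤ) → ∑ xs (λ x → c * f x) ≡ c * ∑ xs f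
  ∑-*ˡ []       c f = sym (*-zeroʳ c)
  ∑-*ˡ (x ∷ xs) c f = trans (cong (c * f x +_) (∑-*ˡ xs c f)) (sym (*-distribˡ-+ c (f x) _))

  ∑-*ʳ : (xs : List A) (c : ℤ) (f : A → ℤ) → ∑ xs (λ x → f x * c) ≡ ∑ xs f * c
  ∑-*ʳ xs c f = trans (∑-cong xs (λ x → *-comm (f x) c)) (trans (∑-*ˡ xs c f) (*-comm c _))

  ∑-neg : (xs : List A) (f : A → ℤ) → ∑ xs (λ x → - f x) ≡ - ∑ xs f
  ∑-neg []       f = sym neg-0
  ∑-neg (x ∷ xs) f = trans (cong (- f x +_) (∑-neg xs f)) (sym (neg-distrib-+ (f x) _))

  ∑-- : (xs : List A) (f g : A → ℤ) → ∑ xs (λ x → f x - g x) ≡ ∑ xs f - ∑ xs g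
  ∑-- xs f g = trans (∑-+ xs f (λ x → - g x)) (cong (∑ xs f +_) (∑-neg xs g))

  ∑-mono : (xs : List A) {f g : A → ℤ} → (∀ x → f x ≤ g x) → ∑ xs f ≤ ∑ xs g
  ∑-mono []       h = ℤ.≤-refl
  ∑-mono (x ∷ xs) h = +-mono-≤ (h x) (∑-mono xs h)

  ∑-nonneg : (xs : List A) {f : A → ℤ} → (∀ x → 0ℤ ≤ f x) → 0ℤ ≤ ∑ xs f
  ∑-nonneg xs h = subst (_≤ ∑ xs _) (∑-0 xs) (∑-mono xs h)

  ∑-++ : (xs ys : List A) (f : A → ℤ) → ∑ (xs ++ ys) f ≡ ∑ xs f + ∑ ys f
  ∑-++ []       ys f = sym (+-identityˡ _)
  ∑-++ (x ∷ xs) ys f = trans (cong (f x +_) (∑-++ xs ys f)) (sym (+-assoc (f x) _ _))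

  ∑-map : (xs : List A) (h : A → B) (f : B → ℤ) → ∑ (map h xs) f ≡ ∑ xs (f ∘ h)
  ∑-map []       h f = refl
  ∑-map (x ∷ xs) h f = cong (f (h x) +_) (∑-map xs h f)

  ∑-swap : (xs : List A) (ys : List B) (f : A → B → ℤ) →
           ∑ xs (λ x → ∑ ys (f x)) ≡ ∑ ys (λ y → ∑ xs (λ x → f x y))
  ∑-swap []       ys f = sym (∑-0 ys)
  ∑-swap (x ∷ xs) ys f = trans (cong (∑ ys (f x) +_) (∑-swap xs ys f)) (sym (∑-+ ys (f x) _))

  ∑-× : (xs : List A) (ys : List B) (f : A × B → ℤ) →
        ∑ (cartesianProduct xs ys) f ≡ ∑ xs (λ x → ∑ ys (λ y → f (x , y)))
  ∑-× []       ys f = refl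
  ∑-× (x ∷ xs) ys f = trans (∑-++ (map (x ,_) ys) _ f) (cong₂ _+_ (∑-map ys (x ,_) f) (∑-× xs ys f))

  ∑-const : (xs : List A) (c : ℤ) → ∑ xs (λ _ → c) ≡ pos (length xs) * c
  ∑-const []       c = sym (*-zeroˡ c)
  ∑-const (x ∷ xs) c = trans (cong (c +_) (∑-const xs c)) (trans (suc-* c _) (cong (_* c) (sym (pos-+ 1 _))))

  ∑-∈-≤ : {x : A} (xs : List A) {f : A → ℤ} → (∀ x → 0ℤ ≤ f x) → x ∈ xs → f x ≤ ∑ xs f
  ∑-∈-≤ (x ∷ xs) h (here refl) = ≤-by _ (∑-nonneg xs h) refl
  ∑-∈-≤ (x ∷ xs) h (there i)   = ℤ.≤-trans (∑-∈-≤ xs h i) (≤-by _ (h x) (+-comm _ _))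

  ∑² : List A → (A → ℤ) → ℤ
  ∑² xs f = ∑ xs (λ x → f x ²)

  ∑²-nonneg : (xs : List A) (f : A → ℤ) → 0ℤ ≤ ∑² xs f
  ∑²-nonneg xs f = ∑-nonneg xs (λ x → square-nonneg (f x))

  -- Lagrange's identity: the sum of (f x - f y)² over all ordered pairs is twice the difference of
  -- the two sides. The factor 2 is cancelled at the start.
  cauchy : (xs : List A) (f : A → ℤ) → (∑ xs f) ² ≤ pos (length xs) * ∑² xs f
  cauchy xs f = *-cancelˡ 1
    (≤-by _ (∑-nonneg xs λ x → ∑²-nonneg xs (λ y → f x - f y)) eq)
    where
      n = pos (length xs)
      isum : ∀ x → ∑ xs (λ y → (f x - f y) ²) ≡ n * f x ² + (pos 2 * (- f x * ∑ xs f) + ∑² xs f)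
      isum x = begin
        ∑ xs (λ y → (f x - f y) ²)
          ≡⟨ ∑-cong xs (λ y → square-- (f x) (f y)) ⟩
        ∑ xs (λ y → f x ² + (pos 2 * (- f x * f y) + f y ²))
          ≡⟨ ∑-+ xs _ _ ⟩
        ∑ xs (λ y → f x ²) + ∑ xs (λ y → pos 2 * (- f x * f y) + f y ²)
          ≡⟨ cong₂ _+_ (∑-const xs _) (∑-+ xs _ _) ⟩
        n * f x ² + (∑ xs (λ y → pos 2 * (- f x * f y)) + ∑² xs f)
          ≡⟨ cong (λ z → n * f x ² + (z + ∑² xs f)) (trans (∑-*ˡ xs _ _) (cong (pos 2 *_) (∑-*ˡ xs _ f))) ⟩
        n * f x ² + (pos 2 * (- f x * ∑ xs f) + ∑² xs f) ∎
        where open ≡-Reasoning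
      dsum : ∑ xs (λ x → ∑ xs (λ y → (f x - f y) ²)) ≡ pos 2 * (n * ∑² xs f) - pos 2 * (∑ xs f * ∑ xs f)
      dsum = begin
        ∑ xs (λ x → ∑ xs (λ y → (f x - f y) ²))
          ≡⟨ ∑-cong xs isum ⟩
        ∑ xs (λ x → n * f x ² + (pos 2 * (- f x * ∑ xs f) + ∑² xs f))
          ≡⟨ ∑-+ xs _ _ ⟩
        ∑ xs (λ x → n * f x ²) + ∑ xs (λ x → pos 2 * (- f x * ∑ xs f) + ∑² xs f)
          ≡⟨ cong₂ _+_ (∑-*ˡ xs _ _) (∑-+ xs _ _) ⟩
        n * ∑² xs f + (∑ xs (λ x → pos 2 * (- f x * ∑ xs f)) + ∑ xs (λ _ → ∑² xs f))
          ≡⟨ cong (n * ∑² xs f +_) (cong₂ _+_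
               (trans (∑-*ˡ xs _ _) (cong (pos 2 *_) (trans (∑-*ʳ xs _ _) (cong (_* ∑ xs f) (∑-neg xs f)))))
               (∑-const xs _)) ⟩
        n * ∑² xs f + (pos 2 * (- ∑ xs f * ∑ xs f) + n * ∑² xs f)
          ≡⟨ cauchy-collect n (∑² xs f) (∑ xs f) ⟩
        pos 2 * (n * ∑² xs f) - pos 2 * (∑ xs f * ∑ xs f) ∎
        where open ≡-Reasoning
      eq : pos 2 * (n * ∑² xs f) ≡ pos 2 * (∑ xs f) ² + ∑ xs (λ x → ∑ xs (λ y → (f x - f y) ²))
      eq = trans (+-cancel-- _ _) (cong (pos 2 * (∑ xs f) ² +_) (sym dsum))

  -- The list acts as a measure: `card` and all sums count elements with their multiplicity in it,
  -- and the spectral estimates are inequalities between such sums.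
  record Finite : Set₁ where
    field
      Carrier  : Set
      elems    : List Carrier
      complete : ∀ x → x ∈ elems

    card : ℤ
    card = pos (length elems)

  open Finite public using (Carrier; elems; complete; card)

  Bools : Finite
  Bools = record
    { Carrier  = Bool
    ; elems    = false ∷ true ∷ []
    ; complete = λ { false → here refl ; true → there (here refl) } }

  infixr 7 _⊗_
  _⊗_ : Finite → Finite → Finite
  X ⊗ Y = record
    { Carrier  = Carrier X × Carrier Y
    ; elems    = cartesianProduct (elems X) (elems Y)
    ; complete = λ { (x , y) → ∈.∈-cartesianProduct⁺ (complete X x) (complete Y y) } }

  vectors : List A → (n : ℕ) → List (Vec A n)
  vectors xs zero    = [] ∷ []
  vectors xs (suc n) = map (λ p → proj₁ p ∷ proj₂ p) (cartesianProduct xs (vectors xs n))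

  infix 8 _^^_
  _^^_ : Finite → ℕ → Finite
  X ^^ n = record { Carrier = Vec (Carrier X) n ; elems = vectors (elems X) n ; complete = go }
    where
      go : ∀ {n} (v : Vec (Carrier X) n) → v ∈ vectors (elems X) n
      go []      = here refl
      go (x ∷ v) = ∈.∈-map⁺ (λ p → proj₁ p ∷ proj₂ p) (∈.∈-cartesianProduct⁺ (complete X x) (go v))

  ∑-vectors : (xs : List A) {n : ℕ} (f : Vec A (suc n) → ℤ) →
              ∑ (vectors xs (suc n)) f ≡ ∑ xs (λ x → ∑ (vectors xs n) (λ v → f (x ∷ v)))
  ∑-vectors xs {n} f = trans (∑-map (cartesianProduct xs (vectors xs n)) _ f) (∑-× xs (vectors xs n) _)

  ∑-1 : (xs : List A) → ∑ xs (λ _ → 1ℤ) ≡ pos (length xs)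
  ∑-1 xs = trans (∑-const xs 1ℤ) (*-identityʳ _)

  card-⊗ : ∀ X Y → card (X ⊗ Y) ≡ card X * card Y
  card-⊗ X Y = begin
    card (X ⊗ Y)                                     ≡⟨ ∑-1 (elems (X ⊗ Y)) ⟨
    ∑ (elems (X ⊗ Y)) (λ _ → 1ℤ)                     ≡⟨ ∑-× (elems X) (elems Y) _ ⟩
    ∑ (elems X) (λ _ → ∑ (elems Y) (λ _ → 1ℤ))       ≡⟨ ∑-cong (elems X) (λ _ → ∑-1 (elems Y)) ⟩
    ∑ (elems X) (λ _ → card Y)                       ≡⟨ ∑-const (elems X) _ ⟩
    card X * card Y                                  ∎
    where open ≡-Reasoning

  card-^^ : ∀ X n → card (X ^^ n) ≡ card X ^ n
  card-^^ X zero    = refl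
  card-^^ X (suc n) = begin
    card (X ^^ suc n)                                          ≡⟨ ∑-1 (elems (X ^^ suc n)) ⟨
    ∑ (elems (X ^^ suc n)) (λ _ → 1ℤ)                          ≡⟨ ∑-vectors (elems X) {n} _ ⟩
    ∑ (elems X) (λ _ → ∑ (elems (X ^^ n)) (λ _ → 1ℤ))          ≡⟨ ∑-cong (elems X) (λ _ → ∑-1 (elems (X ^^ n))) ⟩
    ∑ (elems X) (λ _ → card (X ^^ n))                          ≡⟨ ∑-const (elems X) _ ⟩
    card X * card (X ^^ n)                                     ≡⟨ cong (card X *_) (card-^^ X n) ⟩
    card X * card X ^ n                                      ∎
    where open ≡-Reasoning

  card-nonneg : ∀ X → 0ℤ ≤ card X
  card-nonneg X = pos-nonneg _

-- The zigzag product and its spectral estimate.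

module Spectral where

  open import Data.Bool.Base using (Bool; false)
  open import Data.Integer.Base using (ℤ; 0ℤ; _≤_; _<_) renaming (+_ to pos)
  import Data.Integer.Base as ℤ
  import Data.Integer.Properties as ℤ
  open import Data.Integer.Tactic.RingSolver using (solve-∀)
  open import Data.Nat.Base as ℕ using (ℕ)
  open import Data.Product.Base using (_×_; _,_)
  open import Relation.Binary.PropositionalEquality
  open Int
  open Sums

  opaque
    unfolding _+_ _*_ -_

    -- Convexity of the square, for the weights 49/64, 7/64 and 8/64.
    jensen-identity : ∀ a b e →
      pos 64 * (pos 49 * (a * a) + (pos 7 * (b * b) + pos 8 * (e * e))) ≡
      (pos 49 * a + (pos 7 * b + pos 8 * e)) * (pos 49 * a + (pos 7 * b + pos 8 * e)) +
      (pos 343 * ((a - b) * (a - b)) + (pos 392 * ((a - e) * (a - e)) + pos 56 * ((b - e) * (b - e))))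
    jensen-identity = solve-∀

    split-H : ∀ D d H S → pos 8 * D * H ≡ pos 7 * d * S + (pos 8 * D * H - pos 7 * d * S)
    split-H = solve-∀

    assemble : ∀ D d g jg2 m jb b2 →
      pos 8 * D * g ≡ pos 7 * d * jg2 + b2 →
      pos 8 * D * jg2 ≡ pos 7 * d * m + jb →
      pos 64 * (D * D) * g ≡ pos 49 * (d * d * m) + (pos 7 * (d * jb) + pos 8 * (D * b2))
    assemble D d g jg2 m jb b2 p q = begin
      pos 64 * (D * D) * g                              ≡⟨ e₁ D g ⟩
      pos 8 * D * (pos 8 * D * g)                       ≡⟨ cong (pos 8 * D *_) p ⟩
      pos 8 * D * (pos 7 * d * jg2 + b2)                ≡⟨ e₂ D d jg2 b2 ⟩
      pos 7 * d * (pos 8 * D * jg2) + pos 8 * (D * b2)  ≡⟨ cong (λ z → pos 7 * d * z + pos 8 * (D * b2)) q ⟩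
      pos 7 * d * (pos 7 * d * m + jb) + pos 8 * (D * b2) ≡⟨ e₃ D d m jb b2 ⟩
      pos 49 * (d * d * m) + (pos 7 * (d * jb) + pos 8 * (D * b2)) ∎
      where
        open ≡-Reasoning
        e₁ : ∀ D g → pos 64 * (D * D) * g ≡ pos 8 * D * (pos 8 * D * g)
        e₁ = solve-∀
        e₂ : ∀ D d jg2 b2 → pos 8 * D * (pos 7 * d * jg2 + b2) ≡ pos 7 * d * (pos 8 * D * jg2) + pos 8 * (D * b2)
        e₂ = solve-∀
        e₃ : ∀ D d m jb b2 → pos 7 * d * (pos 7 * d * m + jb) + pos 8 * (D * b2) ≡ pos 49 * (d * d * m) + (pos 7 * (d * jb) + pos 8 * (D * b2))
        e₃ = solve-∀

    square-* : ∀ a b → (a * b) * (a * b) ≡ (a * a) * (b * b)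
    square-* = solve-∀

    B-expand : ∀ D d H S →
      (pos 8 * D * H - pos 7 * d * S) * (pos 8 * D * H - pos 7 * d * S) ≡
      pos 64 * ((D * H - d * S) * (D * H - d * S)) + (pos 16 * (d * S) * (D * H - d * S) + d * S * (d * S))
    B-expand = solve-∀

    B-collect : ∀ D d S N →
      (d * d) * (D * D * N + (- (pos 2 * D * S) * S + D * (S * S))) + (pos 16 * (d * S) * 0ℤ + D * (d * S * (d * S))) ≡
      (d * D) * (d * D) * N
    B-collect = solve-∀

    centre-expand : ∀ D φ S → (D * φ - S) * (D * φ - S) ≡ D * D * (φ * φ) + (- (pos 2 * D * S) * φ + S * S)
    centre-expand = solve-∀

    centred : ∀ D S → D * S - D * S ≡ 0ℤ
    centred = solve-∀

    bound-a : ∀ q D d x → q * (D * (d * d * (d * d) * x)) ≡ D * (d * d * (d * d)) * (q * x)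
    bound-a = solve-∀
    bound-a′ : ∀ p D d y → D * (d * d * (d * d)) * (p * (D * D) * (D * y)) ≡ p * (d * d * (d * d) * (D * D * (D * D)) * y)
    bound-a′ = solve-∀
    bound-b : ∀ D d y → D * (d * d * (D * (d * D * (d * D) * y))) ≡ d * d * (d * d) * (D * D * (D * D)) * y
    bound-b = solve-∀
    bound-e : ∀ D d y → D * D * (d * D * (d * D) * (d * d * y)) ≡ d * d * (d * d) * (D * D * (D * D)) * y
    bound-e = solve-∀

    final-l : ∀ D q x → pos 64 * (D * D * (D * D)) * (pos 64 * q * x) ≡ q * (pos 64 * (D * D) * (pos 64 * (D * D)) * x)
    final-l = solve-∀
    final-m : ∀ q a b e → q * (pos 64 * (pos 49 * a + (pos 7 * b + pos 8 * e))) ≡ pos 64 * (pos 49 * (q * a) + (pos 7 * (q * b) + pos 8 * (q * e)))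
    final-m = solve-∀
    final-r : ∀ p q d D y → pos 64 * (pos 49 * (p * (d * D * y)) + (pos 7 * (q * (d * D * y)) + pos 8 * (q * (d * D * y)))) ≡
                      pos 64 * D * (d * (pos 49 * p + pos 15 * q) * y)
    final-r = solve-∀

  jensen : ∀ a b e → (pos 49 * a + (pos 7 * b + pos 8 * e)) ² ≤ pos 64 * (pos 49 * a ² + (pos 7 * b ² + pos 8 * e ²))
  jensen a b e = ≤-by _
    (+-nonneg (*-nonneg (pos-nonneg 343) (square-nonneg (a - b)))
      (+-nonneg (*-nonneg (pos-nonneg 392) (square-nonneg (a - e))) (*-nonneg (pos-nonneg 56) (square-nonneg (b - e)))))
    (jensen-identity a b e)

  ∑²-*ˡ : {X : Set} (xs : _) (c : ℤ) (f : X → ℤ) → ∑² xs (λ x → c * f x) ≡ c ² * ∑² xs f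
  ∑²-*ˡ xs c f = trans (∑-cong xs (λ x → square-* c (f x))) (∑-*ˡ xs _ _)

  -- Bijectivity enters the spectral argument only as this change of variables in sums. In this form
  -- it passes to products and composites by rewriting.
  Preserves : (X : Finite) → (Carrier X → Carrier X) → Set
  Preserves X π = ∀ f → ∑ (elems X) (λ x → f (π x)) ≡ ∑ (elems X) f

  -- The operator which sums over all letters has norm at most `card A` / 8 on functions of mean
  -- zero; 64 is the square of this 8.
  record IsExpander (A K : Finite) (h : Carrier A → Carrier K → Carrier K) : Set where
    field
      preserves : ∀ a → Preserves K (h a)
      contracts : ∀ φ → ∑ (elems K) φ ≡ 0ℤ →
                  pos 64 * ∑² (elems K) (λ k → ∑ (elems A) (λ a → φ (h a k))) ≤ card A ² * ∑² (elems K) φ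

  module Zigzag (A K : Finite) (h : Carrier A → Carrier K → Carrier K)
                (0<D : 0ℤ < card K) (expander : IsExpander A K h) where
    open IsExpander expander

    private
      d = card A
      D = card K
      As = elems A
      Ks = elems K

    H : (Carrier K → ℤ) → Carrier K → ℤ
    H φ k = ∑ As (λ a → φ (h a k))

    -- The remainder when an expander is split into 7/8 of averaging and 1/8 of a contraction:
    -- divided by d, `H` is 7/8 of the average over `K` plus 1/8 of `B` / (d D), an operator of norm
    -- at most 1 by `B-contracts`.
    B : (Carrier K → ℤ) → Carrier K → ℤ
    B φ k = pos 8 * D * H φ k - pos 7 * d * ∑ Ks φ

    ∑-H : ∀ φ → ∑ Ks (H φ) ≡ d * ∑ Ks φ
    ∑-H φ = begin
      ∑ Ks (H φ)                              ≡⟨ ∑-swap Ks As _ ⟩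
      ∑ As (λ a → ∑ Ks (λ k → φ (h a k)))     ≡⟨ ∑-cong As (λ a → preserves a φ) ⟩
      ∑ As (λ a → ∑ Ks φ)                     ≡⟨ ∑-const As _ ⟩
      d * ∑ Ks φ                              ∎
      where open ≡-Reasoning

    H-contracts : ∀ φ → ∑² Ks (H φ) ≤ d ² * ∑² Ks φ
    H-contracts φ = begin
      ∑² Ks (H φ)                                       ≤⟨ ∑-mono Ks (λ k → cauchy As (λ a → φ (h a k))) ⟩
      ∑ Ks (λ k → d * ∑ As (λ a → φ (h a k) ²))         ≡⟨ ∑-*ˡ Ks d _ ⟩
      d * ∑ Ks (H (λ k → φ k ²))                        ≡⟨ cong (d *_) (∑-H (λ k → φ k ²)) ⟩
      d * (d * ∑² Ks φ)                                 ≡⟨ *-assoc d d _ ⟨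
      d ² * ∑² Ks φ                                     ∎
      where open ℤ.≤-Reasoning

    -- For the centred function ψ = D φ - S, `B` φ is 8 `H` ψ + d S. The cross term vanishes because
    -- `H` ψ again sums to zero, 64 ‖H ψ‖² is at most d² ‖ψ‖² by expansion, and the pieces then add
    -- up to (d D)² ‖φ‖².
    B-contracts : ∀ φ → ∑² Ks (B φ) ≤ (d * D) ² * ∑² Ks φ
    B-contracts φ = begin
      ∑² Ks (B φ)
        ≡⟨ ∑-cong Ks (λ k → B-expand D d (H φ k) S) ⟩
      ∑ Ks (λ k → pos 64 * (D * H φ k - d * S) ² + (pos 16 * (d * S) * (D * H φ k - d * S) + d * S * (d * S)))
        ≡⟨ trans (∑-+ Ks _ _) (cong₂ _+_ (∑-*ˡ Ks _ _) (∑-+ Ks _ _)) ⟩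
      pos 64 * ∑² Ks (λ k → D * H φ k - d * S) + (∑ Ks (λ k → pos 16 * (d * S) * (D * H φ k - d * S)) + ∑ Ks (λ _ → d * S * (d * S)))
        ≡⟨ cong₂ _+_ (cong (pos 64 *_) (∑-cong Ks λ k → cong _² (sym (Hψ k))))
             (cong₂ _+_ (trans (∑-*ˡ Ks _ _) (cong (pos 16 * (d * S) *_) ∑Hψ)) (∑-const Ks _)) ⟩
      pos 64 * ∑² Ks (H ψ) + (pos 16 * (d * S) * 0ℤ + D * (d * S * (d * S)))
        ≤⟨ +-mono-≤ (contracts ψ ∑ψ) ℤ.≤-refl ⟩
      d ² * ∑² Ks ψ + (pos 16 * (d * S) * 0ℤ + D * (d * S * (d * S)))
        ≡⟨ cong (λ z → d ² * z + (pos 16 * (d * S) * 0ℤ + D * (d * S * (d * S)))) ∑²ψ ⟩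
      d ² * (D * D * ∑² Ks φ + (- (pos 2 * D * S) * S + D * (S * S))) + (pos 16 * (d * S) * 0ℤ + D * (d * S * (d * S)))
        ≡⟨ B-collect D d S (∑² Ks φ) ⟩
      (d * D) ² * ∑² Ks φ ∎
      where
        open ℤ.≤-Reasoning
        S = ∑ Ks φ
        ψ : Carrier K → ℤ
        ψ k = D * φ k - S
        ∑ψ : ∑ Ks ψ ≡ 0ℤ
        ∑ψ = trans (∑-- Ks _ _) (trans (cong₂ _-_ (∑-*ˡ Ks D φ) (∑-const Ks S)) (centred D S))
        Hψ : ∀ k → H ψ k ≡ D * H φ k - d * S
        Hψ k = trans (∑-- As _ _) (cong₂ _-_ (∑-*ˡ As D _) (∑-const As S))
        ∑Hψ : ∑ Ks (λ k → D * H φ k - d * S) ≡ 0ℤ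
        ∑Hψ = trans (∑-cong Ks (λ k → sym (Hψ k))) (trans (∑-H ψ) (trans (cong (d *_) ∑ψ) (*-zeroʳ d)))
        ∑²ψ : ∑² Ks ψ ≡ D * D * ∑² Ks φ + (- (pos 2 * D * S) * S + D * (S * S))
        ∑²ψ = trans (∑-cong Ks (λ k → centre-expand D (φ k) S))
          (trans (∑-+ Ks _ _) (cong₂ _+_ (∑-*ˡ Ks _ _)
            (trans (∑-+ Ks _ _) (cong₂ _+_ (∑-*ˡ Ks _ _) (∑-const Ks _)))))

    -- A regular graph on V, its edges being labelled by K in such a way that
    -- each label acts on V as a permutation; χ is a union of components.
    record Graph (V : Finite) : Set where
      field
        π           : Carrier K → Carrier V → Carrier V
        π-preserves : ∀ k → Preserves V (π k)
        χ           : Carrier V → Bool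
        χ-π         : ∀ k v → χ (π k v) ≡ χ v

      M : (Carrier V → ℤ) → Carrier V → ℤ
      M f v = ∑ Ks (λ k → f (π k v))

      Zero : (Carrier V → ℤ) → Set
      Zero f = (∀ v → χ v ≡ false → f v ≡ 0ℤ) × ∑ (elems V) f ≡ 0ℤ

      -- p / q bounds the squared norm of `M` / D on `Zero`. When χ is a single component, support
      -- in χ and total zero exclude the functions which are constant on components, so that p / q
      -- can be below 1 even in a disconnected graph.
      Bound : ℤ → ℤ → Set
      Bound p q = ∀ f → Zero f → q * ∑² (elems V) (M f) ≤ p * D ² * ∑² (elems V) f

      ∑-M : ∀ f → ∑ (elems V) (M f) ≡ D * ∑ (elems V) f
      ∑-M f = begin
        ∑ (elems V) (M f)                                    ≡⟨ ∑-swap (elems V) Ks _ ⟩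
        ∑ Ks (λ k → ∑ (elems V) (λ v → f (π k v)))           ≡⟨ ∑-cong Ks (λ k → π-preserves k f) ⟩
        ∑ Ks (λ k → ∑ (elems V) f)                           ≡⟨ ∑-const Ks _ ⟩
        D * ∑ (elems V) f                                    ∎
        where open ≡-Reasoning

      M-Zero : ∀ {f} → Zero f → Zero (M f)
      M-Zero {f} (s , z) =
        (λ v e → ∑-zero Ks (λ k → s (π k v) (trans (χ-π k v) e))) ,
        trans (∑-M f) (trans (cong (D *_) z) (*-zeroʳ D))

    module Level {V : Finite} (G : Graph V) where
      open Graph G
      private
        Vs = elems V

      Fun : Set
      Fun = Carrier V → Carrier K → ℤ

      ‖_‖² : Fun → ℤ
      ‖ g ‖² = ∑ Vs (λ v → ∑² Ks (g v))

      total : Fun → ℤ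
      total g = ∑ Vs (λ v → ∑ Ks (g v))

      R : Fun → Fun
      R g v k = g (π k v) k

      HH : Fun → Fun
      HH g v = H (g v)

      total-R : ∀ g → total (R g) ≡ total g
      total-R g = begin
        total (R g)                                     ≡⟨ ∑-swap Vs Ks _ ⟩
        ∑ Ks (λ k → ∑ Vs (λ v → g (π k v) k))           ≡⟨ ∑-cong Ks (λ k → π-preserves k (λ v → g v k)) ⟩
        ∑ Ks (λ k → ∑ Vs (λ v → g v k))                 ≡⟨ ∑-swap Vs Ks _ ⟨
        total g                                         ∎
        where open ≡-Reasoning

      ‖R‖ : ∀ g → ‖ R g ‖² ≡ ‖ g ‖²
      ‖R‖ g = total-R (λ v k → g v k ²)

      Zero₂ : Fun → Set
      Zero₂ g = (∀ v k → χ v ≡ false → g v k ≡ 0ℤ) × total g ≡ 0ℤ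

      R-Zero : ∀ {g} → Zero₂ g → Zero₂ (R g)
      R-Zero {g} (s , z) = (λ v k e → s (π k v) k (trans (χ-π k v) e)) , trans (total-R g) z

      HH-Zero : ∀ {g} → Zero₂ g → Zero₂ (HH g)
      HH-Zero {g} (s , z) = (λ v k e → ∑-zero As (λ a → s v (h a k) e)) ,
        trans (∑-cong Vs (λ v → ∑-H (g v))) (trans (∑-*ˡ Vs d _) (trans (cong (d *_) z) (*-zeroʳ d)))

      -- With 8 D H = 7 d J + B, where J sums over the fibre, the operator H R H
      -- is 49/64 of its projection J R J plus terms without expansion.
      zigzag : ∀ {p q} → 0ℤ ≤ q → 0ℤ ≤ p → Bound p q → ∀ g → Zero₂ g →
               pos 64 * q * ‖ HH (R (HH g)) ‖² ≤ d ² ² * (pos 49 * p + pos 15 * q) * ‖ g ‖²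
      zigzag {p} {q} 0≤q 0≤p bound g (supp , zero-sum) =
        cancelˡ (*-pos (ℤ.+<+ (ℕ.s≤s ℕ.z≤n)) (*-pos (*-pos 0<D 0<D) (*-pos 0<D 0<D))) (begin
          pos 64 * D ² ² * (pos 64 * q * ‖ g₃ ‖²)
            ≡⟨ final-l D q _ ⟩
          q * ((pos 64 * D ²) ² * ‖ g₃ ‖²)
            ≡⟨ cong (q *_) (trans (sym (∑-*ˡ Vs _ _)) (∑-cong Vs λ v → sym (∑²-*ˡ Ks _ (g₃ v)))) ⟩
          q * ∑ Vs (λ v → ∑² Ks (λ k → pos 64 * D ² * g₃ v k))
            ≡⟨ cong (q *_) (∑-cong Vs λ v → ∑-cong Ks λ k → cong _² (assemble D d _ _ _ _ _ (eq₁ v k) (eq₂ v))) ⟩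
          q * ∑ Vs (λ v → ∑² Ks (λ k → pos 49 * a v + (pos 7 * b v + pos 8 * e v k)))
            ≤⟨ *-monoˡ 0≤q (∑-mono Vs λ v → ∑-mono Ks λ k → jensen (a v) (b v) (e v k)) ⟩
          q * ∑ Vs (λ v → ∑ Ks (λ k → pos 64 * (pos 49 * a v ² + (pos 7 * b v ² + pos 8 * e v k ²))))
            ≡⟨ cong (q *_) split ⟩
          q * (pos 64 * (pos 49 * Na + (pos 7 * Nb + pos 8 * Ne)))
            ≡⟨ final-m q Na Nb Ne ⟩
          pos 64 * (pos 49 * (q * Na) + (pos 7 * (q * Nb) + pos 8 * (q * Ne)))
            ≤⟨ *-monoˡ (pos-nonneg 64) (+-mono-≤ (*-monoˡ (pos-nonneg 49) Na≤)
                 (+-mono-≤ (*-monoˡ (pos-nonneg 7) (*-monoˡ 0≤q Nb≤)) (*-monoˡ (pos-nonneg 8) (*-monoˡ 0≤q Ne≤)))) ⟩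
          pos 64 * (pos 49 * (p * (d ² ² * D ² ² * ‖ g ‖²)) + (pos 7 * (q * (d ² ² * D ² ² * ‖ g ‖²)) + pos 8 * (q * (d ² ² * D ² ² * ‖ g ‖²))))
            ≡⟨ final-r p q (d ² ²) (D ² ²) _ ⟩
          pos 64 * D ² ² * (d ² ² * (pos 49 * p + pos 15 * q) * ‖ g ‖²) ∎)
        where
          open ℤ.≤-Reasoning
          g₂ g₃ Bg : Fun
          g₂ = R (HH g)
          g₃ = HH g₂
          Bg v = B (g v)
          Jg : Carrier V → ℤ
          Jg v = ∑ Ks (g v)
          -- The terms of 64 D² H R H: first J R J, which is `M` on the fibre sums, then J R B, then
          -- B R H. Only the first uses the gap of `M`; with the weights 49, 7 and 8 of `jensen`,
          -- the gap 1 - p / q is multiplied by 49/64.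
          a b : Carrier V → ℤ
          a v = d * d * M Jg v
          b v = d * ∑ Ks (R Bg v)
          e : Fun
          e v k = D * B (g₂ v) k
          Na = ∑ Vs (λ v → ∑ Ks (λ k → a v ²))
          Nb = ∑ Vs (λ v → ∑ Ks (λ k → b v ²))
          Ne = ∑ Vs (λ v → ∑ Ks (λ k → e v k ²))
          eq₁ : ∀ v k → pos 8 * D * g₃ v k ≡ pos 7 * d * ∑ Ks (g₂ v) + B (g₂ v) k
          eq₁ v k = split-H D d _ _
          eq₂ : ∀ v → pos 8 * D * ∑ Ks (g₂ v) ≡ pos 7 * d * M Jg v + ∑ Ks (R Bg v)
          eq₂ v = trans (sym (∑-*ˡ Ks _ _)) (trans (∑-cong Ks (λ k → split-H D d (H (g (π k v)) k) (Jg (π k v))))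
            (trans (∑-+ Ks _ _) (cong (_+ ∑ Ks (R Bg v)) (∑-*ˡ Ks _ _))))
          pull : (c : ℤ) (u : Fun) → ∑ Vs (λ v → ∑ Ks (λ k → c * u v k)) ≡ c * total u
          pull c u = trans (∑-cong Vs (λ v → ∑-*ˡ Ks c (u v))) (∑-*ˡ Vs c _)
          add : (u w : Fun) → ∑ Vs (λ v → ∑ Ks (λ k → u v k + w v k)) ≡ total u + total w
          add u w = trans (∑-cong Vs (λ v → ∑-+ Ks (u v) (w v))) (∑-+ Vs _ _)
          split : ∑ Vs (λ v → ∑ Ks (λ k → pos 64 * (pos 49 * a v ² + (pos 7 * b v ² + pos 8 * e v k ²)))) ≡
                  pos 64 * (pos 49 * Na + (pos 7 * Nb + pos 8 * Ne))
          split = trans (pull _ _) (cong (pos 64 *_) (trans (add _ _) (cong₂ _+_ (pull _ _)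
            (trans (add _ _) (cong₂ _+_ (pull _ _) (pull _ _))))))
          J-Zero : Zero Jg
          J-Zero = (λ v x → ∑-zero Ks (λ k → supp v k x)) , zero-sum
          J-norm : (u : Fun) → ∑² Vs (λ v → ∑ Ks (u v)) ≤ D * ‖ u ‖²
          J-norm u = ℤ.≤-trans (∑-mono Vs (λ v → cauchy Ks (u v))) (ℤ.≤-reflexive (∑-*ˡ Vs D _))
          B-norm : (u : Fun) → ∑ Vs (λ v → ∑² Ks (B (u v))) ≤ (d * D) ² * ‖ u ‖²
          B-norm u = ℤ.≤-trans (∑-mono Vs (λ v → B-contracts (u v))) (ℤ.≤-reflexive (∑-*ˡ Vs _ _))
          H-norm : (u : Fun) → ‖ HH u ‖² ≤ d ² * ‖ u ‖²
          H-norm u = ℤ.≤-trans (∑-mono Vs (λ v → H-contracts (u v))) (ℤ.≤-reflexive (∑-*ˡ Vs _ _))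
          const-fibre : (u : Carrier V → ℤ) → ∑ Vs (λ v → ∑ Ks (λ k → u v)) ≡ D * ∑ Vs u
          const-fibre u = trans (∑-cong Vs (λ v → ∑-const Ks (u v))) (∑-*ˡ Vs D u)
          0≤D : 0ℤ ≤ D
          0≤D = card-nonneg K
          Na≤ : q * Na ≤ p * (d ² ² * D ² ² * ‖ g ‖²)
          Na≤ = begin
            q * Na                                            ≡⟨ cong (q *_) (trans (const-fibre _) (cong (D *_) (∑²-*ˡ Vs _ (M Jg)))) ⟩
            q * (D * (d ² ² * ∑² Vs (M Jg)))                  ≡⟨ bound-a q D d _ ⟩
            D * d ² ² * (q * ∑² Vs (M Jg))                    ≤⟨ *-monoˡ (*-nonneg 0≤D (square-nonneg (d * d))) (bound Jg J-Zero) ⟩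
            D * d ² ² * (p * D ² * ∑² Vs Jg)                  ≤⟨ *-monoˡ (*-nonneg 0≤D (square-nonneg (d * d)))
                                                                   (*-monoˡ (*-nonneg 0≤p (square-nonneg D)) (J-norm g)) ⟩
            D * d ² ² * (p * D ² * (D * ‖ g ‖²))              ≡⟨ bound-a′ p D d _ ⟩
            p * (d ² ² * D ² ² * ‖ g ‖²)                      ∎
          Nb≤ : Nb ≤ d ² ² * D ² ² * ‖ g ‖²
          Nb≤ = begin
            Nb                                                ≡⟨ trans (const-fibre _) (cong (D *_) (∑²-*ˡ Vs d _)) ⟩
            D * (d ² * ∑² Vs (λ v → ∑ Ks (R Bg v)))           ≤⟨ *-monoˡ 0≤D (*-monoˡ (square-nonneg d) (J-norm (R Bg))) ⟩
            D * (d ² * (D * ‖ R Bg ‖²))                       ≡⟨ cong (λ z → D * (d ² * (D * z))) (‖R‖ Bg) ⟩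
            D * (d ² * (D * ‖ Bg ‖²))                         ≤⟨ *-monoˡ 0≤D (*-monoˡ (square-nonneg d) (*-monoˡ 0≤D (B-norm g))) ⟩
            D * (d ² * (D * ((d * D) ² * ‖ g ‖²)))            ≡⟨ bound-b D d _ ⟩
            d ² ² * D ² ² * ‖ g ‖²                            ∎
          Ne≤ : Ne ≤ d ² ² * D ² ² * ‖ g ‖²
          Ne≤ = begin
            Ne                                                ≡⟨ trans (∑-cong Vs (λ v → ∑²-*ˡ Ks D _)) (∑-*ˡ Vs _ _) ⟩
            D ² * ∑ Vs (λ v → ∑² Ks (B (g₂ v)))               ≤⟨ *-monoˡ (square-nonneg D) (B-norm g₂) ⟩
            D ² * ((d * D) ² * ‖ g₂ ‖²)                       ≡⟨ cong (λ z → D ² * ((d * D) ² * z)) (‖R‖ (HH g)) ⟩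
            D ² * ((d * D) ² * ‖ HH g ‖²)                     ≤⟨ *-monoˡ (square-nonneg D) (*-monoˡ (square-nonneg (d * D)) (H-norm g)) ⟩
            D ² * ((d * D) ² * (d ² * ‖ g ‖²))                ≡⟨ bound-e D d _ ⟩
            d ² ² * D ² ² * ‖ g ‖²                            ∎

-- Label streams and the walk on nodes.

module Walk where

  open import Data.Bool.Base using (Bool; true; false; not; if_then_else_)
  open import Data.List.Base using (List; []; _∷_; _++_)
  open import Data.Nat.Base using (ℕ)
  open import Data.Product.Base using (_×_; _,_)
  open import Data.Vec.Base using (Vec; []; _∷_)

  module Stream {A K : Set} (h : A → K → K) (word : K → List A) where

    labels : K → List A → List K
    labels k []       = []
    labels k (a ∷ as) = h a k ∷ labels (h a k) as

    final : K → List A → K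
    final k []       = k
    final k (a ∷ as) = final (h a k) as

    -- The transducer of one level, its state being the fibre coordinate: a label κ from above is a
    -- word of letters, each of which moves the coordinate and emits it as a label for the graph
    -- below. The coordinate survives to the next κ.
    expand : K → List K → List K
    expand k []       = []
    expand k (κ ∷ κs) = labels k (word κ) ++ expand (final k (word κ)) κs

    -- The labels of the base graph along a walk in the graph ℓ levels above it
    -- which starts over the fibre coordinates ks and follows the labels κs.
    stream : ∀ {ℓ} → Vec K ℓ → List K → List K
    stream []       κs = κs
    stream (k ∷ ks) κs = expand k (stream ks κs)

  -- The idle generator makes the walk lazy, which removes the eigenvalue -1 of bipartite graphs. It
  -- also brings the number of generators to four, so that two bits select one of them uniformly.
  data Gen : Set where
    ide α β γ : Gen

  Bits : ℕ → Set
  Bits = Vec Bool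

  flip : ∀ {L} → Bits L → Bits L
  flip []       = []
  flip (b ∷ bs) = not b ∷ bs

  -- Flips the bit after the first 1; alternating with flip, this runs through
  -- all words in the order of the reflected Gray code.
  gray : ∀ {L} → Bits L → Bits L
  gray []           = []
  gray (true ∷ bs)  = true ∷ flip bs
  gray (false ∷ bs) = false ∷ gray bs

  -- The pairs (u , x) replace the vertex u by a path, the node x of which
  -- carries the possible edge from u to x.
  Node : ℕ → Set
  Node L = Bits L × Bits L

  module Nodes {L : ℕ} (adj : Bits L → Bits L → Bool) where

    act : Gen → Node L → Node L
    act ide p       = p
    act α   (u , x) = u , flip x
    act β   (u , x) = u , gray x
    act γ   (u , x) = if adj u x then (x , u) else (u , x)

    data Reachable (p : Node L) : Node L → Set where
      start : Reachable p p
      move  : ∀ g {q} → Reachable p q → Reachable p (act g q)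

-- Amplification of the spectral gap by iterated levels.

module Tower where

  open import Data.Bool.Base using (Bool; true; false)
  open import Data.Integer.Base using (ℤ; 0ℤ; 1ℤ; _≤_; _<_) renaming (+_ to pos)
  import Data.Integer.Base as ℤ
  import Data.Integer.Properties as ℤ
  open import Data.Integer.Tactic.RingSolver using (solve-∀)
  open import Data.List.Base as List using (List; []; _∷_; _++_; foldl)
  open import Data.Nat.Base as ℕ using (ℕ; zero; suc)
  open import Data.Product.Base using (_×_; _,_; proj₁; proj₂)
  open import Data.Vec.Base as Vec using (Vec; []; _∷_; toList)
  import Data.List.Properties as List
  open import Relation.Binary.PropositionalEquality
  open import Relation.Nullary.Negation using (¬_)
  open Int
  open Sums
  open Spectral
  open Walk

  opaque
    unfolding _+_ _*_ -_

    bernoulli-step : ∀ Q y n → Q * (Q + n * y) ≡ (Q - y) * (Q + (1ℤ + n) * y) + (1ℤ + n) * (y * y)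
    bernoulli-step = solve-∀

    power-regroup : ∀ a b x y → (a * b) * (x * y) ≡ (a * x) * (b * y)
    power-regroup = solve-∀

    P-Q : ∀ m r → pos 49 * m + pos 15 * (m + r) ≡ pos 64 * (m + r) - pos 49 * r
    P-Q = solve-∀

    level-l : ∀ Qn s t x → Qn * s * (t * x) ≡ s * t * (Qn * x)
    level-l = solve-∀
    level-m : ∀ s t P E x → s * t * (P * E * x) ≡ t * (P * s) * (E * x)
    level-m = solve-∀
    level-r : ∀ s Q Qn x → s * (Q * Qn) * x ≡ Qn * (s * Q) * x
    level-r = solve-∀
    level-f : ∀ Qn m s E x → Qn * (m * s) * (E * x) ≡ Qn * s * (m * E * x)
    level-f = solve-∀
    level-c : ∀ Q m y n → m * (Q + n * y) ≡ (m * Q) + (m * n) * y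
    level-c = solve-∀
    level-d : ∀ Q m r → (m + r) * Q ≡ m * Q + Q * r
    level-d = solve-∀
    level-e : ∀ m n r → (pos 49 * n * m) * r ≡ (m * n) * (pos 49 * r)
    level-e = solve-∀

    scale : ∀ b r x → pos 64 * (b * x + r) + pos 64 * r * (x - 1ℤ) ≡ pos 64 * (b + r) * x
    scale = solve-∀

    expand-F : ∀ N m a b → (N * a - m * b) * (N * a - m * b) ≡ N * N * (a * a) + (- (pos 2 * N * m) * (a * b) + m * m * (b * b))
    expand-F = solve-∀
    collect-F : ∀ N m → m * (N * N) ≡ N * N * m + (- (pos 2 * N * m) * m + m * m * N) + N * (m * m)
    collect-F = solve-∀

    square-neg : ∀ x → (- x) * (- x) ≡ x * x
    square-neg = solve-∀
    miss : ∀ N m → N * 0ℤ - m * 1ℤ ≡ - m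
    miss = solve-∀
    cover-l : ∀ s l t m → s * (l * ((t * t) * m)) ≡ (t * t * l) * (s * m)
    cover-l = solve-∀
    zero-F : ∀ N m → N * m - m * N ≡ 0ℤ
    zero-F = solve-∀
    *-swap₃ : ∀ a b c → a * (b * c) ≡ b * (a * c)
    *-swap₃ = solve-∀
    iter-l : ∀ a b x → a * b * x ≡ b * (a * x)
    iter-l = solve-∀

  -- (1 - y/Q)^n ≤ 1 / (1 + n y/Q), cleared of denominators.
  bernoulli : ∀ Q y n → 0ℤ ≤ Q → 0ℤ ≤ Q - y → (Q - y) ^ n * (Q + pos n * y) ≤ Q * Q ^ n
  bernoulli Q y zero 0≤Q _ = ℤ.≤-reflexive (begin
    1ℤ * (Q + 0ℤ * y)  ≡⟨ *-identityˡ _ ⟩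
    Q + 0ℤ * y         ≡⟨ cong (Q +_) (*-zeroˡ y) ⟩
    Q + 0ℤ             ≡⟨ +-identityʳ Q ⟩
    Q                  ≡⟨ *-identityʳ Q ⟨
    Q * 1ℤ             ∎)
    where open ≡-Reasoning
  bernoulli Q y (suc n) 0≤Q 0≤Q-y = begin
    (Q - y) * (Q - y) ^ n * (Q + pos (suc n) * y)    ≡⟨ cong (λ z → (Q - y) * (Q - y) ^ n * (Q + z * y)) (pos-+ 1 n) ⟩
    (Q - y) * (Q - y) ^ n * (Q + (1ℤ + pos n) * y)   ≡⟨ iter-l (Q - y) _ _ ⟩
    (Q - y) ^ n * ((Q - y) * (Q + (1ℤ + pos n) * y)) ≤⟨ *-monoˡ (^-nonneg n 0≤Q-y) (≤-by _
                                                         (*-nonneg (+-nonneg (pos-nonneg 1) (pos-nonneg n)) (square-nonneg y))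
                                                         (bernoulli-step Q y (pos n))) ⟩
    (Q - y) ^ n * (Q * (Q + pos n * y))              ≡⟨ *-swap₃ _ Q _ ⟩
    Q * ((Q - y) ^ n * (Q + pos n * y))              ≤⟨ *-monoˡ 0≤Q (bernoulli Q y n 0≤Q 0≤Q-y) ⟩
    Q * (Q * Q ^ n)                                  ∎
    where open ℤ.≤-Reasoning

  iter : {X : Set} → ℕ → (X → X) → X → X
  iter zero    f x = x
  iter (suc n) f x = f (iter n f x)

  ind : Bool → ℤ
  ind true  = 1ℤ
  ind false = 0ℤ

  ind-nonneg : ∀ b → 0ℤ ≤ ind b
  ind-nonneg true  = pos-nonneg 1
  ind-nonneg false = pos-nonneg 0

  ind≤1 : ∀ b → ind b ≤ 1ℤ
  ind≤1 true  = ℤ.≤-refl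
  ind≤1 false = pos-nonneg 1

  module Levels
    (A : Finite) (n : ℕ)
    (h : Carrier A → Vec (Carrier A) (n ℕ.* 2) → Vec (Carrier A) (n ℕ.* 2))
    (0<d : 0ℤ < card A)
    (expander : IsExpander A (A ^^ (n ℕ.* 2)) h)
    where

    -- A label is a word of 2n letters, and such a word is a path of 2n steps over the fibre. Hence
    -- the powered product has the same labels as the graph below it, and levels can be iterated.
    Label : Set
    Label = Vec (Carrier A) (n ℕ.* 2)

    K : Finite
    K = A ^^ (n ℕ.* 2)

    private
      d = card A
      D = card K
      As = elems A
      Ks = elems K

      D≡ : D ≡ d ^ (n ℕ.* 2)
      D≡ = card-^^ A (n ℕ.* 2)

      0<D : 0ℤ < D
      0<D = subst (0ℤ <_) (sym D≡) (^-pos (n ℕ.* 2) 0<d)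

      0≤D : 0ℤ ≤ D
      0≤D = ℤ.<⇒≤ 0<D

      D² : (d ² ²) ^ n ≡ D ²
      D² = trans (go n) (sym (cong _² D≡))
        where
          go : ∀ n → (d ² ²) ^ n ≡ (d ^ (n ℕ.* 2)) ²
          go zero    = sym (*-identityˡ 1ℤ)
          go (suc n) = trans (cong (d ² ² *_) (go n))
            (trans (power-regroup _ _ _ _) (cong _² (*-assoc d d _)))

    open Stream {Carrier A} {Label} h toList public

    open Zigzag A K h 0<D expander public using (Graph; module Graph)
    open Zigzag A K h 0<D expander using (module Level)

    runs : ∀ {V} → Graph V → List Label → Carrier V → Carrier V
    runs G κs v = foldl (λ v κ → Graph.π G κ v) v κs

    module _ {V : Finite} (G : Graph V) where
      open Graph G
      open Level G
      private
        Vs = elems V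

      run : ∀ {i} → Vec (Carrier A) i → Carrier V × Label → Carrier V × Label
      run []       s       = s
      run (a ∷ as) (v , k) = run as (π (h a k) v , h a k)

      T : Fun → Fun
      T g = HH (R g)

      T-Zero : ∀ {g} → Zero₂ g → Zero₂ (T g)
      T-Zero z = HH-Zero (R-Zero z)

      iterT-Zero : ∀ i {g} → Zero₂ g → Zero₂ (iter i T g)
      iterT-Zero zero    z = z
      iterT-Zero (suc i) z = T-Zero (iterT-Zero i z)

      ∑-run : ∀ i (f : Carrier V × Label → ℤ) v k → ∑ (vectors As i) (λ κ → f (run κ (v , k))) ≡ iter i T (λ v k → f (v , k)) v k
      ∑-run zero    f v k = +-identityʳ _
      ∑-run (suc i) f v k = trans (∑-vectors As {i} _) (∑-cong As (λ a → ∑-run i f (π (h a k) v) (h a k)))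

      run-preserves : ∀ {i} (κ : Vec (Carrier A) i) → Preserves (V ⊗ K) (run κ)
      run-preserves []       f = refl
      run-preserves (a ∷ as) f = begin
        ∑ (elems (V ⊗ K)) (λ s → f (run (a ∷ as) s))
          ≡⟨ ∑-× Vs Ks _ ⟩
        ∑ Vs (λ v → ∑ Ks (λ k → f (run as (π (h a k) v , h a k))))
          ≡⟨ ∑-cong Vs (λ v → preserves a (λ k → f (run as (π k v , k)))) ⟩
        ∑ Vs (λ v → ∑ Ks (λ k → f (run as (π k v , k))))
          ≡⟨ total-R (λ v k → f (run as (v , k))) ⟩
        ∑ Vs (λ v → ∑ Ks (λ k → f (run as (v , k))))
          ≡⟨ ∑-× Vs Ks _ ⟨
        ∑ (elems (V ⊗ K)) (λ s → f (run as s))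
          ≡⟨ run-preserves as f ⟩
        ∑ (elems (V ⊗ K)) f ∎
        where
          open ≡-Reasoning
          open IsExpander expander

      χ-run : ∀ {i} (κ : Vec (Carrier A) i) s → χ (proj₁ (run κ s)) ≡ χ (proj₁ s)
      χ-run []       s       = refl
      χ-run (a ∷ as) (v , k) = trans (χ-run as _) (χ-π (h a k) v)

      level : Graph (V ⊗ K)
      level = record
        { π = run ; π-preserves = run-preserves ; χ = λ s → χ (proj₁ s) ; χ-π = χ-run }

      run-labels : ∀ {i} (κ : Vec (Carrier A) i) v k →
                   run κ (v , k) ≡ (runs G (labels k (toList κ)) v , final k (toList κ))
      run-labels []       v k = refl
      run-labels (a ∷ as) v k = run-labels as _ _

      runs-++ : ∀ κs κs′ v → runs G (κs ++ κs′) v ≡ runs G κs′ (runs G κs v)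
      runs-++ κs κs′ v = List.foldl-++ _ v κs κs′

      runs-level : ∀ κs v k → proj₁ (runs level κs (v , k)) ≡ runs G (expand k κs) v
      runs-level []       v k = refl
      runs-level (κ ∷ κs) v k = trans (cong (λ s → proj₁ (runs level κs s)) (run-labels κ v k))
        (trans (runs-level κs _ _) (sym (runs-++ (labels k (toList κ)) _ v)))

      χ-runs : ∀ κs v → χ (runs G κs v) ≡ χ v
      χ-runs []       v = refl
      χ-runs (κ ∷ κs) v = trans (χ-runs κs (π κ v)) (χ-π κ v)

      -- `T` (`T` g) is H R H applied to `R` g, and `R` is an isometry. So `zigzag` applies to each
      -- pair of steps, which is why labels have even length.
      iterT-norm : ∀ i {p q} → 0ℤ ≤ q → 0ℤ ≤ p → Bound p q → ∀ g → Zero₂ g →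
        (pos 64 * q) ^ i * ‖ iter (i ℕ.* 2) T g ‖² ≤ (d ² ² * (pos 49 * p + pos 15 * q)) ^ i * ‖ g ‖²
      iterT-norm zero    0≤q 0≤p bound g z = ℤ.≤-refl
      iterT-norm (suc i) {p} {q} 0≤q 0≤p bound g z = begin
        (pos 64 * q) * (pos 64 * q) ^ i * ‖ T (T g′) ‖²                ≡⟨ iter-l (pos 64 * q) _ _ ⟩
        (pos 64 * q) ^ i * (pos 64 * q * ‖ T (T g′) ‖²)                ≤⟨ *-monoˡ (^-nonneg i (*-nonneg (pos-nonneg 64) 0≤q))
                                                                          (zigzag 0≤q 0≤p bound (R g′) (R-Zero (iterT-Zero (i ℕ.* 2) z))) ⟩
        (pos 64 * q) ^ i * (C * ‖ R g′ ‖²)                             ≡⟨ cong (λ x → (pos 64 * q) ^ i * (C * x)) (‖R‖ g′) ⟩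
        (pos 64 * q) ^ i * (C * ‖ g′ ‖²)                               ≡⟨ *-swap₃ _ C _ ⟩
        C * ((pos 64 * q) ^ i * ‖ g′ ‖²)                               ≤⟨ *-monoˡ (*-nonneg (square-nonneg (d ²))
                                                                            (+-nonneg (*-nonneg (pos-nonneg 49) 0≤p) (*-nonneg (pos-nonneg 15) 0≤q)))
                                                                          (iterT-norm i 0≤q 0≤p bound g z) ⟩
        C * (C ^ i * ‖ g ‖²)                                           ≡⟨ *-assoc C _ _ ⟨
        C * C ^ i * ‖ g ‖²                                             ∎
        where
          open ℤ.≤-Reasoning
          g′ = iter (i ℕ.* 2) T g
          C = d ² ² * (pos 49 * p + pos 15 * q)

      -- With y = 49 r and Q = 64 (m + r), a pair of steps has squared ratio at most 1 - y / Q. The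
      -- n-th power of this is at most Q / (Q + n y) by `bernoulli`, and the slack Q ≤ 49 n m′ makes
      -- that at most m′ / (m′ + r).
      level-bound : ∀ m r m′ → 0ℤ ≤ m → 0ℤ ≤ r → 0ℤ < m′ → 0ℤ < m + r →
        pos 64 * (m + r) ≤ pos 49 * pos n * m′ → Bound m (m + r) → Graph.Bound level m′ (m′ + r)
      level-bound m r m′ 0≤m 0≤r 0<m′ 0<m+r slack bound f (supp , z) =
        cancelˡ (*-pos (^-pos n 0<Q) 0<s) (begin
          Q ^ n * s * ((m′ + r) * ∑² (elems (V ⊗ K)) (Graph.M level f))
            ≡⟨ cong (λ x → Q ^ n * s * ((m′ + r) * x)) normM ⟩
          Q ^ n * s * ((m′ + r) * ‖ gM ‖²)
            ≡⟨ level-l (Q ^ n) s _ _ ⟩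
          s * (m′ + r) * (Q ^ n * ‖ gM ‖²)
            ≤⟨ *-monoˡ (*-nonneg (ℤ.<⇒≤ 0<s) 0≤m′+r) (iterT-norm n (ℤ.<⇒≤ 0<m+r) 0≤m bound g gz) ⟩
          s * (m′ + r) * ((d ² ² * P) ^ n * ‖ g ‖²)
            ≡⟨ cong (λ x → s * (m′ + r) * (x * ‖ g ‖²)) (trans (^-distribˡ-* (d ² ²) P n)
                 (trans (cong₂ _*_ D² (cong (_^ n) (P-Q m r))) (*-comm _ _))) ⟩
          s * (m′ + r) * ((Q - y) ^ n * D ² * ‖ g ‖²)
            ≡⟨ level-m s _ _ _ _ ⟩
          (m′ + r) * ((Q - y) ^ n * s) * (D ² * ‖ g ‖²)
            ≤⟨ *-monoʳ (*-nonneg (square-nonneg D) 0≤g) (*-monoˡ 0≤m′+r (bernoulli Q y n (ℤ.<⇒≤ 0<Q) 0≤Q-y)) ⟩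
          (m′ + r) * (Q * Q ^ n) * (D ² * ‖ g ‖²)
            ≡⟨ level-r (m′ + r) Q (Q ^ n) _ ⟩
          Q ^ n * ((m′ + r) * Q) * (D ² * ‖ g ‖²)
            ≤⟨ *-monoʳ (*-nonneg (square-nonneg D) 0≤g) (*-monoˡ (^-nonneg n (ℤ.<⇒≤ 0<Q)) key) ⟩
          Q ^ n * (m′ * s) * (D ² * ‖ g ‖²)
            ≡⟨ level-f (Q ^ n) m′ s _ _ ⟩
          Q ^ n * s * (m′ * D ² * ‖ g ‖²)
            ≡⟨ cong (λ x → Q ^ n * s * (m′ * D ² * x)) (∑-× Vs Ks _) ⟨
          Q ^ n * s * (m′ * D ² * ∑² (elems (V ⊗ K)) f) ∎)
        where
          open ℤ.≤-Reasoning
          g gM : Fun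
          g v k = f (v , k)
          gM = iter (n ℕ.* 2) T g
          Q = pos 64 * (m + r)
          y = pos 49 * r
          s = Q + pos n * y
          P = pos 49 * m + pos 15 * (m + r)
          0<Q : 0ℤ < Q
          0<Q = *-pos (ℤ.+<+ (ℕ.s≤s ℕ.z≤n)) 0<m+r
          0≤ny : 0ℤ ≤ pos n * y
          0≤ny = *-nonneg (pos-nonneg n) (*-nonneg (pos-nonneg 49) 0≤r)
          0<s : 0ℤ < s
          0<s = ℤ.<-≤-trans 0<Q (≤-by _ 0≤ny refl)
          0≤m′+r : 0ℤ ≤ m′ + r
          0≤m′+r = +-nonneg (ℤ.<⇒≤ 0<m′) 0≤r
          0≤g : 0ℤ ≤ ‖ g ‖²
          0≤g = ∑-nonneg Vs (λ v → ∑²-nonneg Ks (g v))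
          0≤Q-y : 0ℤ ≤ Q - y
          0≤Q-y = subst (0ℤ ≤_) (P-Q m r) (+-nonneg (*-nonneg (pos-nonneg 49) 0≤m) (*-nonneg (pos-nonneg 15) (ℤ.<⇒≤ 0<m+r)))
          gz : Zero₂ g
          gz = (λ v k → supp (v , k)) , trans (sym (∑-× Vs Ks f)) z
          normM : ∑² (elems (V ⊗ K)) (Graph.M level f) ≡ ‖ gM ‖²
          normM = trans (∑-× Vs Ks _) (∑-cong Vs λ v → ∑-cong Ks λ k → cong _² (∑-run (n ℕ.* 2) f v k))
          key : (m′ + r) * Q ≤ m′ * s
          key = begin
            (m′ + r) * Q                        ≡⟨ level-d Q m′ r ⟩
            m′ * Q + Q * r                      ≤⟨ +-monoʳ (m′ * Q) (*-monoʳ 0≤r slack) ⟩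
            m′ * Q + pos 49 * pos n * m′ * r    ≡⟨ cong (m′ * Q +_) (level-e m′ (pos n) r) ⟩
            m′ * Q + m′ * pos n * y             ≡⟨ level-c Q m′ y (pos n) ⟨
            m′ * s                              ∎

      ∑-runs : ∀ t (f : Carrier V → ℤ) v → ∑ (vectors Ks t) (λ ws → f (runs G (toList ws) v)) ≡ iter t M f v
      ∑-runs zero    f v = +-identityʳ _
      ∑-runs (suc t) f v = trans (∑-vectors Ks {t} _) (∑-cong Ks (λ k → ∑-runs t f (π k v)))

      iterM-Zero : ∀ t {f} → Zero f → Zero (iter t M f)
      iterM-Zero zero    z = z
      iterM-Zero (suc t) z = M-Zero (iterM-Zero t z)

      iterM-norm : ∀ t {q} → 0ℤ ≤ q → Bound 1ℤ q → ∀ f → Zero f →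
                   q ^ t * ∑² Vs (iter t M f) ≤ (D ²) ^ t * ∑² Vs f
      iterM-norm zero    0≤q bound f z = ℤ.≤-refl
      iterM-norm (suc t) {q} 0≤q bound f z = begin
        q * q ^ t * ∑² Vs (M f′)          ≡⟨ iter-l q _ _ ⟩
        q ^ t * (q * ∑² Vs (M f′))        ≤⟨ *-monoˡ (^-nonneg t 0≤q) (bound f′ (iterM-Zero t z)) ⟩
        q ^ t * (1ℤ * D ² * ∑² Vs f′)     ≡⟨ cong (λ x → q ^ t * (x * ∑² Vs f′)) (*-identityˡ (D ²)) ⟩
        q ^ t * (D ² * ∑² Vs f′)          ≡⟨ *-swap₃ _ (D ²) _ ⟩
        D ² * (q ^ t * ∑² Vs f′)          ≤⟨ *-monoˡ (square-nonneg D) (iterM-norm t 0≤q bound f z) ⟩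
        D ² * ((D ²) ^ t * ∑² Vs f)       ≡⟨ *-assoc (D ²) _ _ ⟨
        D ² * (D ²) ^ t * ∑² Vs f         ∎
        where
          open ℤ.≤-Reasoning
          f′ = iter t M f

    module Mixing (b r : ℕ) (0<b : 0 ℕ.< b) (slack : pos 64 * (pos b + pos r) ≤ pos 49 * pos n) where

      module _ where
        private
          0<b^ : ∀ ℓ → 0ℤ < pos b ^ ℓ
          0<b^ ℓ = ^-pos ℓ (ℤ.+<+ 0<b)

          -- The case ℓ = 0 is the hypothesis `slack`; the others follow from it by scaling, since r
          -- is at most r b ^ ℓ.
          slack-ℓ : ∀ ℓ → pos 64 * (pos b ^ suc ℓ + pos r) ≤ pos 49 * pos n * pos b ^ ℓ
          slack-ℓ ℓ = begin
            pos 64 * (pos b * x + pos r)   ≤⟨ ≤-by _ (*-nonneg (*-nonneg (pos-nonneg 64) (pos-nonneg r))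
                                                (diff-nonneg (ℤ.i<j⇒suc[i]≤j (0<b^ ℓ)))) (sym (scale (pos b) (pos r) x)) ⟩
            pos 64 * (pos b + pos r) * x   ≤⟨ *-monoʳ (ℤ.<⇒≤ (0<b^ ℓ)) slack ⟩
            pos 49 * pos n * x             ∎
            where
              open ℤ.≤-Reasoning
              x = pos b ^ ℓ

        level-bound-ℓ : ∀ ℓ {V} (G : Graph V) → Graph.Bound G (pos b ^ suc ℓ) (pos b ^ suc ℓ + pos r) →
                        Graph.Bound (level G) (pos b ^ ℓ) (pos b ^ ℓ + pos r)
        level-bound-ℓ ℓ G = level-bound G _ (pos r) _ (ℤ.<⇒≤ (0<b^ (suc ℓ))) (pos-nonneg r) (0<b^ ℓ)
          (ℤ.<-≤-trans (0<b^ (suc ℓ)) (≤-by (pos r) (pos-nonneg r) refl)) (slack-ℓ ℓ)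

      -- Induction up the tower: f is lifted to `V ⊗ K` as a function constant on fibres, and
      -- `runs-level` identifies walks upstairs with walks along `expand`. Summing over the new
      -- fibre is what brings in the average over all start coordinates ks. At ℓ = 0 the ratio 1 /
      -- (1 + r) is simply iterated.
      mixing : ∀ ℓ t {V} (G : Graph V) → Graph.Bound G (pos b ^ ℓ) (pos b ^ ℓ + pos r) →
        ∀ f → Graph.Zero G f →
        (1ℤ + pos r) ^ t * ∑ (elems V) (λ v → ∑ (vectors Ks ℓ) (λ ks →
          (∑ (vectors Ks t) (λ ws → f (runs G (stream ks (toList ws)) v))) ²))
        ≤ (D ²) ^ t * D ^ ℓ * ∑² (elems V) f
      mixing zero t {V} G bound f z = begin
        (1ℤ + pos r) ^ t * ∑ (elems V) (λ v → (∑ (vectors Ks t) (λ ws → f (runs G (toList ws) v))) ² + 0ℤ)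
          ≡⟨ cong ((1ℤ + pos r) ^ t *_) (∑-cong (elems V) (λ v → trans (+-identityʳ _) (cong _² (∑-runs G t f v)))) ⟩
        (1ℤ + pos r) ^ t * ∑² (elems V) (iter t (Graph.M G) f)
          ≤⟨ iterM-norm G t (+-nonneg (pos-nonneg 1) (pos-nonneg r)) bound f z ⟩
        (D ²) ^ t * ∑² (elems V) f
          ≡⟨ cong (_* ∑² (elems V) f) (*-identityʳ _) ⟨
        (D ²) ^ t * 1ℤ * ∑² (elems V) f ∎
        where open ℤ.≤-Reasoning
      mixing (suc ℓ) t {V} G bound f z = begin
        (1ℤ + pos r) ^ t * ∑ Vs (λ v → ∑ (vectors Ks (suc ℓ)) (λ ks → S v ks ²))
          ≡⟨ cong ((1ℤ + pos r) ^ t *_) (∑-cong Vs λ v → ∑-vectors Ks {ℓ} _) ⟩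
        (1ℤ + pos r) ^ t * ∑ Vs (λ v → ∑ Ks (λ k → ∑ (vectors Ks ℓ) (λ ks → S v (k ∷ ks) ²)))
          ≡⟨ cong ((1ℤ + pos r) ^ t *_) (∑-cong Vs λ v → ∑-cong Ks λ k → ∑-cong (vectors Ks ℓ) λ ks →
               cong _² (∑-cong (vectors Ks t) λ ws → cong f (sym (runs-level G (stream ks (toList ws)) v k)))) ⟩
        (1ℤ + pos r) ^ t * ∑ Vs (λ v → ∑ Ks (λ k → ∑ (vectors Ks ℓ) (λ ks → S′ (v , k) ks ²)))
          ≡⟨ cong ((1ℤ + pos r) ^ t *_) (∑-× Vs Ks _) ⟨
        (1ℤ + pos r) ^ t * ∑ (elems (V ⊗ K)) (λ s → ∑ (vectors Ks ℓ) (λ ks → S′ s ks ²))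
          ≤⟨ mixing ℓ t (level G) (level-bound-ℓ ℓ G bound) f′ z′ ⟩
        (D ²) ^ t * D ^ ℓ * ∑² (elems (V ⊗ K)) f′
          ≡⟨ cong ((D ²) ^ t * D ^ ℓ *_) (trans (∑-× Vs Ks _) (trans (∑-cong Vs (λ v → ∑-const Ks _)) (∑-*ˡ Vs D _))) ⟩
        (D ²) ^ t * D ^ ℓ * (D * ∑² Vs f)
          ≡⟨ trans (sym (*-assoc _ D _)) (cong (_* ∑² Vs f) (trans (*-assoc _ _ D) (cong ((D ²) ^ t *_) (*-comm _ D)))) ⟩
        (D ²) ^ t * (D * D ^ ℓ) * ∑² Vs f ∎
        where
          open ℤ.≤-Reasoning
          Vs = elems V
          S : Carrier V → Vec Label (suc ℓ) → ℤ
          S v ks = ∑ (vectors Ks t) (λ ws → f (runs G (stream ks (toList ws)) v))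
          f′ : Carrier V × Label → ℤ
          f′ s = f (proj₁ s)
          S′ : Carrier V × Label → Vec Label ℓ → ℤ
          S′ s ks = ∑ (vectors Ks t) (λ ws → f′ (runs (level G) (stream ks (toList ws)) s))
          z′ : Graph.Zero (level G) f′
          z′ = (λ s → proj₁ z (proj₁ s)) ,
               trans (∑-× Vs Ks _) (trans (∑-cong Vs (λ v → ∑-const Ks _)) (trans (∑-*ˡ Vs D f)
                 (trans (cong (D *_) (proj₂ z)) (*-zeroʳ D))))

      -- If no walk from x met Y, the mean-free combination of the indicators of
      -- Y and of the component would keep a constant value at x.
      covering : ∀ ℓ t {V} (G : Graph V) → Graph.Bound G (pos b ^ ℓ) (pos b ^ ℓ + pos r) →
        card V ² < (1ℤ + pos r) ^ t →
        (Y : Carrier V → Bool) → (∀ v → Y v ≡ true → Graph.χ G v ≡ true) →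
        ∀ x y → Graph.χ G x ≡ true → Y y ≡ true →
        ¬ (∀ (ks : Vec Label ℓ) (ws : Vec Label t) → Y (runs G (stream ks (toList ws)) x) ≡ false)
      covering ℓ t {V} G bound large Y Y⊆χ x y χx Yy avoid = ℤ.<-irrefl refl (begin-strict
        card V ²                       <⟨ large ⟩
        q ^ t                          ≡⟨ *-identityʳ _ ⟨
        q ^ t * 1ℤ                     ≤⟨ *-monoˡ (^-nonneg t 0≤q) 1≤m ⟩
        q ^ t * m                      ≤⟨ cancelˡ 0<m (cancelˡ (*-pos (^-pos t (*-pos 0<D 0<D)) (^-pos ℓ 0<D)) main) ⟩
        N ²                            ≤⟨ *-mono-≤ 0≤N (card-nonneg V) N≤ N≤ ⟩
        card V ²                       ∎)
        where
          open ℤ.≤-Reasoning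
          open Graph G
          Vs = elems V
          q = 1ℤ + pos r
          0≤q : 0ℤ ≤ q
          0≤q = +-nonneg (pos-nonneg 1) (pos-nonneg r)
          m = ∑ Vs (λ v → ind (Y v))
          N = ∑ Vs (λ v → ind (χ v))
          1≤m : 1ℤ ≤ m
          1≤m = subst (_≤ m) (cong ind Yy) (∑-∈-≤ Vs (λ v → ind-nonneg (Y v)) (complete V y))
          0<m : 0ℤ < m
          0<m = ℤ.<-≤-trans (ℤ.+<+ (ℕ.s≤s ℕ.z≤n)) 1≤m
          0≤N : 0ℤ ≤ N
          0≤N = ∑-nonneg Vs (λ v → ind-nonneg (χ v))
          N≤ : N ≤ card V
          N≤ = ℤ.≤-trans (∑-mono Vs (λ v → ind≤1 (χ v))) (ℤ.≤-reflexive (∑-1 Vs))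
          F : Carrier V → ℤ
          F v = N * ind (Y v) - m * ind (χ v)
          sq : ∀ b → ind b * ind b ≡ ind b
          sq true  = *-identityˡ _
          sq false = *-zeroˡ _
          Y-off : ∀ v → χ v ≡ false → Y v ≡ false
          Y-off v e with Y v in eq
          ... | false = refl
          ... | true with () ← trans (sym e) (Y⊆χ v eq)
          prod : ∀ v → ind (Y v) * ind (χ v) ≡ ind (Y v)
          prod v with Y v in eq
          ... | false = *-zeroˡ _
          ... | true rewrite Y⊆χ v eq = *-identityˡ _
          z : Zero F
          z = (λ v e → trans (cong₂ (λ a b → N * ind a - m * ind b) (Y-off v e) e)
                         (trans (cong₂ _-_ (*-zeroʳ N) (*-zeroʳ m)) (trans (cong (0ℤ +_) neg-0) (+-identityˡ _)))) ,
              trans (∑-- Vs _ _) (trans (cong₂ _-_ (∑-*ˡ Vs N _) (∑-*ˡ Vs m _)) (zero-F N m))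
          norm-F : ∑² Vs F ≤ m * N ²
          norm-F = ≤-by (N * m ²) (*-nonneg 0≤N (square-nonneg m)) (trans (collect-F N m) (cong (_+ N * m ²) (sym eq)))
            where
              eq : ∑² Vs F ≡ N * N * m + (- (pos 2 * N * m) * m + m * m * N)
              eq = trans (∑-cong Vs (λ v → trans (expand-F N m (ind (Y v)) (ind (χ v)))
                     (cong₂ (λ a b → N * N * a + b) (sq (Y v)) (cong₂ (λ a b → - (pos 2 * N * m) * a + m * m * b) (prod v) (sq (χ v))))))
                   (trans (∑-+ Vs _ _) (cong₂ _+_ (∑-*ˡ Vs _ _) (trans (∑-+ Vs _ _) (cong₂ _+_ (∑-*ˡ Vs _ _) (∑-*ˡ Vs _ _)))))
          S : Carrier V → Vec Label ℓ → ℤ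
          S v ks = ∑ (vectors Ks t) (λ ws → F (runs G (stream ks (toList ws)) v))
          S-x : ∀ ks → S x ks ≡ D ^ t * (- m)
          S-x ks = trans (∑-cong (vectors Ks t) (λ ws → trans
                     (cong₂ (λ a b → N * ind a - m * ind b) (avoid ks ws) (trans (χ-runs G (stream ks (toList ws)) x) χx)) (miss N m)))
                   (trans (∑-const (vectors Ks t) (- m)) (cong (_* - m) (card-^^ K t)))
          D^t² : (D ²) ^ t ≡ D ^ t * D ^ t
          D^t² = ^-distribˡ-* D D t
          -- Of the sum bounded by `mixing` only the term at x is kept. There every walk contributes
          -- - m, whatever its labels.
          main : (D ²) ^ t * D ^ ℓ * (m * (q ^ t * m)) ≤ (D ²) ^ t * D ^ ℓ * (m * N ²)
          main = begin
            (D ²) ^ t * D ^ ℓ * (m * (q ^ t * m))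
              ≡⟨ cong₂ _*_ (cong (_* D ^ ℓ) D^t²) (*-swap₃ m _ _) ⟩
            D ^ t * D ^ t * D ^ ℓ * (q ^ t * (m * m))
              ≡⟨ cover-l _ _ _ _ ⟨
            q ^ t * (D ^ ℓ * (D ^ t * D ^ t * (m * m)))
              ≡⟨ cong (λ z → q ^ t * (D ^ ℓ * z)) (trans (sym (square-neg′ (D ^ t) m)) refl) ⟩
            q ^ t * (D ^ ℓ * (D ^ t * (- m)) ²)
              ≡⟨ cong (λ z → q ^ t * z) (trans (cong (_* (D ^ t * (- m)) ²) (sym (card-^^ K ℓ))) (sym (∑-const (vectors Ks ℓ) _))) ⟩
            q ^ t * ∑ (vectors Ks ℓ) (λ ks → (D ^ t * (- m)) ²)
              ≡⟨ cong (q ^ t *_) (∑-cong (vectors Ks ℓ) (λ ks → cong _² (sym (S-x ks)))) ⟩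
            q ^ t * ∑ (vectors Ks ℓ) (λ ks → S x ks ²)
              ≤⟨ *-monoˡ (^-nonneg t 0≤q) (∑-∈-≤ Vs {λ v → ∑ (vectors Ks ℓ) (λ ks → S v ks ²)}
                   (λ v → ∑²-nonneg (vectors Ks ℓ) (S v)) (complete V x)) ⟩
            q ^ t * ∑ Vs (λ v → ∑ (vectors Ks ℓ) (λ ks → S v ks ²))
              ≤⟨ mixing ℓ t G bound F z ⟩
            (D ²) ^ t * D ^ ℓ * ∑² Vs F
              ≤⟨ *-monoˡ (*-nonneg (^-nonneg t (square-nonneg D)) (^-nonneg ℓ 0≤D)) norm-F ⟩
            (D ²) ^ t * D ^ ℓ * (m * N ²) ∎
            where
              square-neg′ : ∀ a m → (a * (- m)) ² ≡ a * a * (m * m)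
              square-neg′ a m = trans (square-* a (- m)) (cong (a * a *_) (square-neg m))

-- Cayley expanders from generators of small bias.

module Expander where

  open import Data.Bool.Base using (Bool; true; false; _xor_; _∧_)
  open import Data.Bool.Properties using (xor-assoc; xor-comm)
  open import Data.Integer.Base using (ℤ; 0ℤ; 1ℤ; _≤_; _<_) renaming (+_ to pos)
  import Data.Integer.Base as ℤ
  import Data.Integer.Properties as ℤ
  open import Data.Integer.Tactic.RingSolver using (solve-∀)
  open import Data.List.Base as List using (List; []; _∷_; length; cartesianProduct)
  open import Data.Nat.Base as ℕ using (ℕ; zero; suc)
  import Data.Nat.Properties as ℕ
  import Data.Nat.Tactic.RingSolver as ℕSolver
  open import Data.Product.Base using (_×_; _,_; proj₁; proj₂; ∃)
  open import Data.Sum.Base using (_⊎_; inj₁; inj₂)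
  open import Data.Vec.Base as Vec using (Vec; []; _∷_)
  open import Relation.Binary.PropositionalEquality
  open import Relation.Nullary using (yes; no)
  open import Relation.Nullary.Negation using (contradiction)
  open Int
  open Sums
  open Spectral

  sgn : Bool → ℤ
  sgn false = 1ℤ
  sgn true  = - 1ℤ

  opaque
    unfolding _+_ _*_ -_

    sgn-xor : ∀ a b → sgn (a xor b) ≡ sgn a * sgn b
    sgn-xor false false = refl
    sgn-xor false true  = refl
    sgn-xor true  false = refl
    sgn-xor true  true  = refl

    weight-false : pos 8 + sgn false ≡ pos 9
    weight-false = refl

    weight-true : pos 8 + sgn true ≡ pos 7
    weight-true = refl

    parallelogram : ∀ a b → (1ℤ * a + (1ℤ * b + 0ℤ)) * (1ℤ * a + (1ℤ * b + 0ℤ)) +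
                            ((1ℤ * a + (- 1ℤ * b + 0ℤ)) * (1ℤ * a + (- 1ℤ * b + 0ℤ)) + 0ℤ) ≡
                            pos 2 * (a * a + (b * b + 0ℤ))
    parallelogram = solve-∀

    sgn-sum : sgn false + (sgn true + 0ℤ) ≡ 0ℤ
    sgn-sum = refl

    shift-sgn : ∀ a b f → a * f ≡ (b * b) * (a * f)  → a * f ≡ b * ((a * b) * f)
    shift-sgn a b f p = trans p (assoc a b f)
      where
        assoc : ∀ a b f → (b * b) * (a * f) ≡ b * ((a * b) * f)
        assoc = solve-∀

    sgn² : ∀ b → sgn b * sgn b ≡ 1ℤ
    sgn² false = refl
    sgn² true  = refl

    bias-factor : ∀ p q → (p + q) * (p + q) ≡ pos 64 * ((p - q) * (p - q)) + (pos 9 * q - pos 7 * p) * (pos 9 * p - pos 7 * q)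
    bias-factor = solve-∀

    diff-+ : ∀ a b c d → (a - b) + (c - d) ≡ (a + c) - (b + d)
    diff-+ = solve-∀

    reassoc₁ : ∀ c b x → b * (c * x) ≡ c * (b * x)
    reassoc₁ = solve-∀

    square-scale : ∀ c b f → c * ((b * f) * (b * f)) ≡ (c * (b * b)) * (f * f)
    square-scale = solve-∀

  module Characters (X : Finite) (⟨_,_⟩ : Carrier X → Carrier X → Bool) where

    hat : (Carrier X → ℤ) → Carrier X → ℤ
    hat f χ = ∑ (elems X) (λ k → sgn ⟨ χ , k ⟩ * f k)

    Trivial : Carrier X → Set
    Trivial χ = ∀ k → ⟨ χ , k ⟩ ≡ false

    Balanced : Carrier X → Set
    Balanced χ = ∑ (elems X) (λ k → sgn ⟨ χ , k ⟩) ≡ 0ℤ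

  -- A finite group identified with its dual, the characters having values ±1, coded as bits. All
  -- fields pass to powers, so that `Bool-Fourier` and `Vec-Fourier` yield the group of labels.
  record Fourier (X : Finite) : Set where
    infixl 6 _⊕_
    field
      _⊕_       : Carrier X → Carrier X → Carrier X
      ⟨_,_⟩     : Carrier X → Carrier X → Bool
      additive  : ∀ χ k s → ⟨ χ , k ⊕ s ⟩ ≡ ⟨ χ , k ⟩ xor ⟨ χ , s ⟩
      translate : ∀ s → Preserves X (_⊕ s)

    open Characters X ⟨_,_⟩ public

    field
      plancherel          : ∀ f → ∑² (elems X) (hat f) ≡ card X * ∑² (elems X) f
      trivial-or-balanced : ∀ χ → Trivial χ ⊎ Balanced χ

  Bool-Fourier : Fourier Bools
  Bool-Fourier = record
    { _⊕_       = _xor_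
    ; ⟨_,_⟩     = _∧_
    ; additive  = λ { false k s → refl ; true k s → refl }
    ; translate = λ { false f → refl ; true f → trans (sym (+-assoc _ _ _)) (trans (cong (_+ 0ℤ) (+-comm _ _)) (+-assoc _ _ _)) }
    ; plancherel = λ f → parallelogram (f false) (f true)
    ; trivial-or-balanced = λ { false → inj₁ (λ k → refl) ; true → inj₂ sgn-sum }
    }

  module _ {X : Finite} (F : Fourier X) where
    open Fourier F
    private
      Xs = elems X

      _⊕ᵥ_ : ∀ {n} → Vec (Carrier X) n → Vec (Carrier X) n → Vec (Carrier X) n
      _⊕ᵥ_ = Vec.zipWith _⊕_

      ⟨_,_⟩ᵥ : ∀ {n} → Vec (Carrier X) n → Vec (Carrier X) n → Bool
      ⟨ [] , [] ⟩ᵥ         = false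
      ⟨ χ ∷ χs , k ∷ ks ⟩ᵥ = ⟨ χ , k ⟩ xor ⟨ χs , ks ⟩ᵥ

      xor-interchange : ∀ a b c d → (a xor b) xor (c xor d) ≡ (a xor c) xor (b xor d)
      xor-interchange false b c d = trans (sym (xor-assoc b c d)) (trans (cong (_xor d) (xor-comm b c)) (xor-assoc c b d))
      xor-interchange true false c d = not-xor c d
        where
          not-xor : ∀ c d → (true xor (c xor d)) ≡ ((true xor c) xor d)
          not-xor false d = refl
          not-xor true false = refl
          not-xor true true = refl
      xor-interchange true true false d = not-not d
        where
          not-not : ∀ d → d ≡ (true xor (true xor d))
          not-not false = refl
          not-not true = refl
      xor-interchange true true true d = refl

      additiveᵥ : ∀ {n} (χ k s : Vec (Carrier X) n) → ⟨ χ , k ⊕ᵥ s ⟩ᵥ ≡ ⟨ χ , k ⟩ᵥ xor ⟨ χ , s ⟩ᵥ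
      additiveᵥ []       []       []       = refl
      additiveᵥ (χ ∷ χs) (k ∷ ks) (s ∷ ss) =
        trans (cong₂ _xor_ (additive χ k s) (additiveᵥ χs ks ss)) (xor-interchange ⟨ χ , k ⟩ ⟨ χ , s ⟩ _ _)

      translateᵥ : ∀ {n} (s : Vec (Carrier X) n) → Preserves (X ^^ n) (_⊕ᵥ s)
      translateᵥ []       f = refl
      translateᵥ {suc n} (s ∷ ss) f = begin
        ∑ (vectors Xs (suc n)) (λ k → f (k ⊕ᵥ (s ∷ ss)))
          ≡⟨ ∑-vectors Xs {n} _ ⟩
        ∑ Xs (λ k → ∑ (vectors Xs n) (λ ks → f ((k ⊕ s) ∷ (ks ⊕ᵥ ss))))
          ≡⟨ ∑-cong Xs (λ k → translateᵥ ss (λ ks → f ((k ⊕ s) ∷ ks))) ⟩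
        ∑ Xs (λ k → ∑ (vectors Xs n) (λ ks → f ((k ⊕ s) ∷ ks)))
          ≡⟨ translate s (λ k → ∑ (vectors Xs n) (λ ks → f (k ∷ ks))) ⟩
        ∑ Xs (λ k → ∑ (vectors Xs n) (λ ks → f (k ∷ ks)))
          ≡⟨ ∑-vectors Xs {n} f ⟨
        ∑ (vectors Xs (suc n)) f ∎
        where open ≡-Reasoning

      ^ᵥ : ∀ {n} → (Vec (Carrier X) n → ℤ) → Vec (Carrier X) n → ℤ
      ^ᵥ {n} f χ = ∑ (vectors Xs n) (λ k → sgn ⟨ χ , k ⟩ᵥ * f k)

      -- The transform of a function of vectors is the transform in the tail of the one in the head,
      -- so the identity is multiplicative in the coordinates.
      plancherelᵥ : ∀ n (f : Vec (Carrier X) n → ℤ) →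
                    ∑² (vectors Xs n) (^ᵥ f) ≡ card (X ^^ n) * ∑² (vectors Xs n) f
      plancherelᵥ zero f = begin
        (1ℤ * f [] + 0ℤ) ² + 0ℤ  ≡⟨ cong (λ z → z ² + 0ℤ) (trans (+-identityʳ _) (*-identityˡ _)) ⟩
        f [] ² + 0ℤ              ≡⟨ *-identityˡ _ ⟨
        1ℤ * (f [] ² + 0ℤ)       ∎
        where open ≡-Reasoning
      plancherelᵥ (suc n) f = begin
        ∑² (vectors Xs (suc n)) (^ᵥ f)
          ≡⟨ ∑-vectors Xs {n} _ ⟩
        ∑ Xs (λ χ → ∑² Vs (λ χs → ^ᵥ f (χ ∷ χs)))
          ≡⟨ ∑-cong Xs (λ χ → ∑-cong Vs (λ χs → cong _² (split χ χs))) ⟩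
        ∑ Xs (λ χ → ∑² Vs (^ᵥ (λ ks → hat (λ k → f (k ∷ ks)) χ)))
          ≡⟨ ∑-cong Xs (λ χ → plancherelᵥ n _) ⟩
        ∑ Xs (λ χ → card (X ^^ n) * ∑² Vs (λ ks → hat (λ k → f (k ∷ ks)) χ))
          ≡⟨ ∑-*ˡ Xs _ _ ⟩
        card (X ^^ n) * ∑ Xs (λ χ → ∑² Vs (λ ks → hat (λ k → f (k ∷ ks)) χ))
          ≡⟨ cong (card (X ^^ n) *_) (∑-swap Xs Vs _) ⟩
        card (X ^^ n) * ∑ Vs (λ ks → ∑² Xs (hat (λ k → f (k ∷ ks))))
          ≡⟨ cong (card (X ^^ n) *_) (trans (∑-cong Vs (λ ks → plancherel _)) (∑-*ˡ Vs _ _)) ⟩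
        card (X ^^ n) * (card X * ∑ Vs (λ ks → ∑² Xs (λ k → f (k ∷ ks))))
          ≡⟨ cong (λ z → card (X ^^ n) * (card X * z)) (trans (∑-swap Vs Xs _) (sym (∑-vectors Xs {n} _))) ⟩
        card (X ^^ n) * (card X * ∑² (vectors Xs (suc n)) f)
          ≡⟨ trans (sym (*-assoc _ _ _)) (cong (_* ∑² (vectors Xs (suc n)) f) (trans (*-comm _ _)
               (sym (trans (card-^^ X (suc n)) (cong (card X *_) (sym (card-^^ X n))))))) ⟩
        card (X ^^ suc n) * ∑² (vectors Xs (suc n)) f ∎
        where
          open ≡-Reasoning
          Vs = vectors Xs n
          split : ∀ χ χs → ^ᵥ f (χ ∷ χs) ≡ ^ᵥ (λ ks → hat (λ k → f (k ∷ ks)) χ) χs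
          split χ χs = begin
            ^ᵥ f (χ ∷ χs)
              ≡⟨ trans (∑-vectors Xs {n} _) (∑-swap Xs Vs _) ⟩
            ∑ Vs (λ ks → ∑ Xs (λ k → sgn (⟨ χ , k ⟩ xor ⟨ χs , ks ⟩ᵥ) * f (k ∷ ks)))
              ≡⟨ ∑-cong Vs (λ ks → trans (∑-cong Xs (λ k → trans
                   (cong (_* f (k ∷ ks)) (trans (sgn-xor ⟨ χ , k ⟩ _) (*-comm _ _))) (*-assoc _ _ _))) (∑-*ˡ Xs _ _)) ⟩
            ^ᵥ (λ ks → hat (λ k → f (k ∷ ks)) χ) χs ∎

      trivial-or-balancedᵥ : ∀ {n} (χ : Vec (Carrier X) n) →
        (∀ k → ⟨ χ , k ⟩ᵥ ≡ false) ⊎ ∑ (vectors Xs n) (λ k → sgn ⟨ χ , k ⟩ᵥ) ≡ 0ℤ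
      trivial-or-balancedᵥ [] = inj₁ λ { [] → refl }
      trivial-or-balancedᵥ {suc n} (χ ∷ χs) with trivial-or-balanced χ | trivial-or-balancedᵥ χs
      ... | inj₁ t | inj₁ u = inj₁ λ { (k ∷ ks) → cong₂ _xor_ (t k) (u ks) }
      ... | inj₂ b | _ = inj₂ (trans (product χ χs) (trans (cong (_* _) b) (*-zeroˡ _)))
        where
          product : ∀ χ χs → ∑ (vectors Xs (suc n)) (λ k → sgn ⟨ χ ∷ χs , k ⟩ᵥ) ≡
                    ∑ Xs (λ k → sgn ⟨ χ , k ⟩) * ∑ (vectors Xs n) (λ k → sgn ⟨ χs , k ⟩ᵥ)
          product χ χs = trans (∑-vectors Xs {n} _) (trans (∑-cong Xs (λ k → trans
            (∑-cong (vectors Xs n) (λ ks → sgn-xor ⟨ χ , k ⟩ _)) (∑-*ˡ (vectors Xs n) _ _))) (∑-*ʳ Xs _ _))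
      ... | inj₁ t | inj₂ b = inj₂ (trans (∑-vectors Xs {n} _) (∑-zero Xs (λ k → trans
            (∑-cong (vectors Xs n) (λ ks → cong (λ z → sgn (z xor ⟨ χs , ks ⟩ᵥ)) (t k))) b)))

    Vec-Fourier : ∀ n → Fourier (X ^^ n)
    Vec-Fourier n = record
      { _⊕_ = _⊕ᵥ_ ; ⟨_,_⟩ = ⟨_,_⟩ᵥ ; additive = additiveᵥ ; translate = translateᵥ
      ; plancherel = plancherelᵥ n ; trivial-or-balanced = trivial-or-balancedᵥ }

  below-average : {X : Set} (xs : List X) (f : X → ℤ) (c : ℤ) → 0ℤ < pos (length xs) →
                  ∑ xs f ≤ pos (length xs) * c → ∃ λ x → f x ≤ c
  below-average []       f c (ℤ.+<+ ()) _
  below-average (x ∷ xs) f c _ le with f x ℤ.≤? c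
  ... | yes p = x , p
  below-average (x ∷ [])     f c _ le | no ¬p =
    contradiction (subst₂ _≤_ (+-identityʳ _) (*-identityˡ c) le) ¬p
  below-average (x ∷ y ∷ ys) f c _ le | no ¬p =
    below-average (y ∷ ys) f c (ℤ.+<+ (ℕ.s≤s ℕ.z≤n)) (+-cancel (ℤ.≤-trans
      (+-mono-≤ (ℤ.<⇒≤ (ℤ.≰⇒> ¬p)) ℤ.≤-refl)
      (subst (∑ (x ∷ y ∷ ys) f ≤_) (trans (cong (_* c) (pos-+ 1 (length (y ∷ ys)))) (sym (suc-* c _))) le)))
    where
      opaque
        unfolding _+_
        +-cancel : ∀ {a b} → c + a ≤ c + b → a ≤ b
        +-cancel {a} {b} p = subst₂ _≤_ (undo a) (undo b) (ℤ.+-monoʳ-≤ (ℤ.- c) p)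
          where
            undo : ∀ a → ℤ.- c ℤ.+ (c ℤ.+ a) ≡ a
            undo a = trans (sym (ℤ.+-assoc (ℤ.- c) c a)) (trans (cong (ℤ._+ a) (ℤ.+-inverseˡ c)) (ℤ.+-identityˡ a))

  -- Formed by halves to match `choose`, which fixes the generators of one half and then treats
  -- those of the other with the resulting weights.
  ∏ : ∀ e → (Vec Bool e → ℤ) → ℤ
  ∏ zero    f = f []
  ∏ (suc e) f = ∏ e (λ a → f (false ∷ a)) * ∏ e (λ a → f (true ∷ a))

  ∏-nonneg : ∀ e {f} → (∀ a → 0ℤ ≤ f a) → 0ℤ ≤ ∏ e f
  ∏-nonneg zero    p = p []
  ∏-nonneg (suc e) p = *-nonneg (∏-nonneg e (λ a → p (false ∷ a))) (∏-nonneg e (λ a → p (true ∷ a)))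

  -- The method of conditional expectations, for the exponential moment of the
  -- biases of all characters.
  module Greedy {X : Finite} (F : Fourier X) (0<card : 0ℤ < card X) where
    open Fourier F
    private
      Xs = elems X
      I  = Bool × Carrier X
      Is = cartesianProduct (false ∷ true ∷ []) Xs

    -- 8 (1 ± 1/8), an integer stand-in for the exponential of ±1/8, the rate that suits a target
    -- bias of 1/8.
    weight : Bool → ℤ
    weight b = pos 8 + sgn b

    weight-nonneg : ∀ b → 0ℤ ≤ weight b
    weight-nonneg false = subst (0ℤ ≤_) (sym weight-false) (pos-nonneg 9)
    weight-nonneg true  = subst (0ℤ ≤_) (sym weight-true) (pos-nonneg 7)

    -- The sign σ lets a single sum control the bias in both directions.
    w : I → Carrier X → ℤ
    w (σ , χ) s = weight (σ xor ⟨ χ , s ⟩)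

    ∑-w : ∀ i → Balanced (proj₂ i) → ∑ Xs (w i) ≡ card X * pos 8
    ∑-w (σ , χ) b = trans (∑-+ Xs _ _) (trans (cong₂ _+_ (∑-const Xs _)
      (trans (∑-cong Xs (λ s → sgn-xor σ ⟨ χ , s ⟩)) (trans (∑-*ˡ Xs _ _) (trans (cong (sgn σ *_) b) (*-zeroʳ _)))))
      (+-identityʳ _))

    -- W is the weight built up by the shifts chosen so far. For a balanced character the next
    -- factor has mean 8, so some shift multiplies the total by at most 8. A trivial character,
    -- which no shift can influence, has to enter with weight 0.
    choose : ∀ e (W : I → ℤ) → (∀ i → 0ℤ ≤ W i) → (∀ i → W i ≡ 0ℤ ⊎ Balanced (proj₂ i)) →
      ∃ λ (s : Vec Bool e → Carrier X) →
        ∑ Is (λ i → W i * ∏ e (λ a → w i (s a))) ≤ ∏ e (λ _ → pos 8) * ∑ Is W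
    choose zero W 0≤W cond =
      let k , p = below-average Xs (λ s → ∑ Is (λ i → W i * w i s)) (pos 8 * ∑ Is W) 0<card (ℤ.≤-reflexive total)
      in (λ _ → k) , p
      where
        open ≡-Reasoning
        each : ∀ i → ∑ Xs (λ s → W i * w i s) ≡ card X * pos 8 * W i
        each i with cond i
        ... | inj₂ b = trans (∑-*ˡ Xs _ _) (trans (cong (W i *_) (∑-w i b)) (*-comm _ _))
        ... | inj₁ z rewrite z = trans (∑-zero Xs (λ s → *-zeroˡ _)) (sym (*-zeroʳ _))
        total : ∑ Xs (λ s → ∑ Is (λ i → W i * w i s)) ≡ card X * (pos 8 * ∑ Is W)
        total = begin
          ∑ Xs (λ s → ∑ Is (λ i → W i * w i s))  ≡⟨ ∑-swap Xs Is _ ⟩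
          ∑ Is (λ i → ∑ Xs (λ s → W i * w i s))  ≡⟨ ∑-cong Is each ⟩
          ∑ Is (λ i → card X * pos 8 * W i)      ≡⟨ ∑-*ˡ Is _ W ⟩
          card X * pos 8 * ∑ Is W                ≡⟨ *-assoc _ _ _ ⟩
          card X * (pos 8 * ∑ Is W)              ∎
    choose (suc e) W 0≤W cond with choose e W 0≤W cond
    ... | s₀ , p₀ with choose e (λ i → W i * ∏ e (λ a → w i (s₀ a)))
                         (λ i → *-nonneg (0≤W i) (∏-nonneg e (λ a → weight-nonneg (proj₁ i xor ⟨ proj₂ i , s₀ a ⟩))))
                         cond′
      where
        cond′ : ∀ i → W i * ∏ e (λ a → w i (s₀ a)) ≡ 0ℤ ⊎ Balanced (proj₂ i)
        cond′ i with cond i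
        ... | inj₁ z = inj₁ (trans (cong (_* _) z) (*-zeroˡ _))
        ... | inj₂ b = inj₂ b
    ... | s₁ , p₁ = s , (begin
      ∑ Is (λ i → W i * (∏ e (λ a → w i (s₀ a)) * ∏ e (λ a → w i (s₁ a))))   ≡⟨ ∑-cong Is (λ i → sym (*-assoc _ _ _)) ⟩
      ∑ Is (λ i → W i * ∏ e (λ a → w i (s₀ a)) * ∏ e (λ a → w i (s₁ a)))     ≤⟨ p₁ ⟩
      P * ∑ Is (λ i → W i * ∏ e (λ a → w i (s₀ a)))                          ≤⟨ *-monoˡ (∏-nonneg e (λ _ → pos-nonneg 8)) p₀ ⟩
      P * (P * ∑ Is W)                                                       ≡⟨ *-assoc _ _ _ ⟨
      P * P * ∑ Is W                                                         ∎)
      where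
        open ℤ.≤-Reasoning
        P = ∏ e (λ _ → pos 8)
        s : Vec Bool (suc e) → Carrier X
        s (false ∷ a) = s₀ a
        s (true  ∷ a) = s₁ a

  -- p and q count the points with sign +1 and -1, where the weights are 9 and 7; `prod′` is the
  -- moment for the opposite sign.
  record Counts (e : ℕ) (b : Vec Bool e → Bool) : Set where
    field
      p q   : ℕ
      total : p ℕ.+ q ≡ 2 ℕ.^ e
      bias  : ∑ (vectors (false ∷ true ∷ []) e) (λ a → sgn (b a)) ≡ pos p - pos q
      prod  : ∏ e (λ a → pos 8 + sgn (b a)) ≡ pos (9 ℕ.^ p ℕ.* 7 ℕ.^ q)
      prod′ : ∏ e (λ a → pos 8 + sgn (true xor b a)) ≡ pos (9 ℕ.^ q ℕ.* 7 ℕ.^ p)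

  count : ∀ e (b : Vec Bool e → Bool) → Counts e b
  count zero b with b [] in eq
  ... | false = record { p = 1 ; q = 0 ; total = refl
                       ; bias = trans (+-identityʳ _) (trans (cong sgn eq) (sym (trans (cong (1ℤ +_) neg-0) (+-identityʳ 1ℤ))))
                       ; prod = trans (cong (λ z → pos 8 + sgn z) eq) weight-false
                       ; prod′ = trans (cong (λ z → pos 8 + sgn (true xor z)) eq) weight-true }
  ... | true  = record { p = 0 ; q = 1 ; total = refl
                       ; bias = trans (+-identityʳ _) (trans (cong sgn eq) (sym (+-identityˡ _)))
                       ; prod = trans (cong (λ z → pos 8 + sgn z) eq) weight-true
                       ; prod′ = trans (cong (λ z → pos 8 + sgn (true xor z)) eq) weight-false }
  count (suc e) b = record
    { p = C₀.p ℕ.+ C₁.p ; q = C₀.q ℕ.+ C₁.q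
    ; total = trans (ℕ-interchange C₀.p C₁.p C₀.q C₁.q) (cong₂ ℕ._+_ C₀.total (trans C₁.total (sym (ℕ.+-identityʳ _))))
    ; bias = trans (∑-vectors (false ∷ true ∷ []) {e} _) (trans (cong (∑ (vectors (false ∷ true ∷ []) e) (λ a → sgn (b (false ∷ a))) +_) (+-identityʳ _))
        (trans (cong₂ _+_ C₀.bias C₁.bias) (trans (diff-+ _ _ _ _) (cong₂ _-_ (sym (pos-+ _ _)) (sym (pos-+ _ _))))))
    ; prod  = trans (cong₂ _*_ C₀.prod C₁.prod) (merge C₀.p C₀.q C₁.p C₁.q)
    ; prod′ = trans (cong₂ _*_ C₀.prod′ C₁.prod′) (merge C₀.q C₀.p C₁.q C₁.p) }
    where
      module C₀ = Counts (count e (λ a → b (false ∷ a)))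
      module C₁ = Counts (count e (λ a → b (true ∷ a)))
      ℕ-interchange : ∀ a b c d → (a ℕ.+ b) ℕ.+ (c ℕ.+ d) ≡ (a ℕ.+ c) ℕ.+ (b ℕ.+ d)
      ℕ-interchange = ℕSolver.solve-∀
      ℕ-interchange* : ∀ a b c d → (a ℕ.* b) ℕ.* (c ℕ.* d) ≡ (a ℕ.* c) ℕ.* (b ℕ.* d)
      ℕ-interchange* = ℕSolver.solve-∀
      merge : ∀ p q p′ q′ → pos (9 ℕ.^ p ℕ.* 7 ℕ.^ q) * pos (9 ℕ.^ p′ ℕ.* 7 ℕ.^ q′) ≡ pos (9 ℕ.^ (p ℕ.+ p′) ℕ.* 7 ℕ.^ (q ℕ.+ q′))
      merge p q p′ q′ = trans (sym (pos-* (9 ℕ.^ p ℕ.* 7 ℕ.^ q) (9 ℕ.^ p′ ℕ.* 7 ℕ.^ q′))) (cong pos (trans (ℕ-interchange* (9 ℕ.^ p) (7 ℕ.^ q) _ _)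
        (cong₂ ℕ._*_ (sym (ℕ.^-distribˡ-+-* 9 p p′)) (sym (ℕ.^-distribˡ-+-* 7 q q′)))))

  -- 9⁹ 7⁷ 8 ≥ 9 8¹⁶ : a bias above 1/8 makes the moment exceed its mean.
  biased-moment : ∀ t N p q → p ℕ.+ q ≡ 16 ℕ.* t → 8 ℕ.^ t ℕ.* N ℕ.< 9 ℕ.^ t → 9 ℕ.* q ℕ.< 7 ℕ.* p →
                  8 ℕ.^ (16 ℕ.* t) ℕ.* N ℕ.< 9 ℕ.^ p ℕ.* 7 ℕ.^ q
  biased-moment t N p q p+q large biased = ℕ.*-cancelˡ-< (8 ℕ.^ t) _ _ (begin-strict
    8 ℕ.^ t ℕ.* (8 ℕ.^ (16 ℕ.* t) ℕ.* N)       ≡⟨ swap (8 ℕ.^ t) (8 ℕ.^ (16 ℕ.* t)) N ⟩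
    8 ℕ.^ (16 ℕ.* t) ℕ.* (8 ℕ.^ t ℕ.* N)       <⟨ ℕ.*-monoʳ-< (8 ℕ.^ (16 ℕ.* t)) {{ℕ.m^n≢0 8 (16 ℕ.* t)}} large ⟩
    8 ℕ.^ (16 ℕ.* t) ℕ.* 9 ℕ.^ t               ≡⟨ cong (ℕ._* 9 ℕ.^ t) (ℕ.^-*-assoc 8 16 t) ⟨
    (8 ℕ.^ 16) ℕ.^ t ℕ.* 9 ℕ.^ t               ≡⟨ ℕ^-distribʳ-* t (8 ℕ.^ 16) 9 ⟨
    (8 ℕ.^ 16 ℕ.* 9) ℕ.^ t                     ≤⟨ ℕ.^-monoˡ-≤ t (ℕ.≤ᵇ⇒≤ (8 ℕ.^ 16 ℕ.* 9) (8 ℕ.* (9 ℕ.^ 9 ℕ.* 7 ℕ.^ 7)) _) ⟩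
    (8 ℕ.* (9 ℕ.^ 9 ℕ.* 7 ℕ.^ 7)) ℕ.^ t        ≡⟨ trans (ℕ^-distribʳ-* t 8 (9 ℕ.^ 9 ℕ.* 7 ℕ.^ 7)) (cong (8 ℕ.^ t ℕ.*_) (ℕ^-distribʳ-* t (9 ℕ.^ 9) (7 ℕ.^ 7))) ⟩
    8 ℕ.^ t ℕ.* ((9 ℕ.^ 9) ℕ.^ t ℕ.* (7 ℕ.^ 7) ℕ.^ t)
      ≡⟨ cong (8 ℕ.^ t ℕ.*_) (cong₂ ℕ._*_ (ℕ.^-*-assoc 9 9 t) (trans (ℕ.^-*-assoc 7 7 t) (cong (7 ℕ.^_) q+x))) ⟩
    8 ℕ.^ t ℕ.* (9 ℕ.^ (9 ℕ.* t) ℕ.* 7 ℕ.^ (x ℕ.+ q))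
      ≡⟨ cong (λ z → 8 ℕ.^ t ℕ.* (9 ℕ.^ (9 ℕ.* t) ℕ.* z)) (ℕ.^-distribˡ-+-* 7 x q) ⟩
    8 ℕ.^ t ℕ.* (9 ℕ.^ (9 ℕ.* t) ℕ.* (7 ℕ.^ x ℕ.* 7 ℕ.^ q))
      ≤⟨ ℕ.*-monoʳ-≤ (8 ℕ.^ t) (ℕ.*-monoʳ-≤ (9 ℕ.^ (9 ℕ.* t)) (ℕ.*-monoˡ-≤ (7 ℕ.^ q) (ℕ.^-monoˡ-≤ x (ℕ.m≤m+n 7 2)))) ⟩
    8 ℕ.^ t ℕ.* (9 ℕ.^ (9 ℕ.* t) ℕ.* (9 ℕ.^ x ℕ.* 7 ℕ.^ q))
      ≡⟨ cong (8 ℕ.^ t ℕ.*_) (trans (sym (ℕ.*-assoc (9 ℕ.^ (9 ℕ.* t)) _ _)) (cong (ℕ._* 7 ℕ.^ q)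
           (trans (sym (ℕ.^-distribˡ-+-* 9 (9 ℕ.* t) x)) (cong (9 ℕ.^_) (ℕ.m+[n∸m]≡n 9t≤p))))) ⟩
    8 ℕ.^ t ℕ.* (9 ℕ.^ p ℕ.* 7 ℕ.^ q) ∎)
    where
      open ℕ.≤-Reasoning
      swap : ∀ a b c → a ℕ.* (b ℕ.* c) ≡ b ℕ.* (a ℕ.* c)
      swap = ℕSolver.solve-∀
      -- 9 q < 7 p says that more than 9/16 of the 16 t factors are 9, in other words that the bias
      -- exceeds 1/8.
      9t≤p : 9 ℕ.* t ℕ.≤ p
      9t≤p = ℕ.*-cancelˡ-≤ 16 (begin
        16 ℕ.* (9 ℕ.* t)          ≡⟨ swap 16 9 t ⟩
        9 ℕ.* (16 ℕ.* t)          ≡⟨ cong (9 ℕ.*_) p+q ⟨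
        9 ℕ.* (p ℕ.+ q)           ≡⟨ ℕ.*-distribˡ-+ 9 p q ⟩
        9 ℕ.* p ℕ.+ 9 ℕ.* q       ≤⟨ ℕ.+-monoʳ-≤ (9 ℕ.* p) (ℕ.<⇒≤ biased) ⟩
        9 ℕ.* p ℕ.+ 7 ℕ.* p       ≡⟨ ℕ.*-distribʳ-+ p 9 7 ⟨
        16 ℕ.* p                  ∎)
      x = p ℕ.∸ 9 ℕ.* t
      q+x : 7 ℕ.* t ≡ x ℕ.+ q
      q+x = ℕ.+-cancelˡ-≡ (9 ℕ.* t) _ _ (begin-equality
        9 ℕ.* t ℕ.+ 7 ℕ.* t             ≡⟨ ℕ.*-distribʳ-+ t 9 7 ⟨
        16 ℕ.* t                        ≡⟨ p+q ⟨
        p ℕ.+ q                         ≡⟨ cong (ℕ._+ q) (ℕ.m+[n∸m]≡n 9t≤p) ⟨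
        9 ℕ.* t ℕ.+ x ℕ.+ q             ≡⟨ ℕ.+-assoc (9 ℕ.* t) x q ⟩
        9 ℕ.* t ℕ.+ (x ℕ.+ q)           ∎)

  -- A union bound: there are 2 |X| moments, one for each character and sign, and a bias above 1/8
  -- raises one of them by (9/8) ^ t at least. By `large`, a single violation would exceed the total
  -- which the greedy choice guarantees.
  module _ {X : Finite} (F : Fourier X) (0<card : 0ℤ < card X) (e t : ℕ) (2^e : 2 ℕ.^ e ≡ 16 ℕ.* t)
           (large : 8 ℕ.^ t ℕ.* (2 ℕ.* length (elems X)) ℕ.< 9 ℕ.^ t) where
    open Fourier F
    open Greedy F 0<card
    private
      Xs = elems X
      A  = Bools ^^ e
      As = elems A
      I  = Bool × Carrier X
      Is = cartesianProduct (false ∷ true ∷ []) Xs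

      W : I → ℤ
      W (σ , χ) with trivial-or-balanced χ
      ... | inj₁ _ = 0ℤ
      ... | inj₂ _ = 1ℤ

      W-nonneg : ∀ i → 0ℤ ≤ W i
      W-nonneg (σ , χ) with trivial-or-balanced χ
      ... | inj₁ _ = pos-nonneg 0
      ... | inj₂ _ = pos-nonneg 1

      W≤1 : ∀ i → W i ≤ 1ℤ
      W≤1 (σ , χ) with trivial-or-balanced χ
      ... | inj₁ _ = pos-nonneg 1
      ... | inj₂ _ = ℤ.≤-refl

      W-cond : ∀ i → W i ≡ 0ℤ ⊎ Balanced (proj₂ i)
      W-cond (σ , χ) with trivial-or-balanced χ
      ... | inj₁ _ = inj₁ refl
      ... | inj₂ b = inj₂ b

      W-trivial-or-1 : ∀ i → Trivial (proj₂ i) ⊎ W i ≡ 1ℤ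
      W-trivial-or-1 (σ , χ) with trivial-or-balanced χ
      ... | inj₁ t = inj₁ t
      ... | inj₂ b = inj₂ refl

      chosen = choose e W W-nonneg W-cond

    shift : Carrier A → Carrier X
    shift = proj₁ chosen

    translation : Carrier A → Carrier X → Carrier X
    translation a k = k ⊕ shift a

    private
      ∏-8 : ∀ e → ∏ e (λ _ → pos 8) ≡ pos (8 ℕ.^ (2 ℕ.^ e))
      ∏-8 zero    = refl
      ∏-8 (suc e) = trans (cong₂ _*_ (∏-8 e) (∏-8 e)) (trans (sym (pos-* (8 ℕ.^ (2 ℕ.^ e)) (8 ℕ.^ (2 ℕ.^ e)))) (cong pos
        (trans (sym (ℕ.^-distribˡ-+-* 8 (2 ℕ.^ e) _)) (cong (λ z → 8 ℕ.^ (2 ℕ.^ e ℕ.+ z)) (sym (ℕ.+-identityʳ _))))))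

      N = 2 ℕ.* length Xs

      ∑W : ∑ Is W ≤ pos N
      ∑W = ℤ.≤-trans (∑-mono Is W≤1) (ℤ.≤-reflexive (trans (∑-1 Is) (trans (card-⊗ Bools X) (sym (pos-* 2 (length Xs))))))

      moment : ∀ i → W i ≡ 1ℤ → ∏ e (λ a → w i (shift a)) ≤ pos (8 ℕ.^ (16 ℕ.* t) ℕ.* N)
      moment i Wi = begin
        ∏ e (λ a → w i (shift a))                    ≡⟨ trans (cong (_* ∏ e (λ a → w i (shift a))) Wi) (*-identityˡ _) ⟨
        W i * ∏ e (λ a → w i (shift a))              ≤⟨ ∑-∈-≤ Is {λ i → W i * ∏ e (λ a → w i (shift a))}
                                                          (λ i → *-nonneg (W-nonneg i) (∏-nonneg e (λ a → weight-nonneg (proj₁ i xor ⟨ proj₂ i , shift a ⟩))))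
                                                          (complete (Bools ⊗ X) i) ⟩
        ∑ Is (λ i → W i * ∏ e (λ a → w i (shift a))) ≤⟨ proj₂ chosen ⟩
        ∏ e (λ _ → pos 8) * ∑ Is W                   ≤⟨ *-monoˡ (∏-nonneg e (λ _ → pos-nonneg 8)) ∑W ⟩
        ∏ e (λ _ → pos 8) * pos N                    ≡⟨ cong (_* pos N) (trans (∏-8 e) (cong (λ z → pos (8 ℕ.^ z)) 2^e)) ⟩
        pos (8 ℕ.^ (16 ℕ.* t)) * pos N               ≡⟨ pos-* (8 ℕ.^ (16 ℕ.* t)) N ⟨
        pos (8 ℕ.^ (16 ℕ.* t) ℕ.* N)                 ∎
        where open ℤ.≤-Reasoning

      bias : Carrier X → ℤ
      bias χ = ∑ As (λ a → sgn ⟨ χ , shift a ⟩)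

      card-A : card A ≡ pos (2 ℕ.^ e)
      card-A = trans (card-^^ Bools e) (sym (pos-^ 2 e))

      -- `bias-factor` writes (p + q)² - 64 (p - q)² as the product of 9 q - 7 p and 9 p - 7 q. The
      -- moments for the two signs make each factor nonnegative.
      small-bias : ∀ χ → Trivial χ ⊎ pos 64 * bias χ ² ≤ card A ²
      small-bias χ with W-trivial-or-1 (false , χ) | W-trivial-or-1 (true , χ)
      ... | inj₁ t | _ = inj₁ t
      ... | inj₂ _ | inj₁ t = inj₁ t
      ... | inj₂ u | inj₂ v = inj₂ (≤-by ((pos 9 * pos q - pos 7 * pos p) * (pos 9 * pos p - pos 7 * pos q))
          (*-nonneg (diff-nonneg (one p q total′ (subst (_≤ _) prod (moment (false , χ) u))))
                    (diff-nonneg (one q p (trans (ℕ.+-comm q p) total′) (subst (_≤ _) prod′ (moment (true , χ) v)))))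
          (trans (cong _² (trans card-A (trans (cong pos (sym total)) (pos-+ p q))))
            (trans (bias-factor (pos p) (pos q)) (cong (λ z → pos 64 * z ² + (pos 9 * pos q - pos 7 * pos p) * (pos 9 * pos p - pos 7 * pos q)) (sym b)))))
        where
          open Counts (count e (λ a → ⟨ χ , shift a ⟩)) renaming (bias to b)
          total′ : p ℕ.+ q ≡ 16 ℕ.* t
          total′ = trans total 2^e
          one : ∀ p q → p ℕ.+ q ≡ 16 ℕ.* t → pos (9 ℕ.^ p ℕ.* 7 ℕ.^ q) ≤ pos (8 ℕ.^ (16 ℕ.* t) ℕ.* N) →
                pos 7 * pos p ≤ pos 9 * pos q
          one p q e (ℤ.+≤+ m) = subst₂ _≤_ (pos-* 7 p) (pos-* 9 q) (ℤ.+≤+ (ℕ.≮⇒≥ λ lt →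
            ℕ.<⇒≱ (biased-moment t N p q e large lt) m))

    -- Characters diagonalise translations, and the sum over all shifts has eigenvalue `bias χ`.
    -- Plancherel on both sides reduces the claim to one χ at a time; at a trivial χ, whose bias is
    -- not small, the coefficient of φ is its sum, which is 0.
    translation-expander : IsExpander A X translation
    translation-expander = record { preserves = λ a → translate (shift a) ; contracts = contracts }
      where
        contracts : ∀ φ → ∑ Xs φ ≡ 0ℤ →
          pos 64 * ∑² Xs (λ k → ∑ As (λ a → φ (k ⊕ shift a))) ≤ card A ² * ∑² Xs φ
        contracts φ z = cancelˡ 0<card (begin
          card X * (pos 64 * ∑² Xs Hφ)                 ≡⟨ reassoc₁ (pos 64) (card X) _ ⟩
          pos 64 * (card X * ∑² Xs Hφ)                 ≡⟨ cong (pos 64 *_) (plancherel Hφ) ⟨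
          pos 64 * ∑² Xs (hat Hφ)                        ≡⟨ ∑-*ˡ Xs _ _ ⟨
          ∑ Xs (λ χ → pos 64 * hat Hφ χ ²)               ≤⟨ ∑-mono Xs each ⟩
          ∑ Xs (λ χ → card A ² * hat φ χ ²)              ≡⟨ ∑-*ˡ Xs _ _ ⟩
          card A ² * ∑² Xs (hat φ)                       ≡⟨ cong (card A ² *_) (plancherel φ) ⟩
          card A ² * (card X * ∑² Xs φ)                ≡⟨ reassoc₁ (card X) (card A ²) _ ⟩
          card X * (card A ² * ∑² Xs φ)                ∎)
          where
            open ℤ.≤-Reasoning
            Hφ : Carrier X → ℤ
            Hφ k = ∑ As (λ a → φ (k ⊕ shift a))
            one-shift : ∀ χ s → ∑ Xs (λ k → sgn ⟨ χ , k ⟩ * φ (k ⊕ s)) ≡ sgn ⟨ χ , s ⟩ * hat φ χ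
            one-shift χ s = begin-equality
              ∑ Xs (λ k → sgn ⟨ χ , k ⟩ * φ (k ⊕ s))
                ≡⟨ ∑-cong Xs (λ k → shift-sgn _ (sgn ⟨ χ , s ⟩) _ (sym (trans (cong (_* (sgn ⟨ χ , k ⟩ * φ (k ⊕ s))) (sgn² ⟨ χ , s ⟩)) (*-identityˡ _)))) ⟩
              ∑ Xs (λ k → sgn ⟨ χ , s ⟩ * (sgn ⟨ χ , k ⟩ * sgn ⟨ χ , s ⟩ * φ (k ⊕ s)))
                ≡⟨ ∑-*ˡ Xs _ _ ⟩
              sgn ⟨ χ , s ⟩ * ∑ Xs (λ k → sgn ⟨ χ , k ⟩ * sgn ⟨ χ , s ⟩ * φ (k ⊕ s))
                ≡⟨ cong (sgn ⟨ χ , s ⟩ *_) (∑-cong Xs (λ k → cong (_* φ (k ⊕ s))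
                     (trans (sym (sgn-xor ⟨ χ , k ⟩ _)) (cong sgn (sym (additive χ k s)))))) ⟩
              sgn ⟨ χ , s ⟩ * ∑ Xs (λ k → sgn ⟨ χ , k ⊕ s ⟩ * φ (k ⊕ s))
                ≡⟨ cong (sgn ⟨ χ , s ⟩ *_) (translate s (λ k → sgn ⟨ χ , k ⟩ * φ k)) ⟩
              sgn ⟨ χ , s ⟩ * hat φ χ ∎
            ^-H : ∀ χ → hat Hφ χ ≡ bias χ * hat φ χ
            ^-H χ = trans (∑-cong Xs (λ k → sym (∑-*ˡ As _ _))) (trans (∑-swap Xs As _)
              (trans (∑-cong As (λ a → one-shift χ (shift a))) (∑-*ʳ As _ _)))
            each : ∀ χ → pos 64 * hat Hφ χ ² ≤ card A ² * hat φ χ ²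
            each χ with small-bias χ
            ... | inj₁ t = ℤ.≤-reflexive (trans (cong (λ z → pos 64 * z ²) (trans (^-H χ) (trans (cong (bias χ *_) φ̂≡0) (*-zeroʳ _))))
                    (trans (trans (cong (pos 64 *_) (*-zeroˡ 0ℤ)) (*-zeroʳ (pos 64)))
                      (sym (trans (cong (λ z → card A ² * z ²) φ̂≡0) (trans (cong (card A ² *_) (*-zeroˡ 0ℤ)) (*-zeroʳ (card A ²)))))))
              where
                φ̂≡0 : hat φ χ ≡ 0ℤ
                φ̂≡0 = trans (∑-cong Xs (λ k → trans (cong (λ b → sgn b * φ k) (t k)) (*-identityˡ _))) z
            ... | inj₂ le = ℤ.≤-trans (ℤ.≤-reflexive (trans (cong (λ z → pos 64 * z ²) (^-H χ)) (square-scale (pos 64) _ _)))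
                    (*-monoʳ (square-nonneg _) le)

  -- Supplies `large` for t = 8 u when twice the order of the group is 2 ^ m. It rests on 2 · 8⁸ ≤
  -- 9⁸.
  power-gap : ∀ u m → m ℕ.< u → 8 ℕ.^ (8 ℕ.* u) ℕ.* 2 ℕ.^ m ℕ.< 9 ℕ.^ (8 ℕ.* u)
  power-gap u m m<u = begin-strict
    8 ℕ.^ (8 ℕ.* u) ℕ.* 2 ℕ.^ m     <⟨ ℕ.*-monoʳ-< (8 ℕ.^ (8 ℕ.* u)) {{ℕ.m^n≢0 8 (8 ℕ.* u)}} (ℕ.^-monoʳ-< 2 (ℕ.s≤s (ℕ.s≤s ℕ.z≤n)) m<u) ⟩
    8 ℕ.^ (8 ℕ.* u) ℕ.* 2 ℕ.^ u     ≡⟨ cong (ℕ._* 2 ℕ.^ u) (ℕ.^-*-assoc 8 8 u) ⟨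
    (8 ℕ.^ 8) ℕ.^ u ℕ.* 2 ℕ.^ u     ≡⟨ ℕ^-distribʳ-* u (8 ℕ.^ 8) 2 ⟨
    (8 ℕ.^ 8 ℕ.* 2) ℕ.^ u           ≤⟨ ℕ.^-monoˡ-≤ u (ℕ.≤ᵇ⇒≤ (8 ℕ.^ 8 ℕ.* 2) (9 ℕ.^ 8) _) ⟩
    (9 ℕ.^ 8) ℕ.^ u                 ≡⟨ ℕ.^-*-assoc 9 8 u ⟩
    9 ℕ.^ (8 ℕ.* u)                 ∎
    where open ℕ.≤-Reasoning

-- The inverse polynomial gap of a connected component.

module BaseGraph where

  open import Data.Bool.Base using (Bool; true; false; not; _∨_; _∧_)
  open import Data.Empty using (⊥-elim)
  open import Data.Integer.Base using (ℤ; 0ℤ; 1ℤ; _≤_; _<_) renaming (+_ to pos)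
  import Data.Integer.Base as ℤ
  import Data.Integer.Properties as ℤ
  open import Data.Integer.Tactic.RingSolver using (solve-∀)
  open import Data.List.Base as List using (List; []; _∷_; length; foldl)
  open import Data.List.Membership.Propositional using (_∈_)
  open import Data.List.Relation.Unary.Any using (here; there)
  open import Data.Nat.Base as ℕ using (ℕ; zero; suc)
  import Data.Nat.Properties as ℕ
  open import Data.Product.Base using (_×_; _,_; proj₁; proj₂; ∃-syntax)
  open import Data.Sum.Base using (_⊎_; inj₁; inj₂)
  open import Data.Vec.Base as Vec using (Vec; []; _∷_; toList)
  open import Relation.Binary.PropositionalEquality
  open import Relation.Nullary.Negation using (contradiction)
  open Int
  open Sums
  open Spectral
  open Tower
  open Walk using (Gen; ide; α; β; γ)

  -- Serves to turn the refutation, by `covering`, of the claim that no walk arrives into an actual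
  -- walk, there being finitely many candidates.
  search : (X : Finite) (P : Carrier X → Bool) → (∃[ x ] P x ≡ true) ⊎ (∀ x → P x ≡ false)
  search X P = go-complete (go (elems X))
    where
      go : (xs : List (Carrier X)) → (∃[ x ] P x ≡ true) ⊎ (∀ x → x ∈ xs → P x ≡ false)
      go []       = inj₂ (λ _ ())
      go (x ∷ xs) with P x in eq | go xs
      ... | true  | _      = inj₁ (x , eq)
      ... | false | inj₁ r = inj₁ r
      ... | false | inj₂ r = inj₂ λ { _ (here refl) → eq ; y (there i) → r y i }
      go-complete : (∃[ x ] P x ≡ true) ⊎ (∀ x → x ∈ elems X → P x ≡ false) → (∃[ x ] P x ≡ true) ⊎ (∀ x → P x ≡ false)
      go-complete (inj₁ r) = inj₁ r
      go-complete (inj₂ r) = inj₂ (λ x → r x (complete X x))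

  opaque
    unfolding _+_ _*_ -_

    four-squares : ∀ a b c d → pos 4 * (a * a + (b * b + (c * c + d * d))) ≡
      ((a + (b + (c + d))) * (a + (b + (c + d))) + ((a - b) * (a - b) + ((a - c) * (a - c) + (a - d) * (a - d)))) +
      ((b - c) * (b - c) + ((b - d) * (b - d) + (c - d) * (c - d)))
    four-squares = solve-∀

    step-identity : ∀ t a b → (1ℤ + t) * (a * a) + t * (1ℤ + t) * (b * b) ≡ t * ((a + b) * (a + b)) + (a - t * b) * (a - t * b)
    step-identity = solve-∀

    step-collect : ∀ t E → (1ℤ + t) * (t * t * E) + t * (1ℤ + t) * E ≡ t * ((1ℤ + t) * (1ℤ + t) * E)
    step-collect = solve-∀

    telescope : ∀ x y z → x - z ≡ (x - y) + (y - z)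
    telescope = solve-∀

    sub-self : ∀ x → x - x ≡ 0ℤ
    sub-self = solve-∀

    sub-square-sym : ∀ x y → (x - y) * (x - y) ≡ (y - x) * (y - x)
    sub-square-sym = solve-∀

    recentre : ∀ f c → 1ℤ * ((c - f) * (c - f)) ≡ f * f + (- (pos 2 * c) * f + c * c * 1ℤ)
    recentre = solve-∀

    bound-arith₁ : ∀ C x → pos 16 * C * x ≡ C * ((pos 4 * pos 4) * x)
    bound-arith₁ = solve-∀

    bound-arith₂ : ∀ C D N → C * (D * (pos 16 * N)) ≡ (pos 16 * C - 1ℤ) * D * N + D * N
    bound-arith₂ = solve-∀

    bound-arith₃ : ∀ C D S E → C * (D * (S + E)) ≡ C * (D * S) + D * (C * E)
    bound-arith₃ = solve-∀

    cancel-right : ∀ {a b c} → a + c ≤ b + c → a ≤ b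
    cancel-right {a} {b} {c} p = subst₂ _≤_ (undo a c) (undo b c) (ℤ.+-monoˡ-≤ (ℤ.- c) p)
      where
        undo : ∀ a c → (a + c) + - c ≡ a
        undo = solve-∀

    weaken-l : ∀ q s x → q * (s * x) ≡ s * (q * x)
    weaken-l = solve-∀
    weaken-m : ∀ s p D x → s * (p * D * x) ≡ (p * s) * (D * x)
    weaken-m = solve-∀
    weaken-r : ∀ m q D x → (m * q) * (D * x) ≡ q * (m * D * x)
    weaken-r = solve-∀
    slack-id : ∀ C m r → m * (pos 16 * C) + (pos 16 * C - 1ℤ) * r ≡ (pos 16 * C - 1ℤ) * (m + r) + m
    slack-id = solve-∀

  -- The triangle inequality without roots: for s = t + 1, from |a| ≤ s √E and |b| ≤ √E follows |a +
  -- b| ≤ (s + 1) √E. The slack in the weighted sum of squares is (a - s b)².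
  square-step : ∀ t {a b E} → a ² ≤ pos (suc t) ² * E → b ² ≤ E → (a + b) ² ≤ pos (suc (suc t)) ² * E
  square-step t {a} {b} {E} p q = *-cancelˡ t (begin
    s * (a + b) ²                               ≤⟨ ≤-by _ (square-nonneg (a - s * b)) (step-identity s a b) ⟩
    (1ℤ + s) * a ² + s * (1ℤ + s) * b ²         ≤⟨ +-mono-≤ (*-monoˡ 0≤1+s p) (*-monoˡ (*-nonneg (pos-nonneg (suc t)) 0≤1+s) q) ⟩
    (1ℤ + s) * (s ² * E) + s * (1ℤ + s) * E     ≡⟨ step-collect s E ⟩
    s * ((1ℤ + s) ² * E)                        ≡⟨ cong (λ z → s * (z ² * E)) (pos-+ 1 (suc t)) ⟨
    s * (pos (suc (suc t)) ² * E)               ∎)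
    where
      open ℤ.≤-Reasoning
      s = pos (suc t)
      0≤1+s : 0ℤ ≤ 1ℤ + s
      0≤1+s = +-nonneg (pos-nonneg 1) (pos-nonneg (suc t))

  ∨-true : ∀ a {b} → (a ∨ b) ≡ true → a ≡ true ⊎ b ≡ true
  ∨-true true  p = inj₁ refl
  ∨-true false p = inj₂ p

  ∨-trueˡ : ∀ {a} b → a ≡ true → (a ∨ b) ≡ true
  ∨-trueˡ b refl = refl

  ∨-trueʳ : ∀ a {b} → b ≡ true → (a ∨ b) ≡ true
  ∨-trueʳ true  p = refl
  ∨-trueʳ false p = p

  module Component
    (V : Finite) (_==_ : Carrier V → Carrier V → Bool)
    (==-refl : ∀ x → (x == x) ≡ true) (==-sound : ∀ x y → (x == y) ≡ true → x ≡ y)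
    (act : Gen → Carrier V → Carrier V)
    (act-ide : ∀ v → act ide v ≡ v)
    (involutive : ∀ g v → act g (act g v) ≡ v) (preserves : ∀ g → Preserves V (act g))
    (x : Carrier V)
    where

    private
      Vs = elems V

    Ball : ℕ → Carrier V → Bool
    Ball zero    v = x == v
    Ball (suc t) v = Ball t v ∨ (Ball t (act α v) ∨ (Ball t (act β v) ∨ Ball t (act γ v)))

    size : ℕ → ℤ
    size t = ∑ Vs (λ v → ind (Ball t v))

    Stable : ℕ → Set
    Stable t = ∀ v → Ball (suc t) v ≡ true → Ball t v ≡ true

    private
      ind-mono : ∀ a {b} → ind a ≤ ind (a ∨ b)
      ind-mono true  = ℤ.≤-refl
      ind-mono false = ind-nonneg _

      grow-∈ : ∀ t v (vs : List (Carrier V)) → v ∈ vs → Ball t v ≡ false → Ball (suc t) v ≡ true →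
               1ℤ + ∑ vs (λ v → ind (Ball t v)) ≤ ∑ vs (λ v → ind (Ball (suc t) v))
      grow-∈ t v (_ ∷ vs) (here refl) p q = +-mono-≤
        (ℤ.≤-reflexive (cong ind (sym q)))
        (subst (λ z → z + _ ≤ _) (cong ind (sym p)) (ℤ.≤-trans (ℤ.≤-reflexive (+-identityˡ _)) (∑-mono vs (λ v → ind-mono (Ball t v)))))
      grow-∈ t v (w ∷ vs) (there i) p q = begin
        1ℤ + (ind (Ball t w) + ∑ vs (λ v → ind (Ball t v)))   ≡⟨ trans (sym (+-assoc _ _ _)) (trans (cong (_+ _) (+-comm 1ℤ _)) (+-assoc _ _ _)) ⟩
        ind (Ball t w) + (1ℤ + ∑ vs (λ v → ind (Ball t v)))   ≤⟨ +-mono-≤ (ind-mono (Ball t w)) (grow-∈ t v vs i p q) ⟩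
        ind (Ball (suc t) w) + ∑ vs (λ v → ind (Ball (suc t) v)) ∎
        where open ℤ.≤-Reasoning

      -- Each radius at which the ball is not yet stable adds a vertex, so a stable radius occurs
      -- before the vertices run out. This yields membership in the component as a `Bool`, as
      -- `Graph` requires.
      stable-or-large : ∀ t → (∃[ s ] s ℕ.< t × Stable s) ⊎ pos t ≤ size t
      stable-or-large zero = inj₂ (∑-nonneg Vs (λ v → ind-nonneg (Ball zero v)))
      stable-or-large (suc t) with stable-or-large t
      ... | inj₁ (s , lt , st) = inj₁ (s , ℕ.m≤n⇒m≤1+n lt , st)
      ... | inj₂ le with search V (λ v → Ball (suc t) v ∧ not (Ball t v))
      ...   | inj₂ none = inj₁ (t , ℕ.≤-refl , λ v p → stable-at v p (none v))
        where
          stable-at : ∀ v → Ball (suc t) v ≡ true → (Ball (suc t) v ∧ not (Ball t v)) ≡ false → Ball t v ≡ true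
          stable-at v p q rewrite p with Ball t v
          ... | true  = refl
          ... | false = sym q
      ...   | inj₁ (v , q) = inj₂ (begin
          pos (suc t)      ≡⟨ pos-+ 1 t ⟩
          1ℤ + pos t       ≤⟨ +-monoʳ 1ℤ le ⟩
          1ℤ + size t      ≤⟨ grow-∈ t v Vs (complete V v) (proj₂ (new _ _ q)) (proj₁ (new _ _ q)) ⟩
          size (suc t)     ∎)
        where
          open ℤ.≤-Reasoning
          new : ∀ a b → (a ∧ not b) ≡ true → a ≡ true × b ≡ false
          new true false _ = refl , refl

    radius : ∃[ t ] t ℕ.≤ length Vs × Stable t
    radius with stable-or-large (suc (length Vs))
    ... | inj₁ (s , lt , st) = s , ℕ.≤-pred lt , st
    ... | inj₂ le = contradiction (ℤ.drop‿+≤+ (ℤ.≤-trans le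
            (ℤ.≤-trans (∑-mono Vs (λ v → ind≤1 (Ball (suc (length Vs)) v))) (ℤ.≤-reflexive (∑-1 Vs))))) ℕ.1+n≰n

    R = proj₁ radius

    χ : Carrier V → Bool
    χ = Ball R

    centre-∈ : ∀ t → Ball t x ≡ true
    centre-∈ zero    = ==-refl x
    centre-∈ (suc t) rewrite centre-∈ t = refl

    χ-back : ∀ g v → χ (act g v) ≡ true → χ v ≡ true
    χ-back ide v p = trans (cong χ (sym (act-ide v))) p
    χ-back α v p = proj₂ (proj₂ radius) v (∨-trueʳ (χ v) (∨-trueˡ _ p))
    χ-back β v p = proj₂ (proj₂ radius) v (∨-trueʳ (χ v) (∨-trueʳ (χ (act α v)) (∨-trueˡ _ p)))
    χ-back γ v p = proj₂ (proj₂ radius) v (∨-trueʳ (χ v) (∨-trueʳ (χ (act α v)) (∨-trueʳ (χ (act β v)) p)))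

    χ-act : ∀ g v → χ (act g v) ≡ χ v
    χ-act g v with χ (act g v) in p | χ v in q
    ... | true  | true  = refl
    ... | false | false = refl
    ... | true  | false with () ← trans (sym q) (χ-back g v p)
    ... | false | true  with () ← trans (sym p) (χ-back g (act g v) (trans (cong χ (involutive g v)) q))

    energy : (Carrier V → ℤ) → ℤ
    energy f = ∑ Vs (λ v → (f v - f (act α v)) ² + ((f v - f (act β v)) ² + (f v - f (act γ v)) ²))

    private
      edge : ∀ f v → (f v - f (act α v)) ² + ((f v - f (act β v)) ² + (f v - f (act γ v)) ²) ≤ energy f
      edge f v = ∑-∈-≤ Vs (λ v → +-nonneg (square-nonneg (f v - f (act α v))) (+-nonneg (square-nonneg (f v - f (act β v))) (square-nonneg (f v - f (act γ v))))) (complete V v)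

      back : ∀ f v w → (f v - f w) ² ≤ energy f → (f w - f v) ² ≤ energy f
      back f v w = subst (_≤ energy f) (sub-square-sym (f v) (f w))

      edge-α : ∀ f v → (f (act α v) - f v) ² ≤ energy f
      edge-α f v = back f v _ (ℤ.≤-trans (≤-by _ (+-nonneg (square-nonneg _) (square-nonneg _)) refl) (edge f v))

      edge-β : ∀ f v → (f (act β v) - f v) ² ≤ energy f
      edge-β f v = back f v _ (ℤ.≤-trans (≤-by _ (+-nonneg (square-nonneg (f v - f (act α v))) (square-nonneg (f v - f (act γ v)))) (rot _ _ _)) (edge f v))
        where
          rot : ∀ a b c → a + (b + c) ≡ b + (a + c)
          rot a b c = trans (sym (+-assoc a b c)) (trans (cong (_+ c) (+-comm a b)) (+-assoc b a c))

      edge-γ : ∀ f v → (f (act γ v) - f v) ² ≤ energy f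
      edge-γ f v = back f v _ (ℤ.≤-trans (≤-by _ (+-nonneg (square-nonneg (f v - f (act α v))) (square-nonneg (f v - f (act β v)))) (rot _ _ _)) (edge f v))
        where
          rot : ∀ a b c → a + (b + c) ≡ c + (a + b)
          rot a b c = trans (sym (+-assoc a b c)) (+-comm _ c)

      energy-nonneg : ∀ f → 0ℤ ≤ energy f
      energy-nonneg f = ∑-nonneg Vs (λ v → +-nonneg (square-nonneg (f v - f (act α v))) (+-nonneg (square-nonneg (f v - f (act β v))) (square-nonneg (f v - f (act γ v)))))

    -- Every edge of a path is charged the whole `energy`, and `square-step` adds up the edges. The
    -- bound has t + 1 in place of t because `square-step` cancels this factor, which must be
    -- positive.
    distance : ∀ f t v → Ball t v ≡ true → (f x - f v) ² ≤ pos (suc t) ² * energy f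
    distance f zero v p rewrite ==-sound x v p = subst (_≤ _) (sym (trans (cong _² (sub-self (f v))) (*-zeroˡ 0ℤ)))
      (*-nonneg (square-nonneg 1ℤ) (energy-nonneg f))
    distance f (suc t) v p with ∨-true (Ball t v) p
    ... | inj₁ q = ℤ.≤-trans (distance f t v q) (*-monoʳ (energy-nonneg f)
                     (*-mono-≤ (pos-nonneg (suc t)) (pos-nonneg (suc (suc t))) (ℤ.+≤+ (ℕ.n≤1+n _)) (ℤ.+≤+ (ℕ.n≤1+n _))))
    ... | inj₂ q with ∨-true (Ball t (act α v)) q
    ...   | inj₁ r = subst (λ z → z ² ≤ _) (sym (telescope (f x) _ (f v))) (square-step t (distance f t (act α v) r) (edge-α f v))
    ...   | inj₂ r with ∨-true (Ball t (act β v)) r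
    ...     | inj₁ s = subst (λ z → z ² ≤ _) (sym (telescope (f x) _ (f v))) (square-step t (distance f t (act β v) s) (edge-β f v))
    ...     | inj₂ s = subst (λ z → z ² ≤ _) (sym (telescope (f x) _ (f v))) (square-step t (distance f t (act γ v) s) (edge-γ f v))

    C : ℤ
    C = card V * pos (suc (length Vs)) ²

    -- As f sums to zero, the sum of (c - f v)² over the component is `∑²` of f plus c² for each of
    -- its vertices. With c the value of f at the centre, `distance` bounds each summand.
    poincare : ∀ f → (∀ v → χ v ≡ false → f v ≡ 0ℤ) → ∑ Vs f ≡ 0ℤ → ∑² Vs f ≤ C * energy f
    poincare f supp z = begin
      ∑² Vs f                                             ≤⟨ ≤-by _ (*-nonneg (square-nonneg c) (∑-nonneg Vs (λ v → ind-nonneg (χ v)))) total ⟩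
      ∑ Vs (λ v → ind (χ v) * (c - f v) ²)                ≤⟨ ∑-mono Vs each ⟩
      ∑ Vs (λ v → pos (suc (length Vs)) ² * energy f)     ≡⟨ ∑-const Vs _ ⟩
      card V * (pos (suc (length Vs)) ² * energy f)       ≡⟨ *-assoc _ _ _ ⟨
      C * energy f                                        ∎
      where
        open ℤ.≤-Reasoning
        c = f x
        pointwise : ∀ v → ind (χ v) * (c - f v) ² ≡ f v ² + (- (pos 2 * c) * f v + c * c * ind (χ v))
        pointwise v with χ v in eq
        ... | true  = recentre (f v) c
        ... | false rewrite supp v eq = trans (*-zeroˡ _) (sym (trans (cong₂ _+_ (*-zeroˡ 0ℤ)
                (trans (cong₂ _+_ (*-zeroʳ _) (*-zeroʳ _)) (+-identityˡ 0ℤ))) (+-identityˡ 0ℤ)))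
        total : ∑ Vs (λ v → ind (χ v) * (c - f v) ²) ≡ ∑² Vs f + c ² * ∑ Vs (λ v → ind (χ v))
        total = trans (∑-cong Vs pointwise) (trans (∑-+ Vs _ _) (cong (∑² Vs f +_)
          (trans (∑-+ Vs _ _) (trans (cong₂ _+_ (trans (∑-*ˡ Vs _ f) (trans (cong (- (pos 2 * c) *_) z) (*-zeroʳ _))) (∑-*ˡ Vs _ _)) (+-identityˡ _)))))
        each : ∀ v → ind (χ v) * (c - f v) ² ≤ pos (suc (length Vs)) ² * energy f
        each v with χ v in eq
        ... | true  = ℤ.≤-trans (ℤ.≤-reflexive (*-identityˡ _)) (ℤ.≤-trans (distance f R v eq) (*-monoʳ (energy-nonneg f)
                        (*-mono-≤ (pos-nonneg _) (pos-nonneg _) (ℤ.+≤+ (ℕ.s≤s (proj₁ (proj₂ radius)))) (ℤ.+≤+ (ℕ.s≤s (proj₁ (proj₂ radius)))))))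
        ... | false = subst (_≤ _) (sym (*-zeroˡ _)) (*-nonneg (square-nonneg _) (energy-nonneg f))

    averages : (Carrier V → ℤ) → Carrier V → ℤ
    averages f v = f (act ide v) + (f (act α v) + (f (act β v) + f (act γ v)))

    -- By `four-squares`, four times a sum of four squares is the square of the sum plus the squares
    -- of all six differences. The three differences which involve the resting value make up the
    -- energy, and the other three are dropped.
    spread : ∀ f → ∑² Vs (averages f) + energy f ≤ pos 16 * ∑² Vs f
    spread f = begin
      ∑² Vs (averages f) + energy f
        ≡⟨ ∑-+ Vs _ _ ⟨
      ∑ Vs (λ v → averages f v ² + ((f v - f (act α v)) ² + ((f v - f (act β v)) ² + (f v - f (act γ v)) ²)))
        ≤⟨ ∑-mono Vs each ⟩
      ∑ Vs (λ v → pos 4 * (f (act ide v) ² + (f (act α v) ² + (f (act β v) ² + f (act γ v) ²))))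
        ≡⟨ trans (∑-*ˡ Vs _ _) (cong (pos 4 *_) (trans (∑-+ Vs _ _) (cong₂ _+_ (preserves ide _)
             (trans (∑-+ Vs _ _) (cong₂ _+_ (preserves α _) (trans (∑-+ Vs _ _) (cong₂ _+_ (preserves β _) (preserves γ _)))))))) ⟩
      pos 4 * (∑² Vs f + (∑² Vs f + (∑² Vs f + ∑² Vs f)))
        ≡⟨ sixteen _ ⟩
      pos 16 * ∑² Vs f ∎
      where
        open ℤ.≤-Reasoning
        opaque
          unfolding _+_ _*_ -_
          sixteen : ∀ x → pos 4 * (x + (x + (x + x))) ≡ pos 16 * x
          sixteen = solve-∀
        each : ∀ v → averages f v ² + ((f v - f (act α v)) ² + ((f v - f (act β v)) ² + (f v - f (act γ v)) ²)) ≤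
                     pos 4 * (f (act ide v) ² + (f (act α v) ² + (f (act β v) ² + f (act γ v) ²)))
        each v rewrite act-ide v = ≤-by _ (+-nonneg (square-nonneg (f (act α v) - f (act β v)))
            (+-nonneg (square-nonneg (f (act α v) - f (act γ v))) (square-nonneg (f (act β v) - f (act γ v)))))
          (four-squares (f v) (f (act α v)) (f (act β v)) (f (act γ v)))

    -- Averaging loses the energy by `spread`, and the energy is at least 1 / C of the norm by
    -- `poincare`: the squared ratio is at most 1 - 1 / (16 C).
    contraction : ∀ f → (∀ v → χ v ≡ false → f v ≡ 0ℤ) → ∑ Vs f ≡ 0ℤ →
      ∀ D (Mf : Carrier V → ℤ) → (∀ v → pos 4 * Mf v ≡ D * averages f v) →
      pos 16 * C * ∑² Vs Mf ≤ (pos 16 * C - 1ℤ) * D ² * ∑² Vs f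
    contraction f supp z D Mf avg = cancel-right (begin
      pos 16 * C * ∑² Vs Mf + D ² * ∑² Vs f
        ≤⟨ +-mono-≤ ℤ.≤-refl (*-monoˡ (square-nonneg D) (poincare f supp z)) ⟩
      pos 16 * C * ∑² Vs Mf + D ² * (C * energy f)
        ≡⟨ cong (_+ D ² * (C * energy f)) (trans (bound-arith₁ C _) (cong (C *_) (trans (sym (∑²-*ˡ Vs (pos 4) Mf))
             (trans (∑-cong Vs (λ v → cong _² (avg v))) (∑²-*ˡ Vs D _))))) ⟩
      C * (D ² * ∑² Vs (averages f)) + D ² * (C * energy f)
        ≡⟨ bound-arith₃ C (D ²) _ _ ⟨
      C * (D ² * (∑² Vs (averages f) + energy f))
        ≤⟨ *-monoˡ 0≤C (*-monoˡ (square-nonneg D) (spread f)) ⟩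
      C * (D ² * (pos 16 * ∑² Vs f))
        ≡⟨ bound-arith₂ C (D ²) _ ⟩
      (pos 16 * C - 1ℤ) * D ² * ∑² Vs f + D ² * ∑² Vs f ∎)
      where
        open ℤ.≤-Reasoning
        0≤C : 0ℤ ≤ C
        0≤C = *-nonneg (card-nonneg V) (square-nonneg _)

    data Connected : Carrier V → Set where
      start : Connected x
      move  : ∀ g {v} → Connected v → Connected (act g v)

    Connected⇒χ : ∀ {v} → Connected v → χ v ≡ true
    Connected⇒χ start      = centre-∈ R
    Connected⇒χ (move g c) = trans (χ-act g _) (Connected⇒χ c)

  module Walks
    (A : Finite) (n : ℕ)
    (h : Carrier A → Vec (Carrier A) (n ℕ.* 2) → Vec (Carrier A) (n ℕ.* 2))
    (0<d : 0ℤ < card A) (expander : IsExpander A (A ^^ (n ℕ.* 2)) h)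
    (gen : Vec (Carrier A) (n ℕ.* 2) → Gen)
    (balanced : ∀ (F : Gen → ℤ) → pos 4 * ∑ (elems (A ^^ (n ℕ.* 2))) (λ k → F (gen k)) ≡
                card (A ^^ (n ℕ.* 2)) * (F ide + (F α + (F β + F γ))))
    (b r : ℕ) (0<b : 0 ℕ.< b) (slack : pos 64 * (pos b + pos r) ≤ pos 49 * pos n)
    where

    open Tower.Levels A n h 0<d expander
    open Mixing b r 0<b slack

    module _ (V : Finite) (_==_ : Carrier V → Carrier V → Bool)
      (==-refl : ∀ x → (x == x) ≡ true) (==-sound : ∀ x y → (x == y) ≡ true → x ≡ y)
      (act : Gen → Carrier V → Carrier V)
      (act-ide : ∀ v → act ide v ≡ v)
      (involutive : ∀ g v → act g (act g v) ≡ v) (preserves : ∀ g → Preserves V (act g))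
      (x : Carrier V)
      where

      open Component V _==_ ==-refl ==-sound act act-ide involutive preserves x

      walk : List Label → Carrier V → Carrier V
      walk κs v = foldl (λ v κ → act (gen κ) v) v κs

      -- The first hypothesis places the base ratio (16 C - 1) / (16 C) below m / (m + r) with m = b
      -- ^ ℓ, from where ℓ levels lead down to 1 / (1 + r). The second lets t steps at the top
      -- overcome the number of vertices.
      reaches : ∀ ℓ t → pos r * (pos 16 * C - 1ℤ) ≤ pos b ^ ℓ → card V ² < (1ℤ + pos r) ^ t → 0ℤ < C →
        ∀ {y} → Connected y → ∃[ ks ] ∃[ ws ] walk (stream {ℓ} ks (toList {n = t} ws)) x ≡ y
      reaches ℓ t steep large 0<C {y} conn
        with search (K ^^ ℓ ⊗ K ^^ t) (λ { (ks , ws) → walk (stream ks (toList ws)) x == y })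
      ... | inj₁ ((ks , ws) , p) = ks , ws , ==-sound _ _ p
      ... | inj₂ none = ⊥-elim (covering ℓ t G bound large (_== y)
              (λ v p → subst (λ v → χ v ≡ true) (sym (==-sound v y p)) (Connected⇒χ conn))
              x y (centre-∈ R) (==-refl y) (λ ks ws → none (ks , ws)))
        where
          G : Graph V
          G = record { π = λ k → act (gen k) ; π-preserves = λ k → preserves (gen k)
                     ; χ = χ ; χ-π = λ k → χ-act (gen k) }
          m = pos b ^ ℓ
          0≤m : 0ℤ ≤ m
          0≤m = ^-nonneg ℓ (pos-nonneg b)
          0<16C : 0ℤ < pos 16 * C
          0<16C = *-pos (ℤ.+<+ (ℕ.s≤s ℕ.z≤n)) 0<C
          key : (pos 16 * C - 1ℤ) * (m + pos r) ≤ m * (pos 16 * C)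
          key = cancel-right {c = m} (ℤ.≤-trans (ℤ.≤-reflexive (sym (slack-id C m (pos r))))
            (+-monoʳ _ (subst (_≤ m) (*-comm (pos r) _) steep)))
          bound : Graph.Bound G m (m + pos r)
          bound f (supp , z) = cancelˡ 0<16C (begin
            pos 16 * C * ((m + pos r) * ∑² (elems V) (Graph.M G f))
              ≡⟨ weaken-l (pos 16 * C) (m + pos r) _ ⟩
            (m + pos r) * (pos 16 * C * ∑² (elems V) (Graph.M G f))
              ≤⟨ *-monoˡ (+-nonneg 0≤m (pos-nonneg r)) (contraction f supp z (card K) (Graph.M G f) (λ v → balanced (λ g → f (act g v)))) ⟩
            (m + pos r) * ((pos 16 * C - 1ℤ) * card K ² * ∑² (elems V) f)
              ≡⟨ weaken-m (m + pos r) _ _ _ ⟩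
            (pos 16 * C - 1ℤ) * (m + pos r) * (card K ² * ∑² (elems V) f)
              ≤⟨ *-monoʳ (*-nonneg (square-nonneg (card K)) (∑²-nonneg (elems V) f)) key ⟩
            m * (pos 16 * C) * (card K ² * ∑² (elems V) f)
              ≡⟨ weaken-r m _ _ _ ⟩
            pos 16 * C * (m * card K ² * ∑² (elems V) f) ∎)
            where open ℤ.≤-Reasoning

-- Labellings whose streams reach every connected node.

module Exploration where

  open import Data.Bool.Base using (Bool; true; false)
  open import Data.Bool.Properties using (not-involutive) renaming (_≟_ to _≟ᵇ_)
  open import Data.Integer.Base using (ℤ; 0ℤ; 1ℤ; _≤_; _<_) renaming (+_ to pos)
  import Data.Integer.Base as ℤ
  import Data.Integer.Properties as ℤ
  open import Data.Integer.Tactic.RingSolver using (solve-∀)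
  open import Data.List.Base using (List; []; _∷_; length; foldl)
  open import Data.Nat.Base as ℕ using (ℕ; zero; suc)
  import Data.Nat.Properties as ℕ
  import Data.Nat.Tactic.RingSolver as ℕSolver
  open import Data.Product.Base using (_,_; ∃-syntax)
  open import Data.Product.Properties using (≡-dec)
  import Data.Vec.Properties as Vec
  open import Data.Vec.Base as Vec using (Vec; []; _∷_; toList)
  open import Relation.Binary.PropositionalEquality
  open import Relation.Nullary.Decidable using (does; yes; dec-true)
  open Int
  open Sums
  open Spectral
  open Expander
  open Tower using (ind)
  open Walk

  opaque
    unfolding _+_ _*_ -_

    blend : ∀ i p → p ≡ i * p + (p - i * p)
    blend = solve-∀

    balance : ∀ k c₄ a b c d → pos 4 * (k * (c₄ * (a + (b + (c + d))))) ≡ pos 2 * (pos 2 * c₄) * k * (a + (b + (c + d)))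
    balance = solve-∀

    ∑-four : ∀ {a b c d} → (a + (b + 0ℤ)) + ((c + (d + 0ℤ)) + 0ℤ) ≡ a + (b + (c + d))
    ∑-four {a} {b} {c} {d} = go a b c d
      where
        go : ∀ a b c d → (a + (b + 0ℤ)) + ((c + (d + 0ℤ)) + 0ℤ) ≡ a + (b + (c + d))
        go = solve-∀

  private
    BitsF : ℕ → Finite
    BitsF L = Bools ^^ L

    NodesF : ℕ → Finite
    NodesF L = BitsF L ⊗ BitsF L

  flip-preserves : ∀ L → Preserves (BitsF L) flip
  flip-preserves zero    f = refl
  flip-preserves (suc L) f = trans (∑-vectors (elems Bools) {L} _)
    (trans (trans (sym (+-assoc _ _ _)) (trans (cong (_+ 0ℤ) (+-comm _ _)) (+-assoc _ _ _))) (sym (∑-vectors (elems Bools) {L} f)))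

  gray-preserves : ∀ L → Preserves (BitsF L) gray
  gray-preserves zero    f = refl
  gray-preserves (suc L) f = trans (∑-vectors (elems Bools) {L} _) (trans
    (cong₂ (λ a b → a + (b + 0ℤ)) (gray-preserves L (λ v → f (false ∷ v))) (flip-preserves L (λ v → f (true ∷ v))))
    (sym (∑-vectors (elems Bools) {L} f)))

  flip-involutive : ∀ {L} (v : Bits L) → flip (flip v) ≡ v
  flip-involutive []       = refl
  flip-involutive (b ∷ v) = cong (_∷ v) (not-involutive b)

  gray-involutive : ∀ {L} (v : Bits L) → gray (gray v) ≡ v
  gray-involutive []          = refl
  gray-involutive (true ∷ v)  = cong (true ∷_) (flip-involutive v)
  gray-involutive (false ∷ v) = cong (false ∷_) (gray-involutive v)

  zeros : ∀ L → Bits L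
  zeros L = Vec.replicate L false

  -- Behind a leading 0, `gray` acts as `gray` on the tail, while `flip`, `gray`, `flip` in
  -- succession act as `flip` on the tail. So both moves are again available for the tail.
  flip-gray-zeros : ∀ {L} (P : Bits L → Set) → (∀ {v} → P v → P (flip v)) → (∀ {v} → P v → P (gray v)) →
                    ∀ v → P v → P (zeros L)
  flip-gray-zeros P f g []       p = p
  flip-gray-zeros {suc L} P f g (b ∷ v) p =
    flip-gray-zeros (λ v → P (false ∷ v)) (λ q → f (g (f q))) g v (to-false b p)
    where
      to-false : ∀ b → P (b ∷ v) → P (false ∷ v)
      to-false false p = p
      to-false true  p = f p

  flip-gray-transitive : ∀ {L} (P : Bits L → Set) → (∀ {v} → P v → P (flip v)) → (∀ {v} → P v → P (gray v)) →
                         ∀ v w → P v → P w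
  flip-gray-transitive P f g v w p = flip-gray-zeros (λ z → P z → P w)
    (λ {v} q p → q (subst P (flip-involutive v) (f p)))
    (λ {v} q p → q (subst P (gray-involutive v) (g p))) w (λ p → p)
    (flip-gray-zeros P f g v p)

  module _ {L : ℕ} (adj : Bits L → Bits L → Bool) (adj-sym : ∀ u x → adj u x ≡ adj x u) where
    open Nodes adj

    act-involutive : ∀ g p → act g (act g p) ≡ p
    act-involutive ide p       = refl
    act-involutive α   (u , x) = cong (u ,_) (flip-involutive x)
    act-involutive β   (u , x) = cong (u ,_) (gray-involutive x)
    act-involutive γ   (u , x) with adj u x in eq
    ... | true  rewrite trans (adj-sym x u) eq = refl
    ... | false rewrite eq = refl

    act-preserves : ∀ g → Preserves (NodesF L) (act g)
    act-preserves ide f = refl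
    act-preserves α   f = trans (∑-× Us Us _) (trans (∑-cong Us (λ u → flip-preserves L (λ x → f (u , x)))) (sym (∑-× Us Us f)))
      where Us = elems (BitsF L)
    act-preserves β   f = trans (∑-× Us Us _) (trans (∑-cong Us (λ u → gray-preserves L (λ x → f (u , x)))) (sym (∑-× Us Us f)))
      where Us = elems (BitsF L)
    -- The indicator of adjacency separates the nodes which are swapped from those which stay.
    -- Exchanging the two summations maps the swapped part to itself, as `adj` is symmetric.
    act-preserves γ   f = begin
      ∑ (elems (NodesF L)) (λ p → f (act γ p))
        ≡⟨ ∑-× Us Us _ ⟩
      ∑ Us (λ u → ∑ Us (λ x → f (act γ (u , x))))
        ≡⟨ ∑-cong Us (λ u → trans (∑-cong Us (λ x → branch u x)) (∑-+ Us _ _)) ⟩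
      ∑ Us (λ u → ∑ Us (λ x → i u x * f (x , u)) + ∑ Us (λ x → f (u , x) - i u x * f (u , x)))
        ≡⟨ ∑-+ Us _ _ ⟩
      ∑ Us (λ u → ∑ Us (λ x → i u x * f (x , u))) + ∑ Us (λ u → ∑ Us (λ x → f (u , x) - i u x * f (u , x)))
        ≡⟨ cong (_+ ∑ Us (λ u → ∑ Us (λ x → f (u , x) - i u x * f (u , x)))) (trans (∑-swap Us Us _) (∑-cong Us λ x → ∑-cong Us λ u → cong (λ b → ind b * f (x , u)) (adj-sym u x))) ⟩
      ∑ Us (λ u → ∑ Us (λ x → i u x * f (u , x))) + ∑ Us (λ u → ∑ Us (λ x → f (u , x) - i u x * f (u , x)))
        ≡⟨ ∑-+ Us _ _ ⟨
      ∑ Us (λ u → ∑ Us (λ x → i u x * f (u , x)) + ∑ Us (λ x → f (u , x) - i u x * f (u , x)))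
        ≡⟨ ∑-cong Us (λ u → trans (sym (∑-+ Us _ _)) (∑-cong Us (λ x → sym (blend (i u x) (f (u , x)))))) ⟩
      ∑ Us (λ u → ∑ Us (λ x → f (u , x)))
        ≡⟨ ∑-× Us Us f ⟨
      ∑ (elems (NodesF L)) f ∎
      where
        open ≡-Reasoning
        Us = elems (BitsF L)
        i : Bits L → Bits L → ℤ
        i u x = ind (adj u x)
        branch : ∀ u x → f (act γ (u , x)) ≡ i u x * f (x , u) + (f (u , x) - i u x * f (u , x))
        branch u x with adj u x
        ... | true  = sym (trans (cong₂ _+_ (*-identityˡ _) (trans (cong (λ z → f (u , x) - z) (*-identityˡ _)) (BaseGraph.sub-self _))) (+-identityʳ _))
        ... | false = sym (trans (cong₂ _+_ (*-zeroˡ _) (trans (cong (λ z → f (u , x) - z) (*-zeroˡ _)) (trans (cong (f (u , x) +_) neg-0) (+-identityʳ _)))) (+-identityˡ _))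

    _==_ : Node L → Node L → Bool
    p == q = does (≡-dec (Vec.≡-dec _≟ᵇ_) (Vec.≡-dec _≟ᵇ_) p q)

    ==-refl : ∀ p → (p == p) ≡ true
    ==-refl p = dec-true (≡-dec (Vec.≡-dec _≟ᵇ_) (Vec.≡-dec _≟ᵇ_) p p) refl

    ==-sound : ∀ p q → (p == q) ≡ true → p ≡ q
    ==-sound p q e with ≡-dec (Vec.≡-dec _≟ᵇ_) (Vec.≡-dec _≟ᵇ_) p q
    ... | yes r = r

  Letter : ℕ → Set
  Letter e = Bits (suc (suc e))

  -- Two bits decide; the other bits of a label make the alphabet and the words large enough for the
  -- expander and the powering.
  gen : ∀ {e c} → Vec (Letter e) (suc c) → Gen
  gen ((false ∷ false ∷ _) ∷ _) = ide
  gen ((false ∷ true  ∷ _) ∷ _) = α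
  gen ((true  ∷ false ∷ _) ∷ _) = β
  gen ((true  ∷ true  ∷ _) ∷ _) = γ

  gen-balanced : ∀ e c (F : Gen → ℤ) →
    pos 4 * ∑ (elems ((Bools ^^ suc (suc e)) ^^ suc c)) (λ k → F (gen k)) ≡
    card ((Bools ^^ suc (suc e)) ^^ suc c) * (F ide + (F α + (F β + F γ)))
  gen-balanced e c F = begin
    pos 4 * ∑ (elems (A ^^ suc c)) (λ k → F (gen k))
      ≡⟨ cong (pos 4 *_) (∑-vectors (elems A) {c} _) ⟩
    pos 4 * ∑ (elems A) (λ a → ∑ (elems (A ^^ c)) (λ ks → F (gen (a ∷ ks))))
      ≡⟨ cong (pos 4 *_) (trans (∑-cong (elems A) head-only) (∑-*ˡ (elems A) _ _)) ⟩
    pos 4 * (card (A ^^ c) * ∑ (elems A) G)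
      ≡⟨ cong (λ z → pos 4 * (card (A ^^ c) * z)) (trans (∑-vectors (elems Bools) {suc e} G)
          (trans (∑-cong (elems Bools) (λ b → trans (∑-vectors (elems Bools) {e} (λ v → G (b ∷ v))) (∑-cong (elems Bools) (λ b′ → ∑-const (elems (Bools ^^ e)) (G (b ∷ b′ ∷ zeros e))))))
            (trans (cong₂ _+_ refl refl) (trans ∑-four pull)))) ⟩
    pos 4 * (card (A ^^ c) * (card (Bools ^^ e) * (F ide + (F α + (F β + F γ)))))
      ≡⟨ balance (card (A ^^ c)) _ _ _ _ _ ⟩
    pos 2 * (pos 2 * card (Bools ^^ e)) * card (A ^^ c) * (F ide + (F α + (F β + F γ)))
      ≡⟨ cong (_* (F ide + (F α + (F β + F γ)))) (sym cards) ⟩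
    card (A ^^ suc c) * (F ide + (F α + (F β + F γ))) ∎
    where
      open ≡-Reasoning
      A = Bools ^^ suc (suc e)
      G : Letter e → ℤ
      G (b ∷ b′ ∷ _) = F (gen {e} {c} ((b ∷ b′ ∷ zeros e) ∷ Vec.replicate c (b ∷ b′ ∷ zeros e)))
      head-only : ∀ a → ∑ (elems (A ^^ c)) (λ ks → F (gen (a ∷ ks))) ≡ card (A ^^ c) * G a
      head-only (false ∷ false ∷ _) = ∑-const (elems (A ^^ c)) _
      head-only (false ∷ true  ∷ _) = ∑-const (elems (A ^^ c)) _
      head-only (true  ∷ false ∷ _) = ∑-const (elems (A ^^ c)) _
      head-only (true  ∷ true  ∷ _) = ∑-const (elems (A ^^ c)) _
      pull : ∀ {c a b d e} → c * a + (c * b + (c * d + c * e)) ≡ c * (a + (b + (d + e)))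
      pull {c} {a} {b} {d} {e} = sym (trans (*-distribˡ-+ c a _) (cong (c * a +_) (trans (*-distribˡ-+ c b _) (cong (c * b +_) (*-distribˡ-+ c d e)))))
      card-suc : ∀ X n → card (X ^^ suc n) ≡ card X * card (X ^^ n)
      card-suc X n = trans (card-^^ X (suc n)) (cong (card X *_) (sym (card-^^ X n)))
      cards : card (A ^^ suc c) ≡ pos 2 * (pos 2 * card (Bools ^^ e)) * card (A ^^ c)
      cards = trans (card-suc A c) (cong (_* card (A ^^ c)) (trans (card-suc Bools (suc e)) (cong (pos 2 *_) (card-suc Bools e))))

  -- All that the machine has to know of the expander: the sizes, the table `h`, and that as many
  -- levels and top labels as a vertex name has bits are enough. What follows is generic in it, so
  -- that the huge sizes stay symbolic.
  record Labelling : Set where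
    field
      e c : ℕ

    Label : Set
    Label = Vec (Letter e) (suc c)

    field
      h : Letter e → Label → Label

    open Stream h toList public

    walk : ∀ {L} → (Bits L → Bits L → Bool) → List Label → Node L → Node L
    walk adj κs p = foldl (λ p κ → Nodes.act adj (gen κ) p) p κs

    field
      covers : ∀ {L} (adj : Bits (suc L) → Bits (suc L) → Bool) → (∀ u x → adj u x ≡ adj x u) →
               ∀ p {q} → Nodes.Reachable adj p q →
               ∃[ ks ] ∃[ ws ] walk adj (stream {suc L} ks (toList {n = suc L} ws)) p ≡ q

  private
    card-Bits : ∀ L → card (BitsF L) ≡ pos (2 ℕ.^ L)
    card-Bits L = trans (card-^^ Bools L) (sym (pos-^ 2 L))

    card-Nodes : ∀ L → length (elems (NodesF L)) ≡ 4 ℕ.^ L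
    card-Nodes L = ℤ.+-injective (trans (card-⊗ (BitsF L) (BitsF L)) (trans (cong₂ _*_ (card-Bits L) (card-Bits L))
      (trans (sym (pos-* (2 ℕ.^ L) (2 ℕ.^ L))) (cong pos (4^ L)))))
      where
        inter : ∀ a → (2 ℕ.* a) ℕ.* (2 ℕ.* a) ≡ 4 ℕ.* (a ℕ.* a)
        inter = ℕSolver.solve-∀
        4^ : ∀ L → 2 ℕ.^ L ℕ.* 2 ℕ.^ L ≡ 4 ℕ.^ L
        4^ zero    = refl
        4^ (suc L) = trans (inter (2 ℕ.^ L)) (cong (4 ℕ.*_) (4^ L))

    -- With N = 4 ^ (L + 1) nodes and r = 16, r times 16 C is at most 1024 N³ = 1024 · 64 ^ (L + 1).
    -- The choice b = 65536 is 1024 · 64.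
    steepℕ : ∀ L → 16 ℕ.* (16 ℕ.* (4 ℕ.^ suc L ℕ.* (suc (4 ℕ.^ suc L) ℕ.* suc (4 ℕ.^ suc L)))) ℕ.≤ 65536 ℕ.^ suc L
    steepℕ L = begin
      16 ℕ.* (16 ℕ.* (N ℕ.* (suc N ℕ.* suc N)))         ≤⟨ ℕ.*-monoʳ-≤ 16 (ℕ.*-monoʳ-≤ 16 (ℕ.*-monoʳ-≤ N (ℕ.*-mono-≤ N+1≤ N+1≤))) ⟩
      16 ℕ.* (16 ℕ.* (N ℕ.* ((N ℕ.+ N) ℕ.* (N ℕ.+ N)))) ≡⟨ regroup N ⟩
      1024 ℕ.* (N ℕ.* N ℕ.* N)                          ≡⟨ cong (1024 ℕ.*_) (trans (cong (ℕ._* N) (sym (ℕ^-distribʳ-* (suc L) 4 4))) (sym (ℕ^-distribʳ-* (suc L) 16 4))) ⟩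
      1024 ℕ.* 64 ℕ.^ suc L                             ≤⟨ ℕ.*-monoˡ-≤ (64 ℕ.^ suc L) (ℕ.≤-trans (ℕ.≤-reflexive (sym (ℕ.*-identityʳ 1024)))
                                                            (ℕ.*-monoʳ-≤ 1024 (ℕ.>-nonZero⁻¹ (1024 ℕ.^ L) {{ℕ.m^n≢0 1024 L}}))) ⟩
      1024 ℕ.^ suc L ℕ.* 64 ℕ.^ suc L                   ≡⟨ ℕ^-distribʳ-* (suc L) 1024 64 ⟨
      65536 ℕ.^ suc L                                   ∎
      where
        open ℕ.≤-Reasoning
        N = 4 ℕ.^ suc L
        N+1≤ : suc N ℕ.≤ N ℕ.+ N
        N+1≤ = ℕ.+-monoˡ-≤ N (ℕ.>-nonZero⁻¹ N {{ℕ.m^n≢0 4 (suc L)}})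
        regroup : ∀ N → 16 ℕ.* (16 ℕ.* (N ℕ.* ((N ℕ.+ N) ℕ.* (N ℕ.+ N)))) ≡ 1024 ℕ.* (N ℕ.* N ℕ.* N)
        regroup = ℕSolver.solve-∀

    -- The square of the number of nodes is 16 ^ (L + 1), hence 1 + r = 17.
    largeℕ : ∀ L → 4 ℕ.^ suc L ℕ.* 4 ℕ.^ suc L ℕ.< 17 ℕ.^ suc L
    largeℕ L = ℕ.≤-<-trans (ℕ.≤-reflexive (sym (ℕ^-distribʳ-* (suc L) 4 4))) (ℕ.^-monoˡ-< (suc L) (ℕ.≤-refl {17}))

  module _ (e n u : ℕ) (2^e : 2 ℕ.^ suc (suc e) ≡ 16 ℕ.* (8 ℕ.* u))
           (room : suc (suc (suc e) ℕ.* (suc n ℕ.* 2)) ℕ.< u)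
           (slack : 64 ℕ.* (65536 ℕ.+ 16) ℕ.≤ 49 ℕ.* suc n) where

    private
      A = Bools ^^ suc (suc e)
      K = A ^^ (suc n ℕ.* 2)
      F = Vec-Fourier (Vec-Fourier Bool-Fourier (suc (suc e))) (suc n ℕ.* 2)

      length-A : length (elems A) ≡ 2 ℕ.^ suc (suc e)
      length-A = ℤ.+-injective (card-Bits (suc (suc e)))

      length-K : length (elems K) ≡ 2 ℕ.^ (suc (suc e) ℕ.* (suc n ℕ.* 2))
      length-K = ℤ.+-injective (trans (card-^^ A (suc n ℕ.* 2)) (trans (sym (pos-^ (length (elems A)) (suc n ℕ.* 2)))
        (cong pos (trans (cong (ℕ._^ (suc n ℕ.* 2)) length-A) (ℕ.^-*-assoc 2 (suc (suc e)) (suc n ℕ.* 2))))))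

      positive : ∀ m → 0ℤ < pos (2 ℕ.^ m)
      positive m = ℤ.+<+ (ℕ.>-nonZero⁻¹ (2 ℕ.^ m) {{ℕ.m^n≢0 2 m}})

      0<K : 0ℤ < card K
      0<K = subst (λ l → 0ℤ < pos l) (sym length-K) (positive (suc (suc e) ℕ.* (suc n ℕ.* 2)))

      0<A : 0ℤ < card A
      0<A = subst (λ l → 0ℤ < pos l) (sym length-A) (positive (suc (suc e)))

      large : 8 ℕ.^ (8 ℕ.* u) ℕ.* (2 ℕ.* length (elems K)) ℕ.< 9 ℕ.^ (8 ℕ.* u)
      large = subst (λ l → 8 ℕ.^ (8 ℕ.* u) ℕ.* (2 ℕ.* l) ℕ.< 9 ℕ.^ (8 ℕ.* u)) (sym length-K)
        (power-gap u (suc (suc (suc e) ℕ.* (suc n ℕ.* 2))) room)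

      h = translation F 0<K (suc (suc e)) (8 ℕ.* u) 2^e large
      expander = translation-expander F 0<K (suc (suc e)) (8 ℕ.* u) 2^e large

      slack′ : pos 64 * (pos 65536 + pos 16) ≤ pos 49 * pos (suc n)
      slack′ = subst₂ _≤_ (trans (pos-* 64 (65536 ℕ.+ 16)) (cong (pos 64 *_) (pos-+ 65536 16))) (pos-* 49 (suc n)) (ℤ.+≤+ slack)

    labelling : Labelling
    labelling = record
      { e = e ; c = suc (n ℕ.* 2) ; h = h
      ; covers = λ {L} adj adj-sym p {q} r →
          BaseGraph.Walks.reaches A (suc n) h 0<A expander gen (gen-balanced e _) 65536 16 (ℕ.s≤s ℕ.z≤n) slack′
            (NodesF (suc L)) (_==_ adj adj-sym) (==-refl adj adj-sym) (==-sound adj adj-sym)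
            (Nodes.act adj) (λ _ → refl) (act-involutive adj adj-sym) (act-preserves adj adj-sym) p
            (suc L) (suc L) (steep L) (large-L L) (0<C L) (connected adj adj-sym p r)
      }
      where
        C : ℕ → ℤ
        C L = card (NodesF (suc L)) * pos (suc (length (elems (NodesF (suc L))))) ²
        C≡ : ∀ L → C L ≡ pos (4 ℕ.^ suc L ℕ.* (suc (4 ℕ.^ suc L) ℕ.* suc (4 ℕ.^ suc L)))
        C≡ L = trans (cong (λ l → pos l * pos (suc l) ²) (card-Nodes (suc L)))
          (trans (cong (pos (4 ℕ.^ suc L) *_) (sym (pos-* (suc (4 ℕ.^ suc L)) _))) (sym (pos-* (4 ℕ.^ suc L) _)))
        0<C : ∀ L → 0ℤ < C L
        0<C L = subst (0ℤ <_) (sym (C≡ L)) (ℤ.+<+ (ℕ.>-nonZero⁻¹ _ {{ℕ.m*n≢0 (4 ℕ.^ suc L) _ {{ℕ.m^n≢0 4 (suc L)}}}}))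
        steep : ∀ L → pos 16 * (pos 16 * C L - 1ℤ) ≤ pos 65536 ^ suc L
        steep L = ℤ.≤-trans (*-monoˡ (pos-nonneg 16) (≤-by 1ℤ (pos-nonneg 1) (sub-add _)))
          (subst₂ _≤_ (trans (pos-* 16 _) (cong (pos 16 *_) (trans (pos-* 16 _) (cong (pos 16 *_) (sym (C≡ L)))))) (pos-^ 65536 (suc L)) (ℤ.+≤+ (steepℕ L)))
          where
            opaque
              unfolding _+_ _*_ -_
              sub-add : ∀ x → x ≡ x - 1ℤ + 1ℤ
              sub-add = solve-∀
        large-L : ∀ L → card (NodesF (suc L)) ² < (1ℤ + pos 16) ^ suc L
        large-L L = subst₂ _<_ (trans (pos-* (4 ℕ.^ suc L) _) (cong (λ l → pos l ²) (sym (card-Nodes (suc L)))))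
          (trans (pos-^ 17 (suc L)) (cong (_^ suc L) (pos-+ 1 16))) (ℤ.+<+ (largeℕ L))
        connected : ∀ {L} (adj : Bits (suc L) → Bits (suc L) → Bool) adj-sym p {q} → Nodes.Reachable adj p q →
          BaseGraph.Component.Connected (NodesF (suc L)) (_==_ adj adj-sym) (==-refl adj adj-sym) (==-sound adj adj-sym)
            (Nodes.act adj) (λ _ → refl) (act-involutive adj adj-sym) (act-preserves adj adj-sym) p q
        connected adj s p Nodes.start      = BaseGraph.Component.start
        connected adj s p (Nodes.move g r) = BaseGraph.Component.move g (connected adj s p r)

  abstract
    -- Letters have 32 bits, labels have 2 · 131072 = 2¹⁸ letters, and u = 2²⁵. Then 2³² = 16 · 8 ·
    -- u; a label has 2²³ bits, and 2²³ + 1 < u; and 64 · 65552 ≤ 49 · 131072. It is abstract so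
    -- that these enumerations are never unfolded.
    the-labelling : Labelling
    the-labelling = labelling 30 131071 33554432 refl (ℕ.<ᵇ⇒< _ _ _) (ℕ.≤ᵇ⇒≤ _ _ _)

-- A language of sweeps and its compilation to Turing machines.

module Machine where

  open import Data.Bool.Base using (Bool; true; false; if_then_else_)
  open import Data.Fin.Base using (Fin; zero; suc)
  open import Data.List.Base as List using (List; []; _∷_; _++_; length; map; lookup)
  import Data.List.Properties as List
  open import Data.List.Membership.Propositional using (_∈_)
  import Data.List.Membership.Propositional.Properties as ∈
  open import Data.List.Relation.Unary.Any as Any using (here; there)
  import Data.List.Relation.Unary.Any.Properties as Any
  open import Data.Maybe.Base as Maybe using (Maybe; just; nothing; maybe)
  open import Data.Nat.Base using (ℕ; zero; suc; _+_; _≤_; z≤n; s≤s)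
  import Data.Nat.Properties as ℕ
  open import Data.Nat.Tactic.RingSolver using (solve-∀)
  open import Data.Product.Base using (_×_; _,_; proj₁; proj₂; ∃-syntax)
  open import Data.Sum.Base using (_⊎_; inj₁; inj₂)
  open import Data.Unit.Base using (⊤; tt)
  open import Data.Vec.Base as Vec using ([]; _∷_)
  open import Relation.Binary.PropositionalEquality
  open import Defs
  open Sums using (Finite; Carrier; elems; complete; _⊗_)

  Units : Finite
  Units = record { Carrier = ⊤ ; elems = tt ∷ [] ; complete = λ _ → here refl }

  infixr 6 _⊞_
  _⊞_ : Finite → Finite → Finite
  X ⊞ Y = record
    { Carrier  = Carrier X ⊎ Carrier Y
    ; elems    = map inj₁ (elems X) ++ map inj₂ (elems Y)
    ; complete = λ { (inj₁ x) → ∈.∈-++⁺ˡ (∈.∈-map⁺ inj₁ (complete X x))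
                   ; (inj₂ y) → ∈.∈-++⁺ʳ (map inj₁ (elems X)) (∈.∈-map⁺ inj₂ (complete Y y)) } }

  Maybes : Finite → Finite
  Maybes X = record
    { Carrier  = Maybe (Carrier X)
    ; elems    = nothing ∷ map just (elems X)
    ; complete = λ { nothing → here refl ; (just x) → there (∈.∈-map⁺ just (complete X x)) } }

  module _ (X : Finite) where
    code : Carrier X → Fin (length (elems X))
    code x = Any.index (complete X x)

    uncode : Fin (length (elems X)) → Carrier X
    uncode = lookup (elems X)

    uncode-code : ∀ x → uncode (code x) ≡ x
    uncode-code x = sym (Any.lookup-index (complete X x))

  -- `append` is a phase of its own: after writing a new cell the head visits the blank to its
  -- right, so that the way back begins there and passes the new cell too.
  data Phase : Set where
    start forwards append backwards : Phase

  Phases : Finite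
  Phases = record
    { Carrier = Phase ; elems = start ∷ forwards ∷ append ∷ backwards ∷ []
    ; complete = λ { start → here refl ; forwards → there (here refl)
                   ; append → there (there (here refl)) ; backwards → there (there (there (here refl))) } }

  -- The work tape holds a block of cells between two blanks, on the left one of
  -- which the head rests between any two instructions.
  module Programs (QF CellF : Finite) where

    Q Cell : Set
    Q    = Carrier QF
    Cell = Carrier CellF

    -- One pass over the cells and back: the head turns at the first cell for
    -- which forth says so, or else at the right blank, where it may add a cell.
    record Sweep : Set where
      field
        forth : Q → Cell → Q × Cell × Bool
        turn  : Q → Q × Maybe Cell
        back  : Q → Cell → Q × Cell

    open Sweep public

    data Prog : Set where
      ctl   : (Q → InputCell Symbol → Q × Direction) → Prog
      sweep : Sweep → Prog
      _⨾_   : Prog → Prog → Prog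
      when  : (Q → Bool) → Prog → Prog
      while : (Q → Bool) → Prog → Prog

    infixr 5 _⨾_

    turned : (s : Sweep) → Q × Maybe Cell → Q × List Cell
    turned s (q , nothing) = q , []
    turned s (q , just c)  = proj₁ (back s q c) , proj₂ (back s q c) ∷ []

    mutual
      runSweep : Sweep → Q → List Cell → Q × List Cell
      runSweep s q []       = turned s (turn s q)
      runSweep s q (c ∷ cs) = swept s cs (forth s q c)

      swept : Sweep → List Cell → Q × Cell × Bool → Q × List Cell
      swept s cs (q , c , false) = q , c ∷ cs
      swept s cs (q , c , true)  = returned s c (runSweep s q cs)

      returned : Sweep → Cell → Q × List Cell → Q × List Cell
      returned s c (q , cs) = proj₁ (back s q c) , proj₂ (back s q c) ∷ cs

    record HC : Set where
      constructor ⟨_,_,_⟩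
      field
        ctrl  : Q
        pos   : ℕ
        cells : List Cell

    open HC public

    module _ (xs : List Symbol) where

      infix 3 _⊢_⇓_
      -- A big-step derivation is finite, so that exhibiting one for every input is at the same time
      -- the proof of termination.
      data _⊢_⇓_ : Prog → HC → HC → Set where
        ctl    : ∀ {f q p cs} → ctl f ⊢ ⟨ q , p , cs ⟩ ⇓
                 ⟨ proj₁ (f q (readInput xs p)) , moveInput (length xs) (proj₂ (f q (readInput xs p))) p , cs ⟩
        sweep  : ∀ {s q p cs q′ cs′} → runSweep s q cs ≡ (q′ , cs′) → sweep s ⊢ ⟨ q , p , cs ⟩ ⇓ ⟨ q′ , p , cs′ ⟩
        seq    : ∀ {P R c d e} → P ⊢ c ⇓ d → R ⊢ d ⇓ e → P ⨾ R ⊢ c ⇓ e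
        whenT  : ∀ {t P c d} → t (ctrl c) ≡ true → P ⊢ c ⇓ d → when t P ⊢ c ⇓ d
        whenF  : ∀ {t P c} → t (ctrl c) ≡ false → when t P ⊢ c ⇓ c
        whileT : ∀ {t P c d e} → t (ctrl c) ≡ true → P ⊢ c ⇓ d → while t P ⊢ d ⇓ e → while t P ⊢ c ⇓ e
        whileF : ∀ {t P c} → t (ctrl c) ≡ false → while t P ⊢ c ⇓ c

    length-runSweep : ∀ s q cs → length cs ≤ length (proj₂ (runSweep s q cs))
    length-runSweep s q []       = z≤n
    length-runSweep s q (c ∷ cs) with forth s q c
    ... | q′ , c′ , false = ℕ.≤-refl
    ... | q′ , c′ , true  = s≤s (length-runSweep s q′ cs)

    -- Cells are never removed, so the length at the end of a computation bounds the space used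
    -- throughout.
    length-⇓ : ∀ xs {P c d} → _⊢_⇓_ xs P c d → length (cells c) ≤ length (cells d)
    length-⇓ xs ctl                       = ℕ.≤-refl
    length-⇓ xs (sweep {s} {q} {cs = cs} e) = subst (λ r → length cs ≤ length (proj₂ r)) e (length-runSweep s q cs)
    length-⇓ xs (seq x y)                 = ℕ.≤-trans (length-⇓ xs x) (length-⇓ xs y)
    length-⇓ xs (whenT _ x)               = length-⇓ xs x
    length-⇓ xs (whenF _)                 = ℕ.≤-refl
    length-⇓ xs (whileT _ x y)            = ℕ.≤-trans (length-⇓ xs x) (length-⇓ xs y)
    length-⇓ xs (whileF _)                = ℕ.≤-refl

    Points : Prog → Finite
    Points (ctl f)     = Units
    Points (sweep s)   = Phases
    Points (P ⨾ R)     = Points P ⊞ Points R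
    Points (when t P)  = Maybes (Points P)
    Points (while t P) = Maybes (Points P)

    Point : Prog → Set
    Point P = Carrier (Points P)

    entry : ∀ P → Point P
    entry (ctl f)     = tt
    entry (sweep s)   = start
    entry (P ⨾ R)     = inj₁ (entry P)
    entry (when t P)  = nothing
    entry (while t P) = nothing

    record Out (X : Set) : Set where
      constructor out
      field
        next  : Maybe X
        ctrl′ : Q
        input : Direction
        write : Maybe Cell
        work  : Direction

    mapNext : ∀ {X Y} → (Maybe X → Maybe Y) → Out X → Out Y
    mapNext f (out n q i w d) = out (f n) q i w d

    stay-at : ∀ {X} → Maybe X → Q → Out X
    stay-at n q = out n q stay nothing stay

    turn-out : Q × Maybe Cell → Out Phase
    turn-out (q , nothing) = out (just backwards) q stay nothing left
    turn-out (q , just c)  = out (just append) q stay (just c) right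

    forth-out : Q × Cell × Bool → Out Phase
    forth-out (q , c , true)  = out (just forwards) q stay (just c) right
    forth-out (q , c , false) = out (just backwards) q stay (just c) left

    sweep-out : Sweep → Phase → Q → Maybe Cell → Out Phase
    sweep-out s start     q m        = out (just forwards) q stay nothing right
    sweep-out s forwards  q nothing  = turn-out (turn s q)
    sweep-out s forwards  q (just c) = forth-out (forth s q c)
    sweep-out s append    q m        = out (just backwards) q stay nothing left
    sweep-out s backwards q nothing  = stay-at nothing q
    sweep-out s backwards q (just c) = out (just backwards) (proj₁ (back s q c)) stay (just (proj₂ (back s q c))) left

    exec : ∀ P → Point P → Q → InputCell Symbol → Maybe Cell → Out (Point P)
    exec (ctl f)     _        q a m = out nothing (proj₁ (f q a)) (proj₂ (f q a)) nothing stay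
    exec (sweep s)   φ        q a m = sweep-out s φ q m
    exec (P ⨾ R)     (inj₁ p) q a m = mapNext (λ n → just (maybe inj₁ (inj₂ (entry R)) n)) (exec P p q a m)
    exec (P ⨾ R)     (inj₂ p) q a m = mapNext (Maybe.map inj₂) (exec R p q a m)
    exec (when t P)  nothing  q a m = stay-at (if t q then just (just (entry P)) else nothing) q
    exec (when t P)  (just p) q a m = mapNext (Maybe.map just) (exec P p q a m)
    exec (while t P) nothing  q a m = stay-at (if t q then just (just (entry P)) else nothing) q
    -- The end of the body, `nothing`, turns into the point `nothing` of the loop, where the test is
    -- repeated.
    exec (while t P) (just p) q a m = mapNext (λ n → just n) (exec P p q a m)

    module Compile (P₀ : Prog) (q₀ : Q) (accepting : Q → Bool) where

      States : Finite
      States = Points P₀ ⊗ QF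

      Mark : Set
      Mark = Fin (suc (length (elems CellF)))

      sym-of : Maybe Cell → Mark
      sym-of nothing  = zero
      sym-of (just c) = suc (code CellF c)

      scan : Mark → Maybe Cell
      scan zero    = nothing
      scan (suc i) = just (uncode CellF i)

      St : Set
      St = State (length (elems States))

      at : Point P₀ → Q → St
      at p q = running (code States (p , q))

      verdict : Q → St
      verdict q = if accepting q then accept else reject

      Act : Set
      Act = Action (length (elems States)) 1 Mark

      act-of : ∀ {X} → (X → Q → St) → (Q → St) → Out X → Act
      act-of ι κ (out n q i w d) = action (maybe (λ p → ι p q) (κ q) n) i ((sym-of w , d) ∷ [])

      M : TuringMachine Symbol
      M = record
        { states = length (elems States)
        ; tapes  = 1
        ; marks  = length (elems CellF)
        ; start  = code States (entry P₀ , q₀)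
        ; δ      = λ { s a (g ∷ []) → act-of at verdict (exec P₀ (proj₁ (uncode States s)) (proj₂ (uncode States s)) a (scan g)) }
        }

      open TuringMachine M using (δ)

      -- P occurs in P₀, control being passed on to κ at its end.
      record Embedded (P : Prog) (κ : Q → St) : Set where
        field
          ι   : Point P → Point P₀
          δ-ι : ∀ p q a g → δ (code States (ι p , q)) a (g ∷ []) ≡ act-of (λ p → at (ι p)) κ (exec P p q a (scan g))

      open Embedded

      whole : Embedded P₀ verdict
      whole = record
        { ι = λ p → p
        ; δ-ι = λ p q a g → cong (λ s → act-of at verdict (exec P₀ (proj₁ s) (proj₂ s) a (scan g))) (uncode-code States (p , q)) }

      module _ {P R κ} (E : Embedded (P ⨾ R) κ) where
        seq-κ : Q → St
        seq-κ = at (ι E (inj₂ (entry R)))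

        first : Embedded P seq-κ
        first = record { ι = λ p → ι E (inj₁ p) ; δ-ι = λ p q a g → trans (δ-ι E (inj₁ p) q a g) (lem (exec P p q a (scan g))) }
          where
            lem : ∀ o → act-of (λ p → at (ι E p)) κ (mapNext (λ n → just (maybe inj₁ (inj₂ (entry R)) n)) o) ≡
                        act-of (λ p → at (ι E (inj₁ p))) seq-κ o
            lem (out (just _) _ _ _ _) = refl
            lem (out nothing  _ _ _ _) = refl

        second : Embedded R κ
        second = record { ι = λ p → ι E (inj₂ p) ; δ-ι = λ p q a g → trans (δ-ι E (inj₂ p) q a g) (lem (exec R p q a (scan g))) }
          where
            lem : ∀ o → act-of (λ p → at (ι E p)) κ (mapNext (Maybe.map inj₂) o) ≡ act-of (λ p → at (ι E (inj₂ p))) κ o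
            lem (out (just _) _ _ _ _) = refl
            lem (out nothing  _ _ _ _) = refl

      when-body : ∀ {t P κ} → Embedded (when t P) κ → Embedded P κ
      when-body {P = P} {κ} E = record { ι = λ p → ι E (just p) ; δ-ι = λ p q a g → trans (δ-ι E (just p) q a g) (lem (exec P p q a (scan g))) }
        where
          lem : ∀ o → act-of (λ p → at (ι E p)) κ (mapNext (Maybe.map just) o) ≡ act-of (λ p → at (ι E (just p))) κ o
          lem (out (just _) _ _ _ _) = refl
          lem (out nothing  _ _ _ _) = refl

      while-body : ∀ {t P κ} (E : Embedded (while t P) κ) → Embedded P (at (ι E nothing))
      while-body {P = P} {κ} E = record { ι = λ p → ι E (just p) ; δ-ι = λ p q a g → trans (δ-ι E (just p) q a g) (lem (exec P p q a (scan g))) }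
        where
          lem : ∀ o → act-of (λ p → at (ι E p)) κ (mapNext (λ n → just n) o) ≡ act-of (λ p → at (ι E (just p))) (at (ι E nothing)) o
          lem (out (just _) _ _ _ _) = refl
          lem (out nothing  _ _ _ _) = refl

      marks-of : List Cell → List Mark
      marks-of = map (λ c → sym-of (just c))

      -- An invariant between instructions: nothing is stored to the left of the left blank, beyond
      -- which no sweep moves, and the right blank is stored explicitly.
      tapeOf : List Cell → Tape Mark
      tapeOf cs = tape [] zero (marks-of cs ++ zero ∷ [])

      cfg : St → ℕ → Tape Mark → Configuration M
      cfg s p t = configuration s p (t ∷ [])

      module Runs (xs : List Symbol) (B : ℕ) where

        -- The bound is asked of each configuration before the last one. No step count is carried
        -- along; `Reach-time` recovers it.
        data Reach : Configuration M → Configuration M → Set where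
          done : ∀ {c} → Reach c c
          next : ∀ {c d} → space M c ≤ B → Reach (step M xs c) d → Reach c d

        Reach-trans : ∀ {c d e} → Reach c d → Reach d e → Reach c e
        Reach-trans done       r = r
        Reach-trans (next b s) r = next b (Reach-trans s r)

        one : ∀ {P κ} (E : Embedded P κ) p {q i ls g rs} m {d} → scan g ≡ m →
              length ls + suc (length rs) + 0 ≤ B →
              (let out n q′ mv w dir = exec P p q (readInput xs i) m in
               Reach (cfg (maybe (λ p → at (ι E p) q′) (κ q′) n) (moveInput (length xs) mv i)
                          (moveHead zero dir (tape ls (sym-of w) rs))) d) →
              Reach (cfg (at (ι E p) q) i (tape ls g rs)) d
        one {P} E p {q} {i} {ls} {g} {rs} m {d} refl b r =
          next b (subst (λ A → Reach (perform M xs (cfg (at (ι E p) q) i (tape ls g rs)) A) d) (sym (δ-ι E p q (readInput xs i) g)) r)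

        scan-just : ∀ c → scan (sym-of (just c)) ≡ just c
        scan-just c = cong just (uncode-code CellF c)

        focusʳ focusˡ : List Mark → List Mark → Tape Mark
        focusʳ ls []       = tape ls zero []
        focusʳ ls (g ∷ rs) = tape ls g rs
        focusˡ []       rs = tape [] zero rs
        focusˡ (g ∷ ls) rs = tape ls g rs

        left-marks right-marks : List Cell → List Mark
        left-marks bs  = marks-of bs ++ zero ∷ []
        right-marks cs = marks-of cs ++ zero ∷ []

        go-left : ∀ bs g rs → moveHead zero left (tape (left-marks bs) g rs) ≡ focusˡ (left-marks bs) (g ∷ rs)
        go-left []       g rs = refl
        go-left (b ∷ bs) g rs = refl

        go-right : ∀ ls g cs → moveHead zero right (tape ls g (right-marks cs)) ≡ focusʳ (g ∷ ls) (right-marks cs)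
        go-right ls g []       = refl
        go-right ls g (c ∷ cs) = refl

        length-marks : ∀ cs → length (marks-of cs ++ zero ∷ []) ≡ length cs + 1
        length-marks cs = trans (List.length-++ (marks-of cs)) (cong (_+ 1) (List.length-map _ cs))

        fits-mid : ∀ bs cs → length bs + suc (length cs) + 2 ≤ B →
                   length (left-marks bs) + suc (length (right-marks cs)) + 0 ≤ B
        fits-mid bs cs = subst (_≤ B) (trans (arith (length bs) (length cs))
            (cong₂ (λ a b → a + suc b + 0) (sym (length-marks bs)) (sym (length-marks cs))))
          where
            arith : ∀ a b → a + suc b + 2 ≡ (a + 1) + suc (b + 1) + 0
            arith = solve-∀

        fits-end : ∀ bs → length bs + 0 + 2 ≤ B → length (left-marks bs) + 1 + 0 ≤ B
        fits-end bs = subst (_≤ B) (trans (arith (length bs)) (cong (λ a → a + 1 + 0) (sym (length-marks bs))))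
          where
            arith : ∀ a → a + 0 + 2 ≡ (a + 1) + 1 + 0
            arith = solve-∀

        fits-home : ∀ cs → length cs + 2 ≤ B → suc (length (right-marks cs)) + 0 ≤ B
        fits-home cs = subst (_≤ B) (trans (arith (length cs)) (cong (λ a → suc a + 0) (sym (length-marks cs))))
          where
            arith : ∀ a → a + 2 ≡ suc (a + 1) + 0
            arith = solve-∀

        -- The cells passed on the way forth are bs, the nearest one first.
        unwind : Sweep → List Cell → Q × List Cell → Q × List Cell
        unwind s []       r = r
        unwind s (c ∷ bs) r = unwind s bs (returned s c r)

        module _ {s : Sweep} {κ : Q → St} (E : Embedded (sweep s) κ) {i : ℕ} where

          Ends : Configuration M → Q × List Cell → Set
          Ends c r = Reach c (cfg (κ (proj₁ r)) i (tapeOf (proj₂ r)))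

          backwards-run : ∀ bs q cs → length bs + length cs + 2 ≤ B →
            Ends (cfg (at (ι E backwards) q) i (focusˡ (left-marks bs) (right-marks cs))) (unwind s bs (q , cs))
          backwards-run []       q cs fit = one E backwards nothing refl (fits-home cs fit) done
          backwards-run (b ∷ bs) q cs fit = one E backwards (just b) (scan-just b) (fits-mid bs cs (subst (_≤ B) (cong (_+ 2) (sym (ℕ.+-suc (length bs) _))) fit))
            (subst (λ t → Ends (cfg (at (ι E backwards) q′) i t) (unwind s bs (q′ , c′ ∷ cs))) (sym (go-left bs _ _))
              (backwards-run bs q′ (c′ ∷ cs) (subst (_≤ B) (cong (_+ 2) (sym (ℕ.+-suc (length bs) _))) fit)))
            where
              q′ = proj₁ (back s q b)
              c′ = proj₂ (back s q b)

          end-run : ∀ bs q r → turn s q ≡ r → length bs + length (proj₂ (turned s r)) + 2 ≤ B →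
            Ends (cfg (at (ι E forwards) q) i (tape (left-marks bs) zero [])) (unwind s bs (turned s r))
          end-run bs q (q′ , nothing) e fit = one E forwards nothing refl (fits-end bs fit)
            (subst (λ o → Reach (cfg (maybe (λ p → at (ι E p) (Out.ctrl′ o)) (κ (Out.ctrl′ o)) (Out.next o)) (moveInput (length xs) (Out.input o) i)
                (moveHead zero (Out.work o) (tape (left-marks bs) (sym-of (Out.write o)) []))) _) (sym (cong turn-out e))
              (subst (λ t → Ends (cfg (at (ι E backwards) q′) i t) (unwind s bs (q′ , []))) (sym (go-left bs _ _))
                (backwards-run bs q′ [] fit)))
          end-run bs q (q′ , just c) e fit = one E forwards nothing refl
            (fits-end bs (ℕ.≤-trans (ℕ.+-monoˡ-≤ 2 (ℕ.+-monoʳ-≤ (length bs) z≤n)) fit))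
            (subst (λ o → Reach (cfg (maybe (λ p → at (ι E p) (Out.ctrl′ o)) (κ (Out.ctrl′ o)) (Out.next o)) (moveInput (length xs) (Out.input o) i)
                (moveHead zero (Out.work o) (tape (left-marks bs) (sym-of (Out.write o)) []))) _) (sym (cong turn-out e))
              (one E append nothing refl (fits-end (c ∷ bs) fit′)
                (subst (λ t → Ends (cfg (at (ι E backwards) q′) i t) (unwind s bs (turned s (q′ , just c)))) (sym (go-left (c ∷ bs) _ _))
                  (backwards-run (c ∷ bs) q′ [] fit′))))
            where
              fit′ : suc (length bs) + 0 + 2 ≤ B
              fit′ = subst (_≤ B) (arith (length bs)) fit
                where
                  arith : ∀ a → a + 1 + 2 ≡ suc a + 0 + 2
                  arith = solve-∀

          -- `unwind` plays the part of a continuation: `back` is still to act on the cells bs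
          -- already passed. With it the nested recursion of `runSweep` follows the head step by
          -- step.
          forwards-run : ∀ bs q cs → length bs + length (proj₂ (runSweep s q cs)) + 2 ≤ B →
            Ends (cfg (at (ι E forwards) q) i (focusʳ (left-marks bs) (right-marks cs))) (unwind s bs (runSweep s q cs))
          forwards-run bs q []       fit = end-run bs q (turn s q) refl fit
          forwards-run bs q (c ∷ cs) fit = one E forwards (just c) (scan-just c)
              (fits-mid bs cs (ℕ.≤-trans (ℕ.+-monoˡ-≤ 2 (ℕ.+-monoʳ-≤ (length bs) (length-runSweep s q (c ∷ cs)))) fit))
              (go (forth s q c) fit)
            where
              go : ∀ r → length bs + length (proj₂ (swept s cs r)) + 2 ≤ B →
                   let o = forth-out r in
                   Ends (cfg (maybe (λ p → at (ι E p) (Out.ctrl′ o)) (κ (Out.ctrl′ o)) (Out.next o)) (moveInput (length xs) (Out.input o) i)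
                        (moveHead zero (Out.work o) (tape (left-marks bs) (sym-of (Out.write o)) (right-marks cs)))) (unwind s bs (swept s cs r))
              go (q′ , c′ , true) fit = subst (λ t → Ends (cfg (at (ι E forwards) q′) i t) (unwind s (c′ ∷ bs) (runSweep s q′ cs))) (sym (go-right _ _ cs))
                (forwards-run (c′ ∷ bs) q′ cs (subst (_≤ B) (cong (_+ 2) (ℕ.+-suc (length bs) _)) fit))
              go (q′ , c′ , false) fit = subst (λ t → Ends (cfg (at (ι E backwards) q′) i t) (unwind s bs (q′ , c′ ∷ cs))) (sym (go-left bs _ _))
                (backwards-run bs q′ (c′ ∷ cs) fit)

          sweep-run : ∀ q cs → length (proj₂ (runSweep s q cs)) + 2 ≤ B →
            Ends (cfg (at (ι E start) q) i (tapeOf cs)) (runSweep s q cs)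
          sweep-run q cs fit = one E start nothing refl
            (fits-home cs (ℕ.≤-trans (ℕ.+-monoˡ-≤ 2 (length-runSweep s q cs)) fit))
            (subst (λ t → Ends (cfg (at (ι E forwards) q) i t) (runSweep s q cs)) (sym (go-right _ _ cs)) (forwards-run [] q cs fit))

          initial-sweep-run : ∀ q → length (proj₂ (runSweep s q [])) + 2 ≤ B →
            Ends (cfg (at (ι E start) q) i (tape [] zero [])) (runSweep s q [])
          initial-sweep-run q fit = one E start nothing refl (ℕ.≤-trans (s≤s z≤n) (ℕ.≤-trans (ℕ.m≤n+m 2 _) fit))
            (forwards-run [] q [] fit)

        home : (Q → St) → HC → Configuration M
        home κ c = cfg (κ (ctrl c)) (pos c) (tapeOf (cells c))

        prog-run : ∀ {P κ} (E : Embedded P κ) {c d} → _⊢_⇓_ xs P c d → length (cells d) + 2 ≤ B →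
                   Reach (home (at (ι E (entry P))) c) (home κ d)
        prog-run E (ctl {cs = cs}) fit = one E tt nothing refl (fits-home cs fit) done
        prog-run E (sweep {s} {q} {cs = cs} refl) fit = sweep-run E q cs fit
        prog-run E (seq x y) fit = Reach-trans
          (prog-run (first E) x (ℕ.≤-trans (ℕ.+-monoˡ-≤ 2 (length-⇓ xs y)) fit)) (prog-run (second E) y fit)
        prog-run {when t P} {κ} E (whenT {c = c} e x) fit =
          one E nothing nothing refl (fits-home (cells c) (ℕ.≤-trans (ℕ.+-monoˡ-≤ 2 (length-⇓ xs x)) fit))
            (subst (λ b → Reach (cfg (maybe (λ p → at (ι E p) (ctrl c)) (κ (ctrl c)) (if b then just (just (entry P)) else nothing)) (pos c) (tapeOf (cells c))) _)
              (sym e) (prog-run (when-body E) x fit))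
        prog-run {when t P} {κ} E (whenF {c = c} e) fit =
          one E nothing nothing refl (fits-home (cells c) fit)
            (subst (λ b → Reach (cfg (maybe (λ p → at (ι E p) (ctrl c)) (κ (ctrl c)) (if b then just (just (entry P)) else nothing)) (pos c) (tapeOf (cells c))) _)
              (sym e) done)
        prog-run {while t P} {κ} E (whileT {c = c} e x y) fit =
          one E nothing nothing refl (fits-home (cells c) (ℕ.≤-trans (ℕ.+-monoˡ-≤ 2 (ℕ.≤-trans (length-⇓ xs x) (length-⇓ xs y))) fit))
            (subst (λ b → Reach (cfg (maybe (λ p → at (ι E p) (ctrl c)) (κ (ctrl c)) (if b then just (just (entry P)) else nothing)) (pos c) (tapeOf (cells c))) _)
              (sym e) (Reach-trans (prog-run (while-body E) x (ℕ.≤-trans (ℕ.+-monoˡ-≤ 2 (length-⇓ xs y)) fit)) (prog-run E y fit)))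
        prog-run {while t P} {κ} E (whileF {c = c} e) fit =
          one E nothing nothing refl (fits-home (cells c) fit)
            (subst (λ b → Reach (cfg (maybe (λ p → at (ι E p) (ctrl c)) (κ (ctrl c)) (if b then just (just (entry P)) else nothing)) (pos c) (tapeOf (cells c))) _)
              (sym e) done)

        from : Configuration M → ℕ → Configuration M
        from c zero    = c
        from c (suc t) = step M xs (from c t)

        from-step : ∀ c t → from (step M xs c) t ≡ from c (suc t)
        from-step c zero    = refl
        from-step c (suc t) = cong (step M xs) (from-step c t)

        Reach-time : ∀ {c d} → Reach c d → ∃[ t ] from c t ≡ d
        Reach-time done = 0 , refl
        Reach-time {c} (next _ r) with Reach-time r
        ... | t , e = suc t , trans (sym (from-step c t)) e

        from-halted : ∀ {d} → step M xs d ≡ d → ∀ t → from d t ≡ d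
        from-halted e zero    = refl
        from-halted e (suc t) = trans (cong (step M xs) (from-halted e t)) e

        Reach-along : ∀ {c d} (P : Configuration M → Set) → (∀ {c} → space M c ≤ B → P c) → P d → step M xs d ≡ d →
                      Reach c d → ∀ t → P (from c t)
        Reach-along P b p e done t = subst P (sym (from-halted e t)) p
        Reach-along P b p e (next x r) zero    = b x
        Reach-along {c} P b p e (next x r) (suc t) = subst P (from-step c t) (Reach-along P b p e r t)

        from-initial : ∀ t → run M xs t ≡ from (initial M) t
        from-initial zero    = refl
        from-initial (suc t) = cong (step M xs) (from-initial t)

        from-+ : ∀ c s t → from c (s + t) ≡ from (from c t) s
        from-+ c zero    t = refl
        from-+ c (suc s) t = cong (step M xs) (from-+ c s t)

    -- A sweep without effect comes first: it brings the empty tape into shape.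
    idle : Sweep
    idle = record { forth = λ q c → q , c , true ; turn = λ q → q , nothing ; back = λ q c → q , c }

    record Decider (P : Prog) (q₀ : Q) (accepting : Q → Bool) : Set where
      field
        machine : TuringMachine Symbol
        accepts : ∀ xs {d} → _⊢_⇓_ xs P ⟨ q₀ , 0 , [] ⟩ d → accepting (ctrl d) ≡ true → Accepts machine xs
        accepted : ∀ xs {d} → _⊢_⇓_ xs P ⟨ q₀ , 0 , [] ⟩ d → Accepts machine xs → accepting (ctrl d) ≡ true
        halts   : ∀ xs {d} → _⊢_⇓_ xs P ⟨ q₀ , 0 , [] ⟩ d → Halts machine xs
        bounded : ∀ xs {d} → _⊢_⇓_ xs P ⟨ q₀ , 0 , [] ⟩ d → ∀ t → space machine (run machine xs t) ≤ length (cells d) + 2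

    module _ (P : Prog) (q₀ : Q) (accepting : Q → Bool) where

      private
        module C = Compile (sweep idle ⨾ P) q₀ accepting
        machine = C.M

        outcome : Bool → C.St
        outcome b = if b then accept else reject

        halted : Bool → Configuration machine → Set
        halted b c = state c ≡ outcome b

        verdict-halted : ∀ b (c : Configuration machine) → halted b c → ∀ xs → step machine xs c ≡ c
        verdict-halted true  (configuration .accept _ _) refl xs = refl
        verdict-halted false (configuration .reject _ _) refl xs = refl

        module _ (xs : List Symbol) {d : HC} (computation : _⊢_⇓_ xs P ⟨ q₀ , 0 , [] ⟩ d) where
          -- The final block together with the blanks at its two ends.
          B = length (cells d) + 2
          open C.Runs xs B

          end : Configuration machine
          end = home C.verdict d

          reach : Reach (initial machine) end
          reach = Reach-trans (initial-sweep-run (C.first C.whole) q₀ (ℕ.m≤n+m 2 _))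
                              (prog-run (C.second C.whole) computation ℕ.≤-refl)

          stops : step machine xs end ≡ end
          stops = verdict-halted (accepting (ctrl d)) end refl xs

          ends : ∃[ t ] run machine xs t ≡ end
          ends with Reach-time reach
          ... | t , e = t , trans (from-initial t) e

          run-bounded : ∀ t → space machine (run machine xs t) ≤ B
          run-bounded t = subst (λ c → space machine c ≤ B) (sym (from-initial t))
            (Reach-along (λ c → space machine c ≤ B) (λ b → b) (fits-home (cells d) ℕ.≤-refl) stops reach t)

          -- Both run t and end are halting configurations reached from the start.
          unique : ∀ t → state (run machine xs t) ≡ accept → run machine xs t ≡ end
          unique t e = begin
            run machine xs t                            ≡⟨ from-halted (verdict-halted true _ e xs) t₀ ⟨
            from (run machine xs t) t₀                  ≡⟨ cong (λ c → from c t₀) (from-initial t) ⟩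
            from (from (initial machine) t) t₀          ≡⟨ from-+ (initial machine) t₀ t ⟨
            from (initial machine) (t₀ + t)             ≡⟨ cong (from (initial machine)) (ℕ.+-comm t₀ t) ⟩
            from (initial machine) (t + t₀)             ≡⟨ from-+ (initial machine) t t₀ ⟩
            from (from (initial machine) t₀) t          ≡⟨ cong (λ c → from c t) (proj₂ (Reach-time reach)) ⟩
            from end t                                  ≡⟨ from-halted stops t ⟩
            end                                         ∎
            where
              open ≡-Reasoning
              t₀ = proj₁ (Reach-time reach)

          verdict-accepts : accepting (ctrl d) ≡ true → Accepts machine xs
          verdict-accepts e = proj₁ ends , trans (cong state (proj₂ ends)) (cong outcome e)

          verdict-accepted : Accepts machine xs → accepting (ctrl d) ≡ true
          verdict-accepted (t , e) = go (accepting (ctrl d)) (trans (cong state (sym (unique t e))) e)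
            where
              go : ∀ b → outcome b ≡ accept → b ≡ true
              go true _ = refl

          verdict-halts : Halts machine xs
          verdict-halts = go (accepting (ctrl d)) refl
            where
              go : ∀ b → halted b end → Halts machine xs
              go true  e = inj₁ (proj₁ ends , trans (cong state (proj₂ ends)) e)
              go false e = inj₂ (proj₁ ends , trans (cong state (proj₂ ends)) e)

      -- Abstract, since the states of a concrete program are too many to be listed.
      abstract
        decider : Decider P q₀ accepting
        decider = record { machine = machine ; accepts = verdict-accepts ; accepted = verdict-accepted
                         ; halts = verdict-halts ; bounded = run-bounded }

-- Counters, registers and the stepwise generation of labels.

module Registers where

  open import Data.Bool.Base using (Bool; true; false; not; _∧_; if_then_else_)
  open import Data.Bool.Properties using (∧-assoc; ∧-identityʳ)
  open import Data.List.Base as List using (List; []; _∷_; _++_; length; map; concatMap)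
  open import Data.List.Membership.Propositional using (_∈_)
  import Data.List.Membership.Propositional.Properties as ∈
  open import Data.List.Relation.Unary.Any using (here; there)
  open import Data.Maybe.Base as Maybe using (Maybe; just; nothing; maybe; is-nothing)
  open import Data.Nat.Base using (ℕ; zero; suc)
  open import Data.Product.Base using (_×_; _,_; proj₁; proj₂; ∃-syntax)
  open import Data.Vec.Base as Vec using (Vec; []; _∷_; head; tail; toList; _∷ʳ_)
  open import Function.Base using (id)
  open import Relation.Binary.PropositionalEquality
  open import Defs using (Symbol)
  import Defs
  open Sums using (Finite; Carrier; elems; complete; _⊗_; Bools; _^^_)
  open Walk
  open Exploration using (Labelling; Letter)
  open Machine

  -- Certifies that iterating `next` runs through exactly this list and then overflows; the loops
  -- over a counter recurse on it.
  data Chain {X : Set} (next : X → Maybe X) : X → List X → Set where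
    last : ∀ {x} → next x ≡ nothing → Chain next x (x ∷ [])
    more : ∀ {x y ys} → next x ≡ just y → Chain next y ys → Chain next x (x ∷ ys)

  record Counter (X : Set) : Set where
    field
      first : X
      next  : X → Maybe X
      all   : List X
      chain : Chain next first all
      ∈-all : ∀ x → x ∈ all

  Bool-Counter : Counter Bool
  Bool-Counter = record
    { first = false ; next = λ { false → just true ; true → nothing } ; all = false ∷ true ∷ []
    ; chain = more refl (last refl) ; ∈-all = λ { false → here refl ; true → there (here refl) } }

  module _ {X : Set} (C : Counter X) where
    open Counter C

    firsts : ∀ {n} → Vec X n
    firsts = Vec.replicate _ first

    -- An odometer whose first digit moves fastest, with `nothing` for overflow. It serves for
    -- numbers, labels and vectors of trials alike.
    nexts : ∀ {n} → Vec X n → Maybe (Vec X n)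
    nexts []       = nothing
    nexts (x ∷ xs) = maybe (λ y → just (y ∷ xs)) (Maybe.map (first ∷_) (nexts xs)) (next x)

    tuples : ∀ n → List (Vec X n)
    tuples zero    = [] ∷ []
    tuples (suc n) = concatMap (λ xs → map (_∷ xs) all) (tuples n)

    private
      chain-last : ∀ {n} {xs : Vec X n} {x ys} → nexts xs ≡ nothing → Chain next x ys → Chain nexts (x ∷ xs) (map (_∷ xs) ys)
      chain-last {xs = xs} e (last {x} f) = last (trans (cong (maybe (λ y → just (y ∷ xs)) (Maybe.map (first ∷_) (nexts xs))) f) (cong (Maybe.map (first ∷_)) e))
      chain-last {xs = xs} e (more {x} f c) = more (cong (maybe (λ y → just (y ∷ xs)) (Maybe.map (first ∷_) (nexts xs))) f) (chain-last e c)

      chain-more : ∀ {n} {xs xs′ : Vec X n} {x ys zs} → nexts xs ≡ just xs′ → Chain next x ys → Chain nexts (first ∷ xs′) zs →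
                   Chain nexts (x ∷ xs) (map (_∷ xs) ys ++ zs)
      chain-more {xs = xs} e (last f) d = more (trans (cong (maybe (λ y → just (y ∷ xs)) (Maybe.map (first ∷_) (nexts xs))) f) (cong (Maybe.map (first ∷_)) e)) d
      chain-more {xs = xs} e (more f c) d = more (cong (maybe (λ y → just (y ∷ xs)) (Maybe.map (first ∷_) (nexts xs))) f) (chain-more e c d)

      chain-∷ : ∀ {n} {xs : Vec X n} {xss} → Chain nexts xs xss → Chain nexts (first ∷ xs) (concatMap (λ xs → map (_∷ xs) all) xss)
      chain-∷ (last e)   = subst (Chain nexts _) (sym (++-[] _)) (chain-last e chain)
        where
          ++-[] : ∀ {A : Set} (ys : List A) → ys ++ [] ≡ ys
          ++-[] []       = refl
          ++-[] (y ∷ ys) = cong (y ∷_) (++-[] ys)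
      chain-∷ (more e c) = chain-more e chain (chain-∷ c)

    tuples-chain : ∀ n → Chain nexts firsts (tuples n)
    tuples-chain zero    = last refl
    tuples-chain (suc n) = chain-∷ (tuples-chain n)

    ∈-tuples : ∀ {n} (xs : Vec X n) → xs ∈ tuples n
    ∈-tuples []       = here refl
    ∈-tuples (x ∷ xs) = ∈.∈-concatMap⁺ (λ xs → map (_∷ xs) all) {xs = tuples _}
      (lift (∈-tuples xs))
      where
        open import Data.List.Relation.Unary.Any as Any using (Any)
        lift : ∀ {xss} → xs ∈ xss → Any (λ ys → (x ∷ xs) ∈ map (_∷ ys) all) xss
        lift (here refl) = here (∈.∈-map⁺ (_∷ xs) (∈-all x))
        lift (there i)   = there (lift i)

    Vec-Counter : ∀ n → Counter (Vec X n)
    Vec-Counter n = record { first = firsts ; next = nexts ; all = tuples n ; chain = tuples-chain n ; ∈-all = ∈-tuples }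

  retract : (X : Finite) {B : Set} (to : Carrier X → B) (from : B → Carrier X) → (∀ b → to (from b) ≡ b) → Finite
  retract X {B} to from e = record
    { Carrier = B ; elems = list ; complete = complete-list }
    where
      -- Abstract, since normalising a product of many factors is not feasible.
      abstract
        list : List B
        list = map to (elems X)

        complete-list : ∀ b → b ∈ list
        complete-list b = subst (_∈ list) (e b) (∈.∈-map⁺ to (complete X (from b)))

  _==ᵇ_ : Bool → Bool → Bool
  true  ==ᵇ b = b
  false ==ᵇ b = not b

  _==ᵛ_ : ∀ {n} → Bits n → Bits n → Bool
  []       ==ᵛ []       = true
  (a ∷ as) ==ᵛ (b ∷ bs) = (a ==ᵇ b) ∧ (as ==ᵛ bs)

  -- Numbers have their least significant bit first.
  shiftIn : ∀ {n} → Bool → Bits n → Bits n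
  shiftIn b []       = []
  shiftIn b (a ∷ as) = b ∷ shiftIn a as

  module Layout (Λ : Labelling) where
    open Labelling Λ

    LabelF : Finite
    LabelF = (Bools ^^ suc (suc e)) ^^ suc c

    Label-Counter : Counter Label
    Label-Counter = Vec-Counter (Vec-Counter Bool-Counter (suc (suc e))) (suc c)

    -- The label with which a level starts, and its label in the top walk.
    Trial : Set
    Trial = Vec Label 2

    Trial-Counter : Counter Trial
    Trial-Counter = Vec-Counter Label-Counter 2

    k₀ w₀ : Trial → Label
    k₀ (k ∷ w ∷ []) = k
    w₀ (k ∷ w ∷ []) = w

    -- The part of a label still to be followed, padded on the right.
    Rem : Set
    Rem = Vec (Maybe (Letter e)) (suc c)

    rest : ∀ {n} → Vec (Maybe (Letter e)) n → List (Letter e)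
    rest []             = []
    rest (nothing ∷ r)  = []
    rest (just a ∷ r)   = a ∷ rest r

    pop : ∀ {n} → Vec (Maybe (Letter e)) n → Maybe (Letter e × Vec (Maybe (Letter e)) n)
    pop []            = nothing
    pop (nothing ∷ r) = nothing
    pop (just a ∷ r)  = just (a , r ∷ʳ nothing)

    rest-∷ʳ : ∀ {n} (r : Vec (Maybe (Letter e)) n) → rest (r ∷ʳ nothing) ≡ rest r
    rest-∷ʳ []            = refl
    rest-∷ʳ (nothing ∷ r) = refl
    rest-∷ʳ (just a ∷ r)  = cong (a ∷_) (rest-∷ʳ r)

    rest-map-just : ∀ {n} (as : Vec (Letter e) n) → rest (Vec.map just as) ≡ toList as
    rest-map-just []       = refl
    rest-map-just (a ∷ as) = cong (a ∷_) (rest-map-just as)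

    pop-just : ∀ {n} (r : Vec (Maybe (Letter e)) n) {a r′} → pop r ≡ just (a , r′) → rest r ≡ a ∷ rest r′
    pop-just (just a ∷ r) refl = cong (a ∷_) (sym (rest-∷ʳ r))

    pop-nothing : ∀ {n} (r : Vec (Maybe (Letter e)) n) → pop r ≡ nothing → rest r ≡ []
    pop-nothing []            _ = refl
    pop-nothing (nothing ∷ r) _ = refl

    -- u and x: the current node; s: the start vertex; v and w: the input
    -- vertices; o: the order of the graph; i, j and n: matrix indices, wrapping
    -- at n.
    record Regs (F : Set → Set) : Set where
      constructor regs
      field
        s u x v w n o i j : F Bool
        trial             : F Trial
        k                 : F Label
        rem               : F Rem
        used              : F Bool

    open Regs public

    Cell : Set
    Cell = Regs id

    CellF : Finite
    CellF = retract
      (Bools ⊗ Bools ⊗ Bools ⊗ Bools ⊗ Bools ⊗ Bools ⊗ Bools ⊗ Bools ⊗ Bools ⊗ (LabelF ^^ 2) ⊗ LabelF ⊗ (Maybes (Bools ^^ suc (suc e)) ^^ suc c) ⊗ Bools)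
      (λ { (s , u , x , v , w , n , o , i , j , t , k , r , d) → regs s u x v w n o i j t k r d })
      (λ (r : Cell) → s r , u r , x r , v r , w r , n r , o r , i r , j r , trial r , k r , rem r , used r)
      (λ r → refl)

    -- f and g: scratch flags; lab: the current label; adj: the result of the
    -- last adjacency test; ans: the verdict, once it has been reached.
    record Control : Set where
      constructor control
      field
        f g : Bool
        lab : Label
        adj : Bool
        ans : Maybe Bool

    open Control public

    ControlF : Finite
    ControlF = retract (Bools ⊗ Bools ⊗ LabelF ⊗ Bools ⊗ Maybes Bools)
      (λ { (f , g , l , a , m) → control f g l a m }) (λ (q : Control) → f q , g q , lab q , adj q , ans q) (λ q → refl)

    open Programs ControlF CellF public hiding (Q; Cell)

    Bank : ℕ → Set
    Bank L = Regs (λ X → Vec X L)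

    headR : ∀ {L} → Bank (suc L) → Cell
    headR (regs s u x v w n o i j t k r d) =
      regs (head s) (head u) (head x) (head v) (head w) (head n) (head o) (head i) (head j) (head t) (head k) (head r) (head d)

    tailR : ∀ {L} → Bank (suc L) → Bank L
    tailR (regs s u x v w n o i j t k r d) =
      regs (tail s) (tail u) (tail x) (tail v) (tail w) (tail n) (tail o) (tail i) (tail j) (tail t) (tail k) (tail r) (tail d)

    -- A transposition: a bank has one vector for each register, the tape one cell for each
    -- position.
    Z : ∀ {L} → Bank L → List Cell
    Z {zero}  R = []
    Z {suc L} R = headR R ∷ Z (tailR R)

    length-Z : ∀ {L} (R : Bank L) → length (Z R) ≡ L
    length-Z {zero}  R = refl
    length-Z {suc L} R = cong suc (length-Z (tailR R))

    -- A lens on cells and on banks at once. Its laws allow a sweep to be verified once for all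
    -- registers of a type.
    record Register (X : Set) : Set where
      field
        getC     : Cell → X
        setC     : X → Cell → Cell
        getB     : ∀ {L} → Bank L → Vec X L
        setB     : ∀ {L} → Vec X L → Bank L → Bank L
        get-head : ∀ {L} (R : Bank (suc L)) → getC (headR R) ≡ head (getB R)
        get-tail : ∀ {L} (R : Bank (suc L)) → getB (tailR R) ≡ tail (getB R)
        set-head : ∀ {L} (y : Vec X (suc L)) R → headR (setB y R) ≡ setC (head y) (headR R)
        set-tail : ∀ {L} (y : Vec X (suc L)) R → tailR (setB y R) ≡ setB (tail y) (tailR R)
        set-get  : ∀ {L} (R : Bank L) → setB (getB R) R ≡ R
        get-set  : ∀ {L} (y : Vec X L) R → getB (setB y R) ≡ y

    open Register public

    u-reg : Register Bool
    u-reg = record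
      { getC = u ; setC = λ y c → record c { u = y } ; getB = u ; setB = λ y R → record R { u = y }
      ; get-head = λ R → refl ; get-tail = λ R → refl ; set-head = λ y R → refl ; set-tail = λ y R → refl ; set-get = λ R → refl ; get-set = λ y R → refl }

    x-reg : Register Bool
    x-reg = record
      { getC = x ; setC = λ y c → record c { x = y } ; getB = x ; setB = λ y R → record R { x = y }
      ; get-head = λ R → refl ; get-tail = λ R → refl ; set-head = λ y R → refl ; set-tail = λ y R → refl ; set-get = λ R → refl ; get-set = λ y R → refl }

    s-reg : Register Bool
    s-reg = record
      { getC = s ; setC = λ y c → record c { s = y } ; getB = s ; setB = λ y R → record R { s = y }
      ; get-head = λ R → refl ; get-tail = λ R → refl ; set-head = λ y R → refl ; set-tail = λ y R → refl ; set-get = λ R → refl ; get-set = λ y R → refl }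

    n-reg : Register Bool
    n-reg = record
      { getC = n ; setC = λ y c → record c { n = y } ; getB = n ; setB = λ y R → record R { n = y }
      ; get-head = λ R → refl ; get-tail = λ R → refl ; set-head = λ y R → refl ; set-tail = λ y R → refl ; set-get = λ R → refl ; get-set = λ y R → refl }

    i-reg : Register Bool
    i-reg = record
      { getC = i ; setC = λ y c → record c { i = y } ; getB = i ; setB = λ y R → record R { i = y }
      ; get-head = λ R → refl ; get-tail = λ R → refl ; set-head = λ y R → refl ; set-tail = λ y R → refl ; set-get = λ R → refl ; get-set = λ y R → refl }

    j-reg : Register Bool
    j-reg = record
      { getC = j ; setC = λ y c → record c { j = y } ; getB = j ; setB = λ y R → record R { j = y }
      ; get-head = λ R → refl ; get-tail = λ R → refl ; set-head = λ y R → refl ; set-tail = λ y R → refl ; set-get = λ R → refl ; get-set = λ y R → refl }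

    v-reg : Register Bool
    v-reg = record
      { getC = v ; setC = λ y c → record c { v = y } ; getB = v ; setB = λ y R → record R { v = y }
      ; get-head = λ R → refl ; get-tail = λ R → refl ; set-head = λ y R → refl ; set-tail = λ y R → refl ; set-get = λ R → refl ; get-set = λ y R → refl }

    w-reg : Register Bool
    w-reg = record
      { getC = w ; setC = λ y c → record c { w = y } ; getB = w ; setB = λ y R → record R { w = y }
      ; get-head = λ R → refl ; get-tail = λ R → refl ; set-head = λ y R → refl ; set-tail = λ y R → refl ; set-get = λ R → refl ; get-set = λ y R → refl }

    trial-reg : Register Trial
    trial-reg = record
      { getC = trial ; setC = λ y c → record c { trial = y } ; getB = trial ; setB = λ y R → record R { trial = y }
      ; get-head = λ R → refl ; get-tail = λ R → refl ; set-head = λ y R → refl ; set-tail = λ y R → refl ; set-get = λ R → refl ; get-set = λ y R → refl }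

    Z-∷ : ∀ {L X} (ρ : Register X) (R : Bank (suc L)) y {ys} → Z (setB ρ (y ∷ ys) R) ≡ setC ρ y (headR R) ∷ Z (setB ρ ys (tailR R))
    Z-∷ ρ R y {ys} = cong₂ (λ a b → a ∷ Z b) (set-head ρ (y ∷ ys) R) (set-tail ρ (y ∷ ys) R)

    -- The successor of a register, with f telling whether it overflowed.

    odoForth : {X : Set} → Counter X → Register X → Control → Cell → Maybe X → Control × Cell × Bool
    odoForth C ρ q c (just y) = record q { f = false } , setC ρ y c , false
    odoForth C ρ q c nothing  = q , setC ρ (Counter.first C) c , true

    odo : {X : Set} → Counter X → Register X → Sweep
    odo C ρ = record
      { forth = λ q c → odoForth C ρ q c (Counter.next C (getC ρ c))
      ; turn  = λ q → record q { f = true } , nothing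
      ; back  = λ q c → q , c }

    overflow : {X : Set} → Maybe X → Bool
    overflow = is-nothing

    run-odo : ∀ {X} (C : Counter X) (ρ : Register X) q {L} (R : Bank L) →
      runSweep (odo C ρ) q (Z R) ≡
      (record q { f = overflow (nexts C (getB ρ R)) } , Z (setB ρ (maybe id (firsts C) (nexts C (getB ρ R))) R))
    run-odo C ρ q {zero} R = cong₂ _,_ (cong (λ m → record q { f = is-nothing m }) (sym (nil (getB ρ R)))) refl
      where
        nil : ∀ v → nexts C v ≡ nothing
        nil [] = refl
    run-odo {X} C ρ q {suc L} R = trans
        (cong (λ y → swept (odo C ρ) (Z (tailR R)) (odoForth C ρ q (headR R) (next y))) (get-head ρ R))
        (trans (digit (next (head (getB ρ R)))) (cong goal (sym (head-tail (getB ρ R)))))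
      where
        open Counter C
        goal : Vec X (suc L) → Control × List Cell
        goal ys = record q { f = overflow (nexts C ys) } , Z (setB ρ (maybe id (firsts C) (nexts C ys)) R)
        after : Maybe (Vec X (suc L)) → Control × List Cell
        after m = record q { f = overflow m } , Z (setB ρ (maybe id (firsts C) m) R)
        ys = tail (getB ρ R)
        head-tail : (v : Vec X (suc L)) → v ≡ head v ∷ tail v
        head-tail (x ∷ v) = refl
        tail-same : Z (setB ρ ys (tailR R)) ≡ Z (tailR R)
        tail-same = cong Z (trans (cong (λ t → setB ρ t (tailR R)) (sym (get-tail ρ R))) (set-get ρ (tailR R)))
        carry : ∀ m → (record q { f = overflow m } , setC ρ first (headR R) ∷ Z (setB ρ (maybe id (firsts C) m) (tailR R))) ≡
                      after (Maybe.map (first ∷_) m)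
        carry (just zs) = cong (record q { f = false } ,_) (sym (Z-∷ ρ R first))
        carry nothing   = cong (record q { f = true } ,_) (sym (Z-∷ ρ R first))
        digit : ∀ m → swept (odo C ρ) (Z (tailR R)) (odoForth C ρ q (headR R) m) ≡
                      after (maybe (λ y → just (y ∷ ys)) (Maybe.map (first ∷_) (nexts C ys)) m)
        digit (just z) = cong (record q { f = false } ,_) (sym (trans (Z-∷ ρ R z) (cong (setC ρ z (headR R) ∷_) tail-same)))
        digit nothing  = trans (cong (returned (odo C ρ) (setC ρ first (headR R))) (run-odo C ρ q (tailR R)))
          (trans (cong (λ t → record q { f = overflow (nexts C t) } , setC ρ first (headR R) ∷ Z (setB ρ (maybe id (firsts C) (nexts C t)) (tailR R)))
                   (get-tail ρ R))
                 (carry (nexts C ys)))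

    shift : Register Bool → Sweep
    shift ρ = record
      { forth = λ q c → record q { g = getC ρ c } , setC ρ (g q) c , true
      ; turn  = λ q → q , nothing
      ; back  = λ q c → q , c }

    run-shift : ∀ ρ q {L} (R : Bank L) → ∃[ b ]
      runSweep (shift ρ) q (Z R) ≡ (record q { g = b } , Z (setB ρ (shiftIn (g q) (getB ρ R)) R))
    run-shift ρ q {zero} R = g q , refl
    run-shift ρ q {suc L} R = proj₁ ih , trans (cong (returned (shift ρ) (setC ρ (g q) (headR R))) (proj₂ ih))
        (cong (record q { g = proj₁ ih } ,_) (trans
          (cong₂ (λ y ys → setC ρ (g q) (headR R) ∷ Z (setB ρ (shiftIn y ys) (tailR R))) (get-head ρ R) (get-tail ρ R))
          (trans (sym (Z-∷ ρ R (g q))) (cong (λ t → Z (setB ρ t R)) (sym (shiftIn-∷ (getB ρ R)))))))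
      where
        ih = run-shift ρ (record q { g = getC ρ (headR R) }) (tailR R)
        shiftIn-∷ : ∀ v → shiftIn (g q) v ≡ g q ∷ shiftIn (head v) (tail v)
        shiftIn-∷ (y ∷ v) = refl

    test : (Cell → Bool) → (Cell → Bool) → Sweep
    test φ ψ = record
      { forth = λ q c → record q { f = f q ∧ φ c ; g = g q ∧ ψ c } , c , true
      ; turn  = λ q → q , nothing
      ; back  = λ q c → q , c }

    allᵇ : (Cell → Bool) → List Cell → Bool
    allᵇ φ []       = true
    allᵇ φ (c ∷ cs) = φ c ∧ allᵇ φ cs

    run-test : ∀ φ ψ q cs → runSweep (test φ ψ) q cs ≡ (record q { f = f q ∧ allᵇ φ cs ; g = g q ∧ allᵇ ψ cs } , cs)
    run-test φ ψ q []       = cong₂ (λ a b → record q { f = a ; g = b } , []) (sym (∧-identityʳ (f q))) (sym (∧-identityʳ (g q)))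
    run-test φ ψ q (c ∷ cs) = trans (cong (returned (test φ ψ) c) (run-test φ ψ _ cs))
      (cong₂ (λ a b → record q { f = a ; g = b } , c ∷ cs) (∧-assoc (f q) (φ c) _) (∧-assoc (g q) (ψ c) _))

    each : (Cell → Cell) → Sweep
    each h = record { forth = λ q c → q , h c , true ; turn = λ q → q , nothing ; back = λ q c → q , c }

    run-each : ∀ h q cs → runSweep (each h) q cs ≡ (q , map h cs)
    run-each h q []       = refl
    run-each h q (c ∷ cs) = cong (returned (each h) (h c)) (run-each h q cs)

    flipX : Sweep
    flipX = record { forth = λ q c → q , record c { x = not (x c) } , false ; turn = λ q → q , nothing ; back = λ q c → q , c }

    run-flipX : ∀ q {L} (R : Bank L) → runSweep flipX q (Z R) ≡ (q , Z (record R { x = flip (x R) }))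
    run-flipX q {zero} R = refl
    run-flipX q {suc L} (regs s u (b ∷ bs) v w n o i j t k r d) = refl

    -- f tells that a 1 has been passed.
    grayX : Sweep
    grayX = record
      { forth = λ q c → if f q then (q , record c { x = not (x c) } , false) else (record q { f = x c } , c , true)
      ; turn = λ q → q , nothing ; back = λ q c → q , c }

    run-grayX : ∀ q {L} (R : Bank L) → f q ≡ false →
      ∃[ b ] runSweep grayX q (Z R) ≡ (record q { f = b } , Z (record R { x = gray (x R) }))
    run-grayX q {zero} R e = f q , refl
    run-grayX (control false g l a m) {suc L} (regs s u (false ∷ bs) v w n o i j t k r d) refl =
        proj₁ ih , cong (returned grayX (headR R)) (proj₂ ih)
      where
        R = regs s u (false ∷ bs) v w n o i j t k r d
        ih = run-grayX (control false g l a m) (tailR R) refl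
    run-grayX (control false g l a m) {suc zero} (regs s u (true ∷ []) v w n o i j t k r d) refl = true , refl
    run-grayX (control false g l a m) {suc (suc L)} (regs s u (true ∷ b ∷ bs) v w n o i j t k r d) refl = true , refl

    -- A level without remaining letters receives the label lab from above.
    load : Control → Cell → Maybe (Letter e × Rem) → Control × Cell
    load q c nothing        = q , c
    load q c (just (a , r)) = record q { lab = h a (k c) } , record c { k = h a (k c) ; rem = r }

    descend : Control → Cell → Control × Cell
    descend q c = if f q then load q c (pop (Vec.map just (lab q))) else (q , c)

    popForth : Control → Cell → Maybe (Letter e × Rem) → Control × Cell × Bool
    popForth q c nothing        = q , c , true
    popForth q c (just (a , r)) = record q { f = true ; lab = h a (k c) } , record c { k = h a (k c) ; rem = r } , false

    -- On the way out, the lowest level that still has letters follows one. On the way back each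
    -- level below it, being exhausted, reloads from the label just produced above and follows the
    -- first letter of that. If no level has letters left, the flag stays false and nothing changes.
    popLevel : Sweep
    popLevel = record { forth = λ q c → popForth q c (pop (rem c)) ; turn = λ q → q , nothing ; back = descend }

    takeForth : Control → Cell → Control × Cell × Bool
    takeForth q c = if f q then (q , c , true) else (if used c then (q , c , true) else
      (record q { f = true ; lab = w₀ (trial c) } , record c { used = true } , true))

    popTop : Sweep
    popTop = record { forth = takeForth ; turn = λ q → q , nothing ; back = descend }

    -- The base labels still to come, given the remainders of all levels and of the top walk. With
    -- empty remainders it is `stream`; `advance` removes its head.
    pending : ∀ {L} → Vec Label L → Vec Rem L → List Label → List Label
    pending []       []       top = top
    pending (k ∷ ks) (r ∷ rs) top = labels k (rest r) ++ expand (final k (rest r)) (pending ks rs top)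

    unused : ∀ {L} → Vec Trial L → Bits L → List Label
    unused []       []           = []
    unused (t ∷ ts) (true  ∷ ds) = unused ts ds
    unused (t ∷ ts) (false ∷ ds) = w₀ t ∷ unused ts ds

    -- The head of κ is missing because a reloaded level follows its first letter at once.
    newRem : Label → Rem
    newRem κ = Vec.map just (tail κ) ∷ʳ nothing

    rest-newRem : ∀ κ → rest (newRem κ) ≡ toList (tail κ)
    rest-newRem κ = trans (rest-∷ʳ (Vec.map just (tail κ))) (rest-map-just (tail κ))

    descend-true : ∀ q c → f q ≡ true →
      descend q c ≡ (record q { lab = h (head (lab q)) (k c) } , record c { k = h (head (lab q)) (k c) ; rem = newRem (lab q) })
    descend-true (control true g (a ∷ as) b m) c refl = refl

    expand-step : ∀ k κ P → expand k (κ ∷ P) ≡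
      h (head κ) k ∷ labels (h (head κ) k) (rest (newRem κ)) ++ expand (final (h (head κ) k) (rest (newRem κ))) P
    expand-step k κ@(a ∷ as) P =
      cong (λ r → h a k ∷ labels (h a k) r ++ expand (final (h a k) r) P) (sym (rest-newRem κ))

    data Popped (q : Control) {L} (R : Bank L) (result : Control × List Cell) : Set where
      exhausted : result ≡ (q , Z R) → (∀ top → pending (k R) (rem R) top ≡ stream (k R) top) → Popped q R result
      popped    : ∀ κ ks rs → result ≡ (record q { f = true ; lab = κ } , Z (record R { k = ks ; rem = rs })) →
                  (∀ top → pending (k R) (rem R) top ≡ κ ∷ pending ks rs top) → Popped q R result

    run-popLevel : ∀ q {L} (R : Bank L) → f q ≡ false → Popped q R (runSweep popLevel q (Z R))
    run-popLevel q {zero} (regs s u x v w n o i j t [] [] d) e = exhausted refl (λ top → refl)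
    run-popLevel q@(control false g l b m) {suc L} R@(regs s u x v w n o i j t (k ∷ ks) (r ∷ rs) d) refl = go (pop r) refl
      where
        c₀ = headR R
        go : ∀ p → pop r ≡ p → Popped q R (swept popLevel (Z (tailR R)) (popForth q c₀ p))
        go (just (a , r′)) eq = popped (h a k) (h a k ∷ ks) (r′ ∷ rs) refl
          (λ top → cong (λ z → labels k z ++ expand (final k z) (pending ks rs top)) (pop-just r eq))
        go nothing eq = up (run-popLevel q (tailR R) refl)
          where
            nil : ∀ top → pending (k ∷ ks) (r ∷ rs) top ≡ expand k (pending ks rs top)
            nil top = cong (λ z → labels k z ++ expand (final k z) (pending ks rs top)) (pop-nothing r eq)
            up : ∀ {res} → Popped q (tailR R) res → Popped q R (returned popLevel c₀ res)
            up (exhausted refl p) = exhausted refl (λ top → trans (nil top) (cong (expand k) (p top)))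
            up (popped κ ks′ rs′ refl p) = popped (h (head κ) k) (h (head κ) k ∷ ks′) (newRem κ ∷ rs′)
              (cong (λ z → proj₁ z , proj₂ z ∷ Z (record (tailR R) { k = ks′ ; rem = rs′ })) (descend-true (record q { f = true ; lab = κ }) c₀ refl))
              (λ top → trans (nil top) (trans (cong (expand k) (p top)) (expand-step k κ (pending ks′ rs′ top))))

    data Descended (q : Control) {L} (R : Bank L) (result : Control × List Cell) : Set where
      descended : ∀ κ ks rs → result ≡ (record q { lab = κ } , Z (record R { k = ks ; rem = rs })) →
                  (∀ top → stream (k R) (lab q ∷ top) ≡ κ ∷ pending ks rs top) → Descended q R result

    run-popTop-true : ∀ q {L} (R : Bank L) → f q ≡ true → Descended q R (runSweep popTop q (Z R))
    run-popTop-true q {zero} (regs s u x v w n o i j t [] [] d) e = descended (lab q) [] [] refl (λ top → refl)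
    run-popTop-true q@(control true g l b m) {suc L} R@(regs s u x v w n o i j t (k ∷ ks) (r ∷ rs) d) refl =
        up (run-popTop-true q (tailR R) refl)
      where
        c₀ = headR R
        up : ∀ {res} → Descended q (tailR R) res → Descended q R (returned popTop c₀ res)
        up (descended κ ks′ rs′ refl p) = descended (h (head κ) k) (h (head κ) k ∷ ks′) (newRem κ ∷ rs′)
          (cong (λ z → proj₁ z , proj₂ z ∷ Z (record (tailR R) { k = ks′ ; rem = rs′ })) (descend-true (record q { lab = κ }) c₀ refl))
          (λ top → trans (cong (expand k) (p top)) (expand-step k κ (pending ks′ rs′ top)))

    data Taken (q : Control) {L} (R : Bank L) (result : Control × List Cell) : Set where
      finished : result ≡ (q , Z R) → unused (trial R) (used R) ≡ [] → Taken q R result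
      taken    : ∀ κ₀ κ ks rs ds → result ≡ (record q { f = true ; lab = κ } , Z (record R { k = ks ; rem = rs ; used = ds })) →
                 unused (trial R) (used R) ≡ κ₀ ∷ unused (trial R) ds →
                 (∀ top → stream (k R) (κ₀ ∷ top) ≡ κ ∷ pending ks rs top) → Taken q R result

    run-popTop : ∀ q {L} (R : Bank L) → f q ≡ false → Taken q R (runSweep popTop q (Z R))
    run-popTop q {zero} (regs s u x v w n o i j [] k r []) e = finished refl refl
    run-popTop q@(control false g l b m) {suc L} R@(regs s u x v w n o i j (t ∷ ts) (k ∷ ks) (r ∷ rs) (true ∷ ds)) refl =
        up (run-popTop q (tailR R) refl)
      where
        c₀ = headR R
        up : ∀ {res} → Taken q (tailR R) res → Taken q R (returned popTop c₀ res)
        up (finished refl p) = finished refl p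
        up (taken κ₀ κ ks′ rs′ ds′ refl p p′) = taken κ₀ (h (head κ) k) (h (head κ) k ∷ ks′) (newRem κ ∷ rs′) (true ∷ ds′)
          (cong (λ z → proj₁ z , proj₂ z ∷ Z (record (tailR R) { k = ks′ ; rem = rs′ ; used = ds′ })) (descend-true (record q { f = true ; lab = κ }) c₀ refl))
          p (λ top → trans (cong (expand k) (p′ top)) (expand-step k κ (pending ks′ rs′ top)))
    run-popTop q@(control false g l b m) {suc L} R@(regs s u x v w n o i j (t ∷ ts) (k ∷ ks) (r ∷ rs) (false ∷ ds)) refl =
        up (run-popTop-true (control true g (w₀ t) b m) (tailR R) refl)
      where
        c₀ = record (headR R) { used = true }
        up : ∀ {res} → Descended (control true g (w₀ t) b m) (tailR R) res → Taken q R (returned popTop c₀ res)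
        up (descended κ ks′ rs′ refl p) = taken (w₀ t) (h (head κ) k) (h (head κ) k ∷ ks′) (newRem κ ∷ rs′) (true ∷ ds)
          (cong (λ z → proj₁ z , proj₂ z ∷ Z (record (tailR R) { k = ks′ ; rem = rs′ })) (descend-true (control true g κ b m) c₀ refl))
          refl (λ top → trans (cong (expand k) (p top)) (expand-step k κ (pending ks′ rs′ top)))

    stream-[] : ∀ {L} (ks : Vec Label L) → stream ks [] ≡ []
    stream-[] []       = refl
    stream-[] (k ∷ ks) = cong (expand k) (stream-[] ks)

    -- The next label, in lab; f tells whether there is one.
    advance : Prog
    advance = ctl (λ q _ → record q { f = false } , Defs.stay) ⨾ sweep popLevel ⨾ when (λ q → not (f q)) (sweep popTop)

    Pending : ∀ {L} → Bank L → List Label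
    Pending R = pending (k R) (rem R) (unused (trial R) (used R))

    module _ (xs : List Symbol) where

      data Advanced {L} (q : Control) (p : ℕ) (R : Bank L) : List Label → Set where
        none : _⊢_⇓_ xs advance ⟨ q , p , Z R ⟩ ⟨ record q { f = false } , p , Z R ⟩ → Advanced q p R []
        some : ∀ {κ κs} ks rs ds → let R′ = record R { k = ks ; rem = rs ; used = ds } in
               _⊢_⇓_ xs advance ⟨ q , p , Z R ⟩ ⟨ record q { f = true ; lab = κ } , p , Z R′ ⟩ →
               Pending R′ ≡ κs → Advanced q p R (κ ∷ κs)

      run-advance : ∀ q p {L} (R : Bank L) → Advanced q p R (Pending R)
      run-advance q p R = level (run-popLevel q₀ R refl) refl
        where
          q₀ = record q { f = false }
          W = unused (trial R) (used R)
          top : ∀ {res} → Taken q₀ R res → runSweep popTop q₀ (Z R) ≡ res → runSweep popLevel q₀ (Z R) ≡ (q₀ , Z R) →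
                Pending R ≡ stream (k R) W → Advanced q p R (Pending R)
          top (finished refl d) e e′ t = subst (Advanced q p R) (sym (trans t (trans (cong (stream (k R)) d) (stream-[] (k R)))))
            (none (seq ctl (seq (sweep e′) (whenT refl (sweep e)))))
          top (taken κ₀ κ ks rs ds refl d st) e e′ t = subst (Advanced q p R)
            (sym (trans t (trans (cong (stream (k R)) d) (st _))))
            (some ks rs ds (seq ctl (seq (sweep e′) (whenT refl (sweep e)))) refl)
          level : ∀ {res} → Popped q₀ R res → runSweep popLevel q₀ (Z R) ≡ res → Advanced q p R (Pending R)
          level (exhausted refl t) e = top (run-popTop q₀ R refl) refl e (t W)
          level (popped κ ks rs refl t) e = subst (Advanced q p R) (sym (t W))
            (some ks rs (used R) (seq ctl (seq (sweep e) (whenF refl))) refl)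

-- The program and the function of the input which it computes.

module Program where

  open import Data.Bool.Base using (Bool; true; false; not; _∧_; if_then_else_)
  open import Data.Fin.Base using (zero; suc)
  open import Data.List.Base as List using (List; []; _∷_; _++_; length; map; concatMap; foldl; drop)
  import Data.List.Properties as List
  open import Data.Maybe.Base as Maybe using (Maybe; just; nothing; maybe; is-nothing)
  open import Data.Nat.Base as ℕ using (ℕ; zero; suc; _⊓_; _≤_)
  import Data.Nat.Properties as ℕ
  open import Data.Product.Base using (_×_; _,_; proj₁; proj₂; ∃-syntax; Σ)
  open import Data.Vec.Base as Vec using (Vec; []; _∷_; head; tail; toList)
  open import Function.Base using (id)
  open import Relation.Binary.PropositionalEquality
  open import Defs using (Symbol; bit; #; InputCell; leftEnd; rightEnd; symbol; Direction; left; stay; right; readInput; moveInput)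
  open Walk
  open Exploration using (Labelling; gen; zeros)
  open Machine
  open Registers

  bitVal : Data.Fin.Base.Fin 2 → Bool
  bitVal zero    = false
  bitVal (suc _) = true

  isBit bitOf : InputCell Symbol → Bool
  isBit (symbol (bit _)) = true
  isBit _                = false
  bitOf (symbol (bit b)) = bitVal b
  bitOf _                = false

  leading : List Symbol → List Bool
  leading (bit b ∷ ys) = bitVal b ∷ leading ys
  leading _            = []

  after : List Symbol → List Symbol
  after (bit b ∷ ys) = after ys
  after ys           = ys

  -- The input head is at p, with ys as the rest of the input.
  At : List Symbol → ℕ → List Symbol → Set
  At xs p ys = ∃[ pre ] xs ≡ pre ++ ys × p ≡ suc (length pre)

  At-start : ∀ xs → At xs 1 xs
  At-start xs = [] , refl , refl

  read-[] : ∀ {xs p} → At xs p [] → readInput xs p ≡ rightEnd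
  read-[] (pre , refl , refl) = go pre
    where
      go : ∀ pre → readInput (pre ++ []) (suc (length pre)) ≡ rightEnd
      go []              = refl
      go (_ ∷ [])        = refl
      go (_ ∷ c ∷ pre)   = go (c ∷ pre)

  read-∷ : ∀ {xs p y ys} → At xs p (y ∷ ys) → readInput xs p ≡ symbol y
  read-∷ {y = y} {ys} (pre , refl , refl) = go pre
    where
      go : ∀ pre → readInput (pre ++ y ∷ ys) (suc (length pre)) ≡ symbol y
      go []            = refl
      go (_ ∷ [])      = refl
      go (_ ∷ c ∷ pre) = go (c ∷ pre)

  move-right : ∀ {xs p} ys → At xs p ys → At xs (moveInput (length xs) right p) (drop 1 ys)
  -- At the right end marker the head stays where it is, in agreement with `drop 1 []`.
  move-right [] (pre , refl , refl) = pre , refl ,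
    cong suc (trans (cong (suc (length pre) ⊓_) (trans (List.length-++ pre) (ℕ.+-identityʳ _))) (ℕ.m≥n⇒m⊓n≡n (ℕ.n≤1+n _)))
  move-right (y ∷ ys) (pre , refl , refl) = pre ++ y ∷ [] , sym (List.++-assoc pre _ ys) ,
    cong suc (trans (ℕ.m≤n⇒m⊓n≡m (subst (suc (length pre) ≤_) (sym (trans (List.length-++ pre) (ℕ.+-suc _ _))) (ℕ.s≤s (ℕ.m≤m+n _ _))))
      (sym (trans (List.length-++ pre) (ℕ.+-comm _ 1))))

  -- Settles which of v and w is met first; a verdict once reached is kept. For v = w it is false,
  -- so that the relation is strict.
  judge : ∀ {L} → Bits L → Bits L → Maybe Bool → Bits L → Maybe Bool
  judge v w (just a) u = just a
  judge v w nothing  u = if u ==ᵛ v then just (not (u ==ᵛ w)) else (if u ==ᵛ w then just false else nothing)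

  inc : ∀ {L} → Bits L → Bits L
  inc v = maybe id (firsts Bool-Counter) (nexts Bool-Counter v)

  Index : ℕ → Set
  Index L = Bits L × Bits L

  tick : ∀ {L} → Bits L → Index L → Index L
  tick n (i , j) = if inc j ==ᵛ n then (inc i , zeros _) else (i , inc j)

  ticks : ∀ {L} → Bits L → Index L → List Bool → Index L
  ticks n ij []       = ij
  ticks n ij (b ∷ bs) = ticks n (tick n ij) bs

  match : ∀ {L} → Bits L → Bits L → Index L → Bool
  match u x (i , j) = (i ==ᵛ u) ∧ (j ==ᵛ x)

  find : ∀ {L} → Bits L → Bits L → Bits L → Index L → Bool → List Bool → Bool
  find n u x ij a []       = a
  find n u x ij a (b ∷ bs) = find n u x (tick n ij) (if match u x ij then b else a) bs

  origin : ∀ {L} → Index L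
  origin = zeros _ , zeros _

  -- The encoding does not state the order of the graph. It is recovered as the n for which a scan
  -- with rows of length n ends exactly at row n, column 0, by trying all n.
  isOrder : ∀ {L} → List Bool → Bits L → Bool
  isOrder bs n = (proj₁ (ticks n origin bs) ==ᵛ n) ∧ (proj₂ (ticks n origin bs) ==ᵛ zeros _)

  order : ∀ {L} → List Bool → Bits L
  order {L} bs = foldl (λ o n → if isOrder bs n then n else o) (zeros L) (tuples Bool-Counter L)

  adjacency : ∀ {L} → List Bool → Bits L → Bits L → Bits L → Bool
  adjacency bs n u x = find n u x origin false bs

  incL : List Bool → List Bool
  incL []           = true ∷ []
  incL (false ∷ bs) = true ∷ bs
  incL (true ∷ bs)  = false ∷ incL bs

  counter : List Bool → List Bool
  counter = foldl (λ n _ → incL n) []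

  load : ∀ {L} → List Bool → Bits L
  load = foldl (λ v b → shiftIn b v) (zeros _)

  module Explorer (Λ : Labelling) where
    open Labelling Λ
    open Registers.Layout Λ hiding (load)

    trace : ∀ {L} → (Bits L → Bits L → Bool) → Node L → List Label → List (Bits L)
    trace adj p []       = proj₁ p ∷ []
    trace adj p (κ ∷ κs) = proj₁ p ∷ trace adj (Nodes.act adj (gen κ) p) κs

    trialVisits : ∀ {L} → (Bits L → Bits L → Bool) → Bits L → Vec Trial L → List (Bits L)
    trialVisits adj s t = trace adj (s , zeros _) (stream (Vec.map k₀ t) (toList (Vec.map w₀ t)))

    startVisits : ∀ {L} → (Bits L → Bits L → Bool) → Bits L → List (Bits L)
    startVisits {L} adj s = concatMap (trialVisits adj s) (tuples Trial-Counter L)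

    visits : ∀ {L} → (Bits L → Bits L → Bool) → List (Bits L)
    visits {L} adj = concatMap (startVisits adj) (tuples Bool-Counter L)

    -- Only the bits of the adjacency matrix are counted, so that the size L of
    -- the memory, and with it the list of visits, is independent of v and w.
    answer : List Symbol → Maybe Bool
    answer xs = foldl (judge (load {L} vs) (load ws)) nothing (visits (adjacency bs (order bs)))
      where
        bs = leading xs
        L  = length (counter bs)
        xs₁ = drop 1 (after xs)
        vs = leading xs₁
        ws = leading (drop 1 (after xs₁))

    -- Stepping right from the left marker leaves the head at position 1 with the flag cleared,
    -- which ends the loop of `rewind`.
    rewAction : Control → InputCell Symbol → Control × Direction
    rewAction q leftEnd = record q { f = false } , right
    rewAction q a       = record q { f = true } , left

    withFlags : Bool → Bool → Control → Control
    withFlags a b q = record q { f = a ; g = b }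

    withFlag : Bool → Control → Control
    withFlag b q = record q { f = b }

    setFlags peek goRight rew : Prog
    setFlags = ctl (λ q _ → record q { f = true ; g = true } , stay)
    peek     = ctl (λ q a → record q { f = isBit a ; g = bitOf a } , stay)
    goRight  = ctl (λ q _ → q , right)
    rew      = ctl rewAction

    forBits : Prog → Prog
    forBits body = peek ⨾ while f (body ⨾ goRight ⨾ peek)

    rewind : Prog
    rewind = rew ⨾ while f rew

    -- Overflow shows only after a step of the counter, hence the round in front of the loop. At the
    -- end the register is back at its first value, ready for an enclosing loop.
    forEach : {X : Set} → Counter X → Register X → Prog → Prog
    forEach C ρ body = body ⨾ sweep (odo C ρ) ⨾ while (λ q → not (f q)) (body ⨾ sweep (odo C ρ))

    equal : Register Bool → Register Bool → Cell → Bool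
    equal ρ σ c = getC ρ c ==ᵇ getC σ c

    isZero : Register Bool → Cell → Bool
    isZero ρ c = not (getC ρ c)

    yes! : Cell → Bool
    yes! _ = true

    tickProg scanProg adjProg checkProg stepProg walkProg trialProg searchProg : Prog
    tickProg =
      sweep (odo Bool-Counter j-reg) ⨾ setFlags ⨾ sweep (test (equal j-reg n-reg) yes!) ⨾
      when f (sweep (each (λ c → record c { j = false })) ⨾ sweep (odo Bool-Counter i-reg))

    scanProg = sweep (each (λ c → record c { i = false ; j = false })) ⨾ rewind ⨾
      ctl (λ q _ → record q { adj = false } , stay) ⨾
      forBits (setFlags ⨾ sweep (test (λ c → equal i-reg u-reg c ∧ equal j-reg x-reg c) yes!) ⨾
               ctl (λ q a → record q { adj = if f q then bitOf a else adj q } , stay) ⨾ tickProg)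

    adjProg = scanProg ⨾ when adj (sweep (each (λ c → record c { u = x c ; x = u c })))

    checkProg = setFlags ⨾ sweep (test (equal u-reg v-reg) (equal u-reg w-reg)) ⨾
      ctl (λ q _ → record q { ans = maybe just (if f q then just (not (g q)) else (if g q then just false else nothing)) (ans q) } , stay)

    isα isβ isγ : Gen → Bool
    isα α = true
    isα _ = false
    isβ β = true
    isβ _ = false
    isγ γ = true
    isγ _ = false

    stepProg = when (λ q → isα (gen (lab q))) (sweep flipX) ⨾
      when (λ q → isβ (gen (lab q))) (ctl (λ q _ → record q { f = false } , stay) ⨾ sweep grayX) ⨾
      when (λ q → isγ (gen (lab q))) adjProg

    walkProg = checkProg ⨾ advance ⨾ while f (stepProg ⨾ checkProg ⨾ advance)

    trialProg = sweep (each (λ c → record c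
        { u = s c ; x = false ; k = k₀ (trial c) ; rem = Vec.replicate _ nothing ; used = false })) ⨾ walkProg

    searchProg = scanProg ⨾ setFlags ⨾ sweep (test (λ c → equal i-reg n-reg c ∧ isZero j-reg c) yes!) ⨾
      when f (sweep (each (λ c → record c { o = n c })))

    blankCell : Bool → Cell
    blankCell b = regs false false false false false false false b false (firsts Label-Counter) (Counter.first Label-Counter) (Vec.replicate _ nothing) false

    -- A binary increment in register `i`, appending a cell when the carry leaves the block.
    -- Performed for each bit of the matrix, it leaves as many cells as the number of these bits has
    -- binary digits.
    countSweep : Sweep
    countSweep = record
      { forth = λ q c → q , record c { i = not (i c) } , i c
      ; turn  = λ q → q , just (blankCell true)
      ; back  = λ q c → q , c }

    setupProg mainProg program : Prog
    setupProg = goRight ⨾ forBits (sweep countSweep) ⨾ goRight ⨾ forBits (sweep (shift v-reg)) ⨾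
      goRight ⨾ forBits (sweep (shift w-reg)) ⨾
      forEach Bool-Counter n-reg searchProg ⨾ sweep (each (λ c → record c { n = o c }))

    mainProg = forEach Bool-Counter s-reg (forEach Trial-Counter trial-reg trialProg)

    program = setupProg ⨾ mainProg

    allᵇ-equal : ∀ ρ σ {L} (R : Bank L) → allᵇ (equal ρ σ) (Z R) ≡ (getB ρ R ==ᵛ getB σ R)
    allᵇ-equal ρ σ {zero} R = nil (getB ρ R) (getB σ R)
      where
        nil : ∀ (a b : Bits 0) → true ≡ (a ==ᵛ b)
        nil [] [] = refl
    allᵇ-equal ρ σ {suc L} R = trans (cong₂ _∧_ (cong₂ _==ᵇ_ (get-head ρ R) (get-head σ R))
        (trans (allᵇ-equal ρ σ (tailR R)) (cong₂ _==ᵛ_ (get-tail ρ R) (get-tail σ R)))) (step (getB ρ R) (getB σ R))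
      where
        step : ∀ (a b : Bits (suc L)) → ((head a ==ᵇ head b) ∧ (tail a ==ᵛ tail b)) ≡ (a ==ᵛ b)
        step (_ ∷ _) (_ ∷ _) = refl

    allᵇ-isZero : ∀ ρ {L} (R : Bank L) → allᵇ (isZero ρ) (Z R) ≡ (getB ρ R ==ᵛ zeros L)
    allᵇ-isZero ρ {zero} R = nil (getB ρ R)
      where
        nil : ∀ (a : Bits 0) → true ≡ (a ==ᵛ [])
        nil [] = refl
    allᵇ-isZero ρ {suc L} R = trans (cong₂ _∧_ (cong not (get-head ρ R))
        (trans (allᵇ-isZero ρ (tailR R)) (cong (_==ᵛ zeros L) (get-tail ρ R)))) (step (getB ρ R))
      where
        step : ∀ (a : Bits (suc L)) → (not (head a) ∧ (tail a ==ᵛ zeros L)) ≡ (a ==ᵛ zeros (suc L))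
        step (true ∷ _)  = refl
        step (false ∷ _) = refl

    allᵇ-∧ : ∀ φ ψ cs → allᵇ (λ c → φ c ∧ ψ c) cs ≡ (allᵇ φ cs ∧ allᵇ ψ cs)
    allᵇ-∧ φ ψ []       = refl
    allᵇ-∧ φ ψ (c ∷ cs) = trans (cong ((φ c ∧ ψ c) ∧_) (allᵇ-∧ φ ψ cs)) (step (φ c) (ψ c) (allᵇ φ cs) (allᵇ ψ cs))
      where
        step : ∀ a b c d → ((a ∧ b) ∧ (c ∧ d)) ≡ ((a ∧ c) ∧ (b ∧ d))
        step false b c d         = refl
        step true  false false d = refl
        step true  false true  d = refl
        step true  true  c     d = refl

    each-j : ∀ {L} (R : Bank L) → map (λ c → record c { j = false }) (Z R) ≡ Z (record R { j = zeros L })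
    each-j {zero}  R = refl
    each-j {suc L} R = cong (record (headR R) { j = false } ∷_) (each-j (tailR R))

    each-ij : ∀ {L} (R : Bank L) → map (λ c → record c { i = false ; j = false }) (Z R) ≡ Z (record R { i = zeros L ; j = zeros L })
    each-ij {zero}  R = refl
    each-ij {suc L} R = cong (record (headR R) { i = false ; j = false } ∷_) (each-ij (tailR R))

    each-swap : ∀ {L} (R : Bank L) → map (λ c → record c { u = x c ; x = u c }) (Z R) ≡ Z (record R { u = x R ; x = u R })
    each-swap {zero}  R = refl
    each-swap {suc L} R = cong (record (headR R) { u = head (x R) ; x = head (u R) } ∷_) (each-swap (tailR R))

    each-o : ∀ {L} (R : Bank L) → map (λ c → record c { o = n c }) (Z R) ≡ Z (record R { o = n R })
    each-o {zero}  R = refl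
    each-o {suc L} R = cong (record (headR R) { o = head (n R) } ∷_) (each-o (tailR R))

    each-n : ∀ {L} (R : Bank L) → map (λ c → record c { n = o c }) (Z R) ≡ Z (record R { n = o R })
    each-n {zero}  R = refl
    each-n {suc L} R = cong (record (headR R) { n = head (o R) } ∷_) (each-n (tailR R))

    each-reset : ∀ {L} (R : Bank L) →
      map (λ c → record c { u = s c ; x = false ; k = k₀ (trial c) ; rem = Vec.replicate _ nothing ; used = false }) (Z R) ≡
      Z (record R { u = s R ; x = zeros L ; k = Vec.map k₀ (trial R) ; rem = Vec.replicate _ (Vec.replicate _ nothing) ; used = zeros L })
    each-reset {zero}  R = refl
    each-reset {suc L} R@(regs s u x v w n o i j (t ∷ ts) k r d) =
      cong (record (headR R) { u = head s ; x = false ; k = k₀ t ; rem = Vec.replicate _ nothing ; used = false } ∷_) (each-reset (tailR R))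

    pending-reset : ∀ {L} (ks : Vec Label L) top → pending ks (Vec.replicate _ (Vec.replicate _ nothing)) top ≡ stream ks top
    pending-reset []       top = refl
    pending-reset (k ∷ ks) top = cong (expand k) (pending-reset ks top)

    unused-reset : ∀ {L} (ts : Vec Trial L) → unused ts (zeros L) ≡ toList (Vec.map w₀ ts)
    unused-reset []       = refl
    unused-reset (t ∷ ts) = cong (w₀ t ∷_) (unused-reset ts)

    module Runs (xs : List Symbol) where

      Run : Prog → HC → HC → Set
      Run = _⊢_⇓_ xs

      rew-step : ∀ q p {cs} → Run rew ⟨ q , suc p , cs ⟩ ⟨ record q { f = true } , p , cs ⟩
      rew-step q p {cs} = subst (λ r → Run rew ⟨ q , suc p , cs ⟩ ⟨ proj₁ r , moveInput (length xs) (proj₂ r) (suc p) , cs ⟩)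
          (not-left xs p) ctl
        where
          not-left : ∀ xs p → rewAction q (readInput xs (suc p)) ≡ (record q { f = true } , left)
          not-left []       p       = refl
          not-left (x ∷ xs) zero    = refl
          not-left (x ∷ xs) (suc p) = not-left xs p

      rewind-run : ∀ q p {cs} → Run rewind ⟨ q , p , cs ⟩ ⟨ record q { f = false } , 1 , cs ⟩
      rewind-run q zero    = seq ctl (whileF refl)
      rewind-run q (suc p) = seq (rew-step q p) (loop q p)
        where
          loop : ∀ q p {cs} → Run (while f rew) ⟨ record q { f = true } , p , cs ⟩ ⟨ record q { f = false } , 1 , cs ⟩
          loop q zero    = whileT refl ctl (whileF refl)
          loop q (suc p) = whileT refl (rew-step _ p) (loop q p)

      -- `I` is indexed by the bits still to be read. In its uses it says that the rest of the
      -- specifying fold, started from the present state, has the intended result; one round is then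
      -- one unfolding of that fold.
      module ForBits (body : Prog) (I : List Bool → Control → List Cell → Set)
        (I-flags : ∀ bs q cs a b → I bs q cs → I bs (withFlags a b q) cs)
        (I-body : ∀ b bs q cs p → bitOf (readInput xs p) ≡ b → g q ≡ b → I (b ∷ bs) q cs →
                  ∃[ q′ ] ∃[ cs′ ] Run body ⟨ q , p , cs ⟩ ⟨ q′ , p , cs′ ⟩ × I bs q′ cs′) where

        Final : List Symbol → HC → Prog → Set
        Final ys c P = ∃[ q′ ] ∃[ p′ ] ∃[ cs′ ] Run P c ⟨ q′ , p′ , cs′ ⟩ × I [] q′ cs′ × At xs p′ (after ys)

        peek-run : ∀ q p {cs} a → readInput xs p ≡ a → Run peek ⟨ q , p , cs ⟩ ⟨ record q { f = isBit a ; g = bitOf a } , p , cs ⟩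
        peek-run q p a refl = ctl

        private
          stop : ∀ ys {q p cs} a → readInput xs p ≡ a → isBit a ≡ false → leading ys ≡ [] → after ys ≡ ys → At xs p ys →
                 I (leading ys) q cs → Final ys ⟨ q , p , cs ⟩ (forBits body)
          stop ys {q} {p} {cs} a r nb e e′ at inv = _ , p , cs , seq (peek-run q p a r) (whileF nb) ,
            I-flags [] q cs _ _ (subst (λ bs → I bs q cs) e inv) , subst (At xs p) (sym e′) at

        for-bits : ∀ ys {q p cs} → At xs p ys → I (leading ys) q cs → Final ys ⟨ q , p , cs ⟩ (forBits body)
        for-bits []         at inv = stop [] _ (read-[] at) refl refl refl at inv
        for-bits (# ∷ ys)   at inv = stop (# ∷ ys) _ (read-∷ at) refl refl refl at inv
        for-bits (bit b ∷ ys) {q} {p} {cs} at inv =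
            first (I-body _ _ q₀ cs p (cong bitOf (read-∷ at)) refl (I-flags _ q cs true (bitVal b) inv))
          where
            q₀ = record q { f = true ; g = bitVal b }
            then : ∀ {q₁ cs₁} → Run body ⟨ q₀ , p , cs ⟩ ⟨ q₁ , p , cs₁ ⟩ →
                   Final ys ⟨ q₁ , moveInput (length xs) right p , cs₁ ⟩ (forBits body) → Final (bit b ∷ ys) ⟨ q , p , cs ⟩ (forBits body)
            then r₁ (q₂ , p₂ , cs₂ , seq r₂ r₃ , inv₂ , at₂) =
              q₂ , p₂ , cs₂ , seq (peek-run q p _ (read-∷ at)) (whileT refl (seq r₁ (seq ctl r₂)) r₃) , inv₂ , at₂
            first : (∃[ q′ ] ∃[ cs′ ] Run body ⟨ q₀ , p , cs ⟩ ⟨ q′ , p , cs′ ⟩ × I (leading ys) q′ cs′) →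
                    Final (bit b ∷ ys) ⟨ q , p , cs ⟩ (forBits body)
            first (q₁ , cs₁ , r₁ , inv₁) = then r₁ (for-bits ys (move-right (bit b ∷ ys) at) inv₁)

      -- Between rounds `odo` overwrites the flag and ρ, under which `I` must be stable by `I-set`.
      -- The body in turn has to hand ρ back with the value it found.
      module ForEach {X : Set} (C : Counter X) (ρ : Register X) (body : Prog) {L : ℕ}
        (I : List (Vec X L) → Control → Bank L → Set)
        (I-set : ∀ vs q R b v → I vs q R → I vs (withFlag b q) (setB ρ v R))
        (I-body : ∀ v vs q p R → getB ρ R ≡ v → I (v ∷ vs) q R →
                  ∃[ q′ ] ∃[ p′ ] ∃[ R′ ] Run body ⟨ q , p , Z R ⟩ ⟨ q′ , p′ , Z R′ ⟩ × getB ρ R′ ≡ v × I vs q′ R′) where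

        odo-run : ∀ q p (R : Bank L) m → nexts C (getB ρ R) ≡ m →
          Run (sweep (odo C ρ)) ⟨ q , p , Z R ⟩ ⟨ record q { f = is-nothing m } , p , Z (setB ρ (maybe id (firsts C) m) R) ⟩
        odo-run q p R m refl = sweep (run-odo C ρ q R)

        Done : Control → ℕ → Bank L → Set
        Done q p R = ∃[ q′ ] ∃[ p′ ] ∃[ R′ ] Run (forEach C ρ body) ⟨ q , p , Z R ⟩ ⟨ q′ , p′ , Z R′ ⟩ × getB ρ R′ ≡ firsts C × I [] q′ R′

        for-each : ∀ {v vs} → Chain (nexts C) v vs → ∀ q p R → getB ρ R ≡ v → I vs q R → Done q p R
        for-each (last e) q p R r inv = first (I-body _ _ q p R r inv)
          where
            first : _ → Done q p R
            first (q₁ , p₁ , R₁ , run₁ , r₁ , inv₁) = _ , p₁ , setB ρ (firsts C) R₁ ,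
              seq run₁ (seq (odo-run q₁ p₁ R₁ nothing (trans (cong (nexts C) r₁) e)) (whileF refl)) ,
              get-set ρ (firsts C) R₁ , I-set [] q₁ R₁ true (firsts C) inv₁
        for-each (more {y = y} e ch) q p R r inv = first (I-body _ _ q p R r inv)
          where
            then : ∀ q₁ p₁ R₁ → Run body ⟨ q , p , Z R ⟩ ⟨ q₁ , p₁ , Z R₁ ⟩ → nexts C (getB ρ R₁) ≡ just y →
                   Done (record q₁ { f = false }) p₁ (setB ρ y R₁) → Done q p R
            then q₁ p₁ R₁ run₁ e₁ (q₂ , p₂ , R₂ , seq run₂ (seq run₃ run₄) , r₂ , inv₂) = q₂ , p₂ , R₂ ,
              seq run₁ (seq (odo-run q₁ p₁ R₁ (just y) e₁) (whileT refl (seq run₂ run₃) run₄)) , r₂ , inv₂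
            first : _ → Done q p R
            first (q₁ , p₁ , R₁ , run₁ , r₁ , inv₁) = then q₁ p₁ R₁ run₁ (trans (cong (nexts C) r₁) e)
              (for-each ch (record q₁ { f = false }) p₁ (setB ρ y R₁) (get-set ρ y R₁) (I-set _ q₁ R₁ false y inv₁))

      tick-run : ∀ q p {L} (R : Bank L) → ∃[ a ] ∃[ b ] let ij = tick (n R) (i R , j R) in
        Run tickProg ⟨ q , p , Z R ⟩ ⟨ record q { f = a ; g = b } , p , Z (record R { i = proj₁ ij ; j = proj₂ ij }) ⟩
      tick-run q p {L} R = go (inc (j R) ==ᵛ n R) refl
        where
          R₁ = record R { j = inc (j R) }
          q₁ = record q { f = overflow (nexts Bool-Counter (j R)) }
          q₂ : Bool → Control
          q₂ b = record q { f = b ; g = allᵇ yes! (Z R₁) }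
          tested : ∀ b → (inc (j R) ==ᵛ n R) ≡ b →
            runSweep (test (equal j-reg n-reg) yes!) (record q₁ { f = true ; g = true }) (Z R₁) ≡ (q₂ b , Z R₁)
          tested b e = trans (run-test (equal j-reg n-reg) yes! _ (Z R₁))
            (cong (λ b → q₂ b , Z R₁) (trans (allᵇ-equal j-reg n-reg R₁) e))
          result : Bool → Set
          result t = ∃[ a ] ∃[ b ] let ij = if t then (inc (i R) , zeros L) else (i R , inc (j R)) in
            Run tickProg ⟨ q , p , Z R ⟩ ⟨ record q { f = a ; g = b } , p , Z (record R { i = proj₁ ij ; j = proj₂ ij }) ⟩
          go : ∀ b → (inc (j R) ==ᵛ n R) ≡ b → result b
          go true e = _ , _ , seq (sweep (run-odo Bool-Counter j-reg q R)) (seq ctl (seq (sweep (tested true e))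
            (whenT refl (seq (sweep (trans (run-each _ _ (Z R₁)) (cong (q₂ true ,_) (each-j R₁))))
              (sweep (run-odo Bool-Counter i-reg (q₂ true) (record R { j = zeros L })))))))
          go false e = _ , _ , seq (sweep (run-odo Bool-Counter j-reg q R)) (seq ctl (seq (sweep (tested false e)) (whenF refl)))

      module _ {L : ℕ} (R : Bank L) (q₀ : Control) where

        private
          bs = leading xs

          Inv : List Bool → Control → List Cell → Set
          Inv bs′ q cs = ∃[ i ] ∃[ j ] cs ≡ Z (record R { i = i ; j = j }) × lab q ≡ lab q₀ × ans q ≡ ans q₀ ×
            ticks (n R) (i , j) bs′ ≡ ticks (n R) origin bs × find (n R) (u R) (x R) (i , j) (adj q) bs′ ≡ adjacency bs (n R) (u R) (x R)

          body : Prog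
          body = setFlags ⨾ sweep (test (λ c → equal i-reg u-reg c ∧ equal j-reg x-reg c) yes!) ⨾
                 ctl (λ q a → record q { adj = if f q then bitOf a else adj q } , stay) ⨾ tickProg

          Inv-flags : ∀ bs′ q cs a b → Inv bs′ q cs → Inv bs′ (record q { f = a ; g = b }) cs
          Inv-flags bs′ q cs a b inv = inv

          Inv-body : ∀ b bs q cs p → bitOf (readInput xs p) ≡ b → g q ≡ b → Inv (b ∷ bs) q cs →
                     ∃[ q′ ] ∃[ cs′ ] Run body ⟨ q , p , cs ⟩ ⟨ q′ , p , cs′ ⟩ × Inv bs q′ cs′
          Inv-body b bs q _ p refl _ (i , j , refl , l , a , tk , fd) =
              _ , _ , seq ctl (seq (sweep tested) (seq ctl (proj₂ (proj₂ ticked)))) ,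
              (_ , _ , refl , l , a , tk , fd)
            where
              R₁ = record R { i = i ; j = j }
              m = match (u R) (x R) (i , j)
              q₁ = record q { f = m ; g = allᵇ yes! (Z R₁) }
              tested : runSweep (test (λ c → equal i-reg u-reg c ∧ equal j-reg x-reg c) yes!) (record q { f = true ; g = true }) (Z R₁) ≡ (q₁ , Z R₁)
              tested = trans (run-test _ yes! _ (Z R₁)) (cong (λ b → record q { f = b ; g = allᵇ yes! (Z R₁) } , Z R₁)
                (trans (allᵇ-∧ (equal i-reg u-reg) (equal j-reg x-reg) (Z R₁)) (cong₂ _∧_ (allᵇ-equal i-reg u-reg R₁) (allᵇ-equal j-reg x-reg R₁))))
              ticked = tick-run (record q₁ { adj = if m then b else adj q }) p R₁

        scan-run : ∀ p → ∃[ a ] ∃[ b ] ∃[ p′ ] let ij = ticks (n R) origin bs in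
          Run scanProg ⟨ q₀ , p , Z R ⟩ ⟨ record q₀ { f = a ; g = b ; adj = adjacency bs (n R) (u R) (x R) } , p′ ,
                                          Z (record R { i = proj₁ ij ; j = proj₂ ij }) ⟩
        scan-run p = finish (for-bits xs (At-start xs) (zeros L , zeros L , refl , refl , refl , refl , refl))
          where
            open ForBits body Inv Inv-flags Inv-body
            R₀ = record R { i = zeros L ; j = zeros L }
            q₁ = record q₀ { f = false ; adj = false }
            finish : Final xs ⟨ q₁ , 1 , Z R₀ ⟩ (forBits body) → _
            finish (control a b _ _ _ , p′ , _ , r , (i , j , refl , refl , refl , refl , refl) , _) =
              a , b , p′ , seq (sweep (trans (run-each _ q₀ (Z R)) (cong (q₀ ,_) (each-ij R)))) (seq (rewind-run q₀ p) (seq ctl r))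

      check-run : ∀ q p {L} (R : Bank L) → ∃[ a ] ∃[ b ]
        Run checkProg ⟨ q , p , Z R ⟩ ⟨ record q { f = a ; g = b ; ans = judge (v R) (w R) (ans q) (u R) } , p , Z R ⟩
      check-run q p R = _ , _ , subst (λ m → Run checkProg ⟨ q , p , Z R ⟩ ⟨ record q₁ { ans = m } , p , Z R ⟩) (lem (ans q))
          (seq ctl (seq (sweep tested) ctl))
        where
          q₁ = record q { f = u R ==ᵛ v R ; g = u R ==ᵛ w R }
          tested : runSweep (test (equal u-reg v-reg) (equal u-reg w-reg)) (record q { f = true ; g = true }) (Z R) ≡ (q₁ , Z R)
          tested = trans (run-test _ _ _ (Z R)) (cong₂ (λ a b → record q { f = a ; g = b } , Z R) (allᵇ-equal u-reg v-reg R) (allᵇ-equal u-reg w-reg R))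
          lem : ∀ m → maybe just (if u R ==ᵛ v R then just (not (u R ==ᵛ w R)) else (if u R ==ᵛ w R then just false else nothing)) m ≡
                      judge (v R) (w R) m (u R)
          lem (just a) = refl
          lem nothing  = refl

      private
        bs₀ = leading xs

      Stepped : ∀ {L} → Control → ℕ → Bank L → Node L → Set
      Stepped q p R ux = ∃[ a ] ∃[ b ] ∃[ d ] ∃[ p′ ] ∃[ i′ ] ∃[ j′ ]
        Run stepProg ⟨ q , p , Z R ⟩
          ⟨ record q { f = a ; g = b ; adj = d } , p′ , Z (record R { u = proj₁ ux ; x = proj₂ ux ; i = i′ ; j = j′ }) ⟩

      step-run : ∀ q p {L} (R : Bank L) → Stepped q p R (Nodes.act (adjacency bs₀ (n R)) (gen (lab q)) (u R , x R))
      step-run q p {L} R = go (gen (lab q)) refl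
        where
          A = adjacency bs₀ (n R)
          go : ∀ t → gen (lab q) ≡ t → Stepped q p R (Nodes.act A t (u R , x R))
          go ide e = _ , _ , _ , p , i R , j R , seq (whenF (cong isα e)) (seq (whenF (cong isβ e)) (whenF (cong isγ e)))
          go α   e = _ , _ , _ , p , i R , j R , seq (whenT (cong isα e) (sweep (run-flipX q R))) (seq (whenF (cong isβ e)) (whenF (cong isγ e)))
          go β   e = _ , _ , _ , p , i R , j R , seq (whenF (cong isα e)) (seq (whenT (cong isβ e) (seq ctl (sweep (proj₂ gray-run)))) (whenF (cong isγ e)))
            where
              gray-run = run-grayX (record q { f = false }) R refl
          go γ   e = finish (scan-run R q p)
            where
              ij = ticks (n R) origin bs₀
              finish : (∃[ a ] ∃[ b ] ∃[ p′ ] Run scanProg ⟨ q , p , Z R ⟩ ⟨ record q { f = a ; g = b ; adj = A (u R) (x R) } , p′ ,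
                          Z (record R { i = proj₁ ij ; j = proj₂ ij }) ⟩) → Stepped q p R (Nodes.act A γ (u R , x R))
              finish (a , b , p′ , run) = decide (A (u R) (x R)) refl
                where
                  decide : ∀ d → A (u R) (x R) ≡ d → Stepped q p R (if d then (x R , u R) else (u R , x R))
                  decide true  e′ = _ , _ , _ , p′ , _ , _ , seq (whenF (cong isα e)) (seq (whenF (cong isβ e))
                    (whenT (cong isγ e) (seq run (whenT e′ (sweep (trans (run-each _ _ (Z (record R { i = proj₁ ij ; j = proj₂ ij })))
                      (cong (record q { f = a ; g = b ; adj = A (u R) (x R) } ,_) (each-swap (record R { i = proj₁ ij ; j = proj₂ ij })))))))))
                  decide false e′ = _ , _ , _ , p′ , _ , _ , seq (whenF (cong isα e)) (seq (whenF (cong isβ e))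
                    (whenT (cong isγ e) (seq run (whenF e′))))

      Fixed : ∀ {L} → Bank L → Bank L → Set
      Fixed R R′ = s R′ ≡ s R × v R′ ≡ v R × w R′ ≡ w R × n R′ ≡ n R × trial R′ ≡ trial R

      Walked : ∀ {L} → Prog → Control → ℕ → Bank L → List Label → Set
      Walked P q p R κs = ∃[ q′ ] ∃[ p′ ] ∃[ R′ ] Run P ⟨ q , p , Z R ⟩ ⟨ q′ , p′ , Z R′ ⟩ ×
        ans q′ ≡ foldl (judge (v R) (w R)) (ans q) (trace (adjacency bs₀ (n R)) (u R , x R) κs) × Fixed R R′

      -- The recursion is on the labels still pending: `advance` takes the head off this list, so
      -- the loop ends with it.
      walk-run : ∀ κs q p {L} (R : Bank L) → Pending R ≡ κs → Walked walkProg q p R κs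
      walk-run κs q p {L} R e = checked (check-run q p R)
        where
          A = adjacency bs₀ (n R)
          checked : (∃[ a ] ∃[ b ] Run checkProg ⟨ q , p , Z R ⟩
                      ⟨ record q { f = a ; g = b ; ans = judge (v R) (w R) (ans q) (u R) } , p , Z R ⟩) → Walked walkProg q p R κs
          checked (a , b , run₁) = advanced κs (subst (Advanced xs q₁ p R) e (run-advance xs q₁ p R))
            where
              q₁ = record q { f = a ; g = b ; ans = judge (v R) (w R) (ans q) (u R) }
              advanced : ∀ κs → Advanced xs q₁ p R κs → Walked walkProg q p R κs
              advanced _ (none run₂) = _ , _ , R , seq run₁ (seq run₂ (whileF refl)) , refl , refl , refl , refl , refl , refl
              advanced _ (some {κ} {κs} ks rs ds run₂ e₂) = stepped (step-run q₂ p R₂)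
                where
                  q₂ = record q₁ { f = true ; lab = κ }
                  R₂ = record R { k = ks ; rem = rs ; used = ds }
                  ux = Nodes.act A (gen κ) (u R , x R)
                  then : ∀ q₃ p₃ R₃ → Run stepProg ⟨ q₂ , p , Z R₂ ⟩ ⟨ q₃ , p₃ , Z R₃ ⟩ → ans q₃ ≡ ans q₁ → (u R₃ , x R₃) ≡ ux →
                         Fixed R R₃ → Walked walkProg q₃ p₃ R₃ κs → Walked walkProg q p R (κ ∷ κs)
                  then q₃ p₃ R₃ run₃ refl refl (refl , refl , refl , refl , refl) (q₄ , p₄ , R₄ , seq run₄ (seq run₅ run₆) , a₄ , fixed) =
                    q₄ , p₄ , R₄ , seq run₁ (seq run₂ (whileT refl (seq run₃ (seq run₄ run₅)) run₆)) , a₄ , fixed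
                  stepped : Stepped q₂ p R₂ ux → Walked walkProg q p R (κ ∷ κs)
                  stepped (a₃ , b₃ , d₃ , p₃ , i₃ , j₃ , run₃) =
                      then q₃ p₃ R₃ run₃ refl refl (refl , refl , refl , refl , refl) (walk-run κs q₃ p₃ R₃ e₂)
                    where
                      q₃ = record q₂ { f = a₃ ; g = b₃ ; adj = d₃ }
                      R₃ = record R₂ { u = proj₁ ux ; x = proj₂ ux ; i = i₃ ; j = j₃ }

      trial-run : ∀ q p {L} (R : Bank L) → ∃[ q′ ] ∃[ p′ ] ∃[ R′ ] Run trialProg ⟨ q , p , Z R ⟩ ⟨ q′ , p′ , Z R′ ⟩ ×
        ans q′ ≡ foldl (judge (v R) (w R)) (ans q) (trialVisits (adjacency bs₀ (n R)) (s R) (trial R)) × Fixed R R′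
      trial-run q p {L} R = then (walk-run _ q p R₁ (trans (pending-reset (Vec.map k₀ (trial R)) _) (cong (stream (Vec.map k₀ (trial R))) (unused-reset (trial R)))))
        where
          R₁ = record R { u = s R ; x = zeros L ; k = Vec.map k₀ (trial R) ; rem = Vec.replicate _ (Vec.replicate _ nothing) ; used = zeros L }
          then : Walked walkProg q p R₁ (stream (Vec.map k₀ (trial R)) (toList (Vec.map w₀ (trial R)))) → _
          then (q′ , p′ , R′ , run , a , fixed) = q′ , p′ , R′ , seq (sweep (trans (run-each _ q (Z R)) (cong (q ,_) (each-reset R)))) run , a , fixed

      module Main {L : ℕ} (V W N : Bits L) where

        private
          A = adjacency bs₀ N
          fold = foldl (judge V W)

        module Trials (σ : Bits L) (total : Maybe Bool) where

          I : List (Vec Trial L) → Control → Bank L → Set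
          I ts q R = s R ≡ σ × v R ≡ V × w R ≡ W × n R ≡ N × fold (ans q) (concatMap (trialVisits A σ) ts) ≡ total

          I-set : ∀ ts q R b t → I ts q R → I ts (record q { f = b }) (setB trial-reg t R)
          I-set ts q R b t inv = inv

          I-body : ∀ t ts q p R → trial R ≡ t → I (t ∷ ts) q R →
                   ∃[ q′ ] ∃[ p′ ] ∃[ R′ ] Run trialProg ⟨ q , p , Z R ⟩ ⟨ q′ , p′ , Z R′ ⟩ × trial R′ ≡ t × I ts q′ R′
          I-body t ts q p R refl (refl , refl , refl , refl , e) = then (trial-run q p R)
            where
              then : _ → _
              then (q′ , p′ , R′ , run , a , (e₁ , e₂ , e₃ , e₄ , e₅)) = q′ , p′ , R′ , run , e₅ , e₁ , e₂ , e₃ , e₄ ,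
                trans (cong (λ m → fold m (concatMap (trialVisits A σ) ts)) a)
                  (trans (sym (List.foldl-++ (judge V W) (ans q) (trialVisits A σ t) _)) e)

          trials-run : ∀ q p R → trial R ≡ firsts Trial-Counter → I (tuples Trial-Counter L) q R →
            ∃[ q′ ] ∃[ p′ ] ∃[ R′ ] Run (forEach Trial-Counter trial-reg trialProg) ⟨ q , p , Z R ⟩ ⟨ q′ , p′ , Z R′ ⟩ ×
              trial R′ ≡ firsts Trial-Counter × I [] q′ R′
          trials-run q p R = ForEach.for-each Trial-Counter trial-reg trialProg I I-set I-body
            (tuples-chain Trial-Counter L) q p R

        module _ (total : Maybe Bool) where

          I : List (Bits L) → Control → Bank L → Set
          I ss q R = trial R ≡ firsts Trial-Counter × v R ≡ V × w R ≡ W × n R ≡ N × fold (ans q) (concatMap (startVisits A) ss) ≡ total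

          I-set : ∀ ss q R b σ → I ss q R → I ss (record q { f = b }) (setB s-reg σ R)
          I-set ss q R b σ inv = inv

          I-body : ∀ σ ss q p R → s R ≡ σ → I (σ ∷ ss) q R →
                   ∃[ q′ ] ∃[ p′ ] ∃[ R′ ] Run (forEach Trial-Counter trial-reg trialProg) ⟨ q , p , Z R ⟩ ⟨ q′ , p′ , Z R′ ⟩ × s R′ ≡ σ × I ss q′ R′
          I-body σ ss q p R e (e₀ , e₁ , e₂ , e₃ , e₄) =
              then (Trials.trials-run σ (fold (ans q) (startVisits A σ)) q p R e₀ (e , e₁ , e₂ , e₃ , refl))
            where
              then : _ → _
              then (q′ , p′ , R′ , run , t , (a₀ , a₁ , a₂ , a₃ , a₄)) = q′ , p′ , R′ , run , a₀ , t , a₁ , a₂ , a₃ ,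
                trans (cong (λ m → fold m (concatMap (startVisits A) ss)) a₄)
                  (trans (sym (List.foldl-++ (judge V W) (ans q) (startVisits A σ) _)) e₄)

        main-run : ∀ q p R → s R ≡ zeros L → trial R ≡ firsts Trial-Counter → v R ≡ V → w R ≡ W → n R ≡ N →
          ∃[ q′ ] ∃[ p′ ] ∃[ R′ ] Run mainProg ⟨ q , p , Z {L} R ⟩ ⟨ q′ , p′ , Z {L} R′ ⟩ × ans q′ ≡ fold (ans q) (visits A)
        main-run q p R e₀ e₁ e₂ e₃ e₄ = then (ForEach.for-each Bool-Counter s-reg (forEach Trial-Counter trial-reg trialProg) (I total)
            (I-set total) (I-body total)
            (tuples-chain Bool-Counter L) q p R e₀ (e₁ , e₂ , e₃ , e₄ , refl))
          where
            total = fold (ans q) (visits A)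
            then : _ → _
            then (q′ , p′ , R′ , run , _ , (_ , _ , _ , _ , a)) = q′ , p′ , R′ , run , a

      run-count : ∀ q vs → runSweep countSweep q (map blankCell vs) ≡ (q , map blankCell (incL vs))
      run-count q []           = refl
      run-count q (false ∷ vs) = refl
      run-count q (true ∷ vs)  = cong (returned countSweep (blankCell false)) (run-count q vs)

      blankBank : (vs : List Bool) → Bank (length vs)
      blankBank vs = regs (zeros _) (zeros _) (zeros _) (zeros _) (zeros _) (zeros _) (zeros _) (Vec.fromList vs) (zeros _)
        (firsts Trial-Counter) (Vec.replicate _ (Counter.first Label-Counter)) (Vec.replicate _ (Vec.replicate _ nothing)) (zeros _)

      Z-blank : ∀ vs → map blankCell vs ≡ Z (blankBank vs)
      Z-blank []       = refl
      Z-blank (v ∷ vs) = cong (blankCell v ∷_) (Z-blank vs)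

      private
        CountI : List Bool → Control → List Cell → Set
        CountI bs q cs = ∃[ vs ] cs ≡ map blankCell vs × foldl (λ n _ → incL n) vs bs ≡ counter bs₀ × ans q ≡ nothing

        CountI-flags : ∀ bs q cs a b → CountI bs q cs → CountI bs (record q { f = a ; g = b }) cs
        CountI-flags bs q cs a b inv = inv

        CountI-body : ∀ b bs q cs p → bitOf (readInput xs p) ≡ b → g q ≡ b → CountI (b ∷ bs) q cs →
                      ∃[ q′ ] ∃[ cs′ ] Run (sweep countSweep) ⟨ q , p , cs ⟩ ⟨ q′ , p , cs′ ⟩ × CountI bs q′ cs′
        CountI-body _ _ q _ _ _ _ (vs , refl , e , a) = q , map blankCell (incL vs) , sweep (run-count q vs) , (incL vs , refl , e , a)

        module CountBits = ForBits (sweep countSweep) CountI CountI-flags CountI-body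

        module Load (ρ : Register Bool) {L : ℕ} (R : Bank L) (bs₁ : List Bool) where

          LoadI : List Bool → Control → List Cell → Set
          LoadI bs q cs = ∃[ v ] cs ≡ Z (setB ρ v R) × foldl (λ v b → shiftIn b v) v bs ≡ load bs₁ × ans q ≡ nothing

          LoadI-flags : ∀ bs q cs a b → LoadI bs q cs → LoadI bs (record q { f = a ; g = b }) cs
          LoadI-flags bs q cs a b inv = inv

          module _ (set-set : ∀ v v′ → setB ρ v (setB ρ v′ R) ≡ setB ρ v R) where

            LoadI-body : ∀ b bs q cs p → bitOf (readInput xs p) ≡ b → g q ≡ b → LoadI (b ∷ bs) q cs →
                         ∃[ q′ ] ∃[ cs′ ] Run (sweep (shift ρ)) ⟨ q , p , cs ⟩ ⟨ q′ , p , cs′ ⟩ × LoadI bs q′ cs′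
            LoadI-body _ _ q _ _ _ refl (v , refl , e , a) = _ , _ , sweep (proj₂ shifted) ,
                (shiftIn (g q) v , cong Z (trans (cong (λ t → setB ρ (shiftIn (g q) t) (setB ρ v R)) (get-set ρ v R)) (set-set _ v)) , e , a)
              where
                shifted = run-shift ρ q (setB ρ v R)

            module LoadBits = ForBits (sweep (shift ρ)) LoadI LoadI-flags LoadI-body

        module Search {L : ℕ} (V W : Bits L) where

          I : List (Bits L) → Control → Bank L → Set
          I ns q R = s R ≡ zeros L × trial R ≡ firsts Trial-Counter × v R ≡ V × w R ≡ W × ans q ≡ nothing ×
            foldl (λ o n → if isOrder bs₀ n then n else o) (o R) ns ≡ order bs₀

          I-set : ∀ ns q R b m → I ns q R → I ns (record q { f = b }) (setB n-reg m R)
          I-set ns q R b m inv = inv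

          I-body : ∀ m ns q p R → n R ≡ m → I (m ∷ ns) q R →
                   ∃[ q′ ] ∃[ p′ ] ∃[ R′ ] Run searchProg ⟨ q , p , Z R ⟩ ⟨ q′ , p′ , Z R′ ⟩ × n R′ ≡ m × I ns q′ R′
          I-body m ns q p R refl (e₀ , e₁ , e₂ , e₃ , e₄ , e₅) = scanned (scan-run R q p)
            where
              ij = ticks (n R) origin bs₀
              R₁ = record R { i = proj₁ ij ; j = proj₂ ij }
              Result : Set
              Result = ∃[ q′ ] ∃[ p′ ] ∃[ R′ ] Run searchProg ⟨ q , p , Z R ⟩ ⟨ q′ , p′ , Z R′ ⟩ × n R′ ≡ n R × I ns q′ R′
              scanned : (∃[ a ] ∃[ b ] ∃[ p′ ] Run scanProg ⟨ q , p , Z R ⟩ ⟨ record q { f = a ; g = b ; adj = adjacency bs₀ (n R) (u R) (x R) } , p′ , Z R₁ ⟩) → Result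
              scanned (a , b , p′ , run) = decide (isOrder bs₀ (n R)) refl
                where
                  q₁ : Bool → Control
                  q₁ t = record q { f = t ; g = allᵇ yes! (Z R₁) ; adj = adjacency bs₀ (n R) (u R) (x R) }
                  tested : ∀ t → isOrder bs₀ (n R) ≡ t →
                    runSweep (test (λ c → equal i-reg n-reg c ∧ isZero j-reg c) yes!)
                      (record q { f = true ; g = true ; adj = adjacency bs₀ (n R) (u R) (x R) }) (Z R₁) ≡ (q₁ t , Z R₁)
                  tested t e = trans (run-test _ yes! _ (Z R₁)) (cong (λ t → q₁ t , Z R₁)
                    (trans (allᵇ-∧ (equal i-reg n-reg) (isZero j-reg) (Z R₁)) (trans (cong₂ _∧_ (allᵇ-equal i-reg n-reg R₁) (allᵇ-isZero j-reg R₁)) e)))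
                  choice : ∀ t → isOrder bs₀ (n R) ≡ t → foldl (λ o n → if isOrder bs₀ n then n else o) (if t then n R else o R) ns ≡ order bs₀
                  choice t e = trans (cong (λ t → foldl (λ o n → if isOrder bs₀ n then n else o) (if t then n R else o R) ns) (sym e)) e₅
                  decide : ∀ t → isOrder bs₀ (n R) ≡ t → Result
                  decide true  e = q₁ true , p′ , record R₁ { o = n R } ,
                    seq run (seq ctl (seq (sweep (tested true e)) (whenT refl (sweep (trans (run-each _ _ (Z R₁)) (cong (q₁ true ,_) (each-o R₁))))))) ,
                    refl , e₀ , e₁ , e₂ , e₃ , e₄ , choice true e
                  decide false e = q₁ false , p′ , R₁ , seq run (seq ctl (seq (sweep (tested false e)) (whenF refl))) ,
                    refl , e₀ , e₁ , e₂ , e₃ , e₄ , choice false e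

          search-run : ∀ q p R → n R ≡ zeros L → I (tuples Bool-Counter L) q R →
            ∃[ q′ ] ∃[ p′ ] ∃[ R′ ] Run (forEach Bool-Counter n-reg searchProg) ⟨ q , p , Z R ⟩ ⟨ q′ , p′ , Z R′ ⟩ × n R′ ≡ zeros L × I [] q′ R′
          search-run q p R = ForEach.for-each Bool-Counter n-reg searchProg I I-set I-body (tuples-chain Bool-Counter L) q p R

      program-run : ∀ q → ans q ≡ nothing → let L = length (counter bs₀) in
        ∃[ q′ ] ∃[ p′ ] Σ (Bank L) λ R′ → Run program ⟨ q , 0 , [] ⟩ ⟨ q′ , p′ , Z R′ ⟩ × ans q′ ≡ answer xs
      program-run q e = counted (CountBits.for-bits xs {q} (At-start xs) ([] , refl , refl , e))
        where
          L = length (counter bs₀)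
          xs₁ = drop 1 (after xs)
          xs₂ = drop 1 (after xs₁)
          V W : Bits L
          V = load (leading xs₁)
          W = load (leading xs₂)
          Result : Set
          Result = ∃[ q′ ] ∃[ p′ ] Σ (Bank L) λ R′ → Run program ⟨ q , 0 , [] ⟩ ⟨ q′ , p′ , Z R′ ⟩ × ans q′ ≡ answer xs
          R₀ R₁ R₂ : Bank L
          R₀ = blankBank (counter bs₀)
          R₁ = record R₀ { v = V }
          R₂ = record R₁ { w = W }
          finish : ∀ {q₁ p₁ cs₁ q₂ p₂ cs₂ q₃ p₃} →
            Run (forBits (sweep countSweep)) ⟨ q , 1 , [] ⟩ ⟨ q₁ , p₁ , cs₁ ⟩ →
            Run (forBits (sweep (shift v-reg))) ⟨ q₁ , moveInput (length xs) right p₁ , cs₁ ⟩ ⟨ q₂ , p₂ , cs₂ ⟩ →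
            Run (forBits (sweep (shift w-reg))) ⟨ q₂ , moveInput (length xs) right p₂ , cs₂ ⟩ ⟨ q₃ , p₃ , Z R₂ ⟩ →
            ans q₃ ≡ nothing → Result
          finish {q₃ = q₃} {p₃} run₁ run₂ run₃ a₃ = searched (Search.search-run V W q₃ p₃ R₂ refl (refl , refl , refl , refl , a₃ , refl))
            where
              searched : _ → Result
              searched (q₄ , p₄ , R₄ , run₄ , _ , (e₀ , e₁ , e₂ , e₃ , e₄ , e₅)) = done (Main.main-run V W (order bs₀) q₄ p₄ R₅ e₀ e₁ e₂ e₃ e₅)
                where
                  R₅ = record R₄ { n = o R₄ }
                  done : _ → Result
                  done (q₆ , p₆ , R₆ , run₆ , a₆) = q₆ , p₆ , R₆ ,
                    seq (seq ctl (seq run₁ (seq ctl (seq run₂ (seq ctl (seq run₃ (seq run₄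
                      (sweep (trans (run-each _ q₄ (Z R₄)) (cong (q₄ ,_) (each-n R₄))))))))))) run₆ ,
                    trans a₆ (cong (λ m → foldl (judge V W) m (visits (adjacency bs₀ (order bs₀)))) e₄)
          module LoadV = Load v-reg R₀ (leading xs₁)
          module LoadVBits = LoadV.LoadBits (λ v v′ → refl)
          module LoadW = Load w-reg R₁ (leading xs₂)
          module LoadWBits = LoadW.LoadBits (λ v v′ → refl)
          counted : CountBits.Final xs ⟨ q , 1 , [] ⟩ (forBits (sweep countSweep)) → Result
          counted (q₁ , p₁ , _ , run₁ , (_ , refl , refl , a₁) , at₁) =
              loadedV (LoadVBits.for-bits xs₁ {q₁} (move-right (after xs) at₁) (zeros L , Z-blank (counter bs₀) , refl , a₁))
            where
              loadedV : _ → Result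
              loadedV (q₂ , p₂ , _ , run₂ , (_ , refl , refl , a₂) , at₂) =
                  loadedW (LoadWBits.for-bits xs₂ {q₂} (move-right (after xs₁) at₂) (zeros L , refl , refl , a₂))
                where
                  loadedW : _ → Result
                  loadedW (q₃ , p₃ , _ , run₃ , (_ , refl , refl , a₃) , at₃) = finish run₁ run₂ run₃ a₃

-- Lists of visits as graph searches.

module Visits where

  open import Data.Bool.Base using (Bool; true; false; if_then_else_)
  open import Data.Empty using (⊥-elim)
  open import Data.List.Base as List using (List; []; _∷_; _++_; concatMap; foldl; _ʳ++_)
  open import Data.List.Membership.Propositional using (_∈_; _∉_)
  import Data.List.Membership.Propositional.Properties as ∈
  open import Data.List.Relation.Unary.Any as Any using (Any; here; there)
  open import Data.Maybe.Base as Maybe using (just; nothing)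
  open import Data.Nat.Base as ℕ using (ℕ; suc; _<_; s≤s; z≤n)
  import Data.Nat.Properties as ℕ
  open import Data.Product.Base using (_×_; _,_; proj₁; proj₂; ∃-syntax)
  open import Data.Sum.Base using (_⊎_; inj₁; inj₂)
  open import Data.Vec.Base as Vec using (Vec; []; _∷_; toList)
  open import Relation.Binary.PropositionalEquality
  open import Relation.Nullary.Negation using (¬_; contradiction)
  open Walk
  open Exploration using (Labelling; gen; zeros; flip-gray-transitive)
  open Registers
  open Program

  ==ᵇ-refl : ∀ a → (a ==ᵇ a) ≡ true
  ==ᵇ-refl true  = refl
  ==ᵇ-refl false = refl

  ==ᵛ-refl : ∀ {n} (a : Bits n) → (a ==ᵛ a) ≡ true
  ==ᵛ-refl []       = refl
  ==ᵛ-refl (x ∷ a) rewrite ==ᵇ-refl x = ==ᵛ-refl a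

  ==ᵛ-sound : ∀ {n} (a b : Bits n) → (a ==ᵛ b) ≡ true → a ≡ b
  ==ᵛ-sound []          []          e = refl
  ==ᵛ-sound (true ∷ a)  (true ∷ b)  e = cong (true ∷_) (==ᵛ-sound a b e)
  ==ᵛ-sound (false ∷ a) (false ∷ b) e = cong (false ∷_) (==ᵛ-sound a b e)

  module _ {L : ℕ} where

    rank : Bits L → List (Bits L) → ℕ
    rank x []      = 0
    rank x (z ∷ l) = if z ==ᵛ x then 0 else suc (rank x l)

    rank-injective : ∀ {x y} l → x ∈ l → rank x l ≡ rank y l → x ≡ y
    rank-injective {x} {y} (z ∷ l) i e with z ==ᵛ x in p | z ==ᵛ y in q
    rank-injective (z ∷ l) i e | true | true = trans (sym (==ᵛ-sound z _ p)) (==ᵛ-sound z _ q)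
    rank-injective (z ∷ l) (here refl) e | false | false with () ← trans (sym p) (==ᵛ-refl z)
    rank-injective (z ∷ l) (there i) e | false | false = rank-injective l i (ℕ.suc-injective e)

    judge-just : ∀ (v w : Bits L) b l → foldl (judge v w) (just b) l ≡ just b
    judge-just v w b []      = refl
    judge-just v w b (_ ∷ l) = judge-just v w b l

    judge⇒rank : ∀ v w l → v ∈ l → foldl (judge v w) nothing l ≡ just true → rank v l < rank w l
    judge⇒rank v w (z ∷ l) i e with z ==ᵛ v in p | z ==ᵛ w in q
    judge⇒rank v w (z ∷ l) i e | true  | true  with () ← trans (sym (judge-just v w false l)) e
    judge⇒rank v w (z ∷ l) i e | true  | false = s≤s z≤n
    judge⇒rank v w (z ∷ l) i e | false | true  with () ← trans (sym (judge-just v w false l)) e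
    judge⇒rank v w (z ∷ l) (here refl) e | false | false with () ← trans (sym p) (==ᵛ-refl z)
    judge⇒rank v w (z ∷ l) (there i) e | false | false = s≤s (judge⇒rank v w l i e)

    rank⇒judge : ∀ v w l → rank v l < rank w l → foldl (judge v w) nothing l ≡ just true
    rank⇒judge v w (z ∷ l) r with z ==ᵛ v | z ==ᵛ w
    rank⇒judge v w (z ∷ l) ()      | true  | true
    rank⇒judge v w (z ∷ l) r       | true  | false = judge-just v w true l
    rank⇒judge v w (z ∷ l) (s≤s r) | false | false = rank⇒judge v w l r

    module Traversals (adj : Bits L → Bits L → Bool) where

      Closed : List (Bits L) → Set
      Closed P = ∀ {u w} → u ∈ P → adj u w ≡ true → w ∈ P

      data Next (P : List (Bits L)) (v : Bits L) : Set where
        visited : v ∈ P → Next P v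
        edge    : ∀ {y} → y ∈ P → adj y v ≡ true → Next P v
        closed  : Closed P → Next P v

      -- The list continues a graph search which has visited P, most recent
      -- vertices first, with repeated visits being allowed.
      data Search (P : List (Bits L)) : List (Bits L) → Set where
        []  : Search P []
        _∷_ : ∀ {v l} → Next P v → Search (v ∷ P) l → Search P (v ∷ l)

      search-++ : ∀ {P l l′} → Search P l → Search (l ʳ++ P) l′ → Search P (l ++ l′)
      search-++ []       t = t
      search-++ (n ∷ s)  t = n ∷ search-++ s t

      -- A snapshot at the first visit of v. The last two fields relate `seen`, apart from P, to the
      -- vertices of smaller rank, which translates `Next` into a statement on the order.
      record Before (P l : List (Bits L)) (v : Bits L) : Set where
        field
          seen     : List (Bits L)
          next     : Next seen v
          unseen   : v ∉ seen
          ⊆-seen   : ∀ {y} → y ∈ P → y ∈ seen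
          earlier  : ∀ {y} → y ∈ seen → y ∈ P ⊎ rank y l < rank v l
          earlier′ : ∀ {y} → rank y l < rank v l → y ∈ seen

      before : ∀ {P l v} → Search P l → v ∉ P → v ∈ l → Before P l v
      before {P} {z ∷ l} {v} (n ∷ s) v∉P v∈l with z ==ᵛ v in p
      ... | true rewrite ==ᵛ-sound z v p = record
        { seen = P ; next = n ; unseen = v∉P ; ⊆-seen = λ i → i ; earlier = inj₁
        ; earlier′ = λ {y} r → contradiction (subst (rank y (v ∷ l) <_) (cong (λ b → if b then 0 else suc (rank v l)) (==ᵛ-refl v)) r) ℕ.n≮0 }
      ... | false = record
        { seen = B.seen ; next = B.next ; unseen = B.unseen ; ⊆-seen = λ i → B.⊆-seen (there i)
        ; earlier = λ i → subst (λ r → _ ⊎ rank _ (z ∷ l) < r) (sym rank-v) (from (B.earlier i))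
        ; earlier′ = λ {y} r → back (subst (rank y (z ∷ l) <_) rank-v r) }
        where
          rank-v : rank v (z ∷ l) ≡ suc (rank v l)
          rank-v = cong (λ b → if b then 0 else suc (rank v l)) p
          z≢v : z ≢ v
          z≢v refl with () ← trans (sym p) (==ᵛ-refl z)
          tail-∈ : v ∈ z ∷ l → v ∈ l
          tail-∈ (here refl) = ⊥-elim (z≢v refl)
          tail-∈ (there i)   = i
          v∉z∷P : v ∉ z ∷ P
          v∉z∷P (here e)  = z≢v (sym e)
          v∉z∷P (there i) = v∉P i
          module B = Before (before s v∉z∷P (tail-∈ v∈l))
          from : ∀ {y} → y ∈ z ∷ P ⊎ rank y l < rank v l → y ∈ P ⊎ (if z ==ᵛ y then 0 else suc (rank y l)) < suc (rank v l)
          from (inj₁ (here refl)) rewrite ==ᵛ-refl z = inj₂ (s≤s z≤n)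
          from (inj₁ (there i))   = inj₁ i
          from {y} (inj₂ r) with z ==ᵛ y
          ... | true  = inj₂ (s≤s z≤n)
          ... | false = inj₂ (s≤s r)
          back : ∀ {y} → (if z ==ᵛ y then 0 else suc (rank y l)) < suc (rank v l) → y ∈ B.seen
          back {y} r with z ==ᵛ y in q
          back {y} r       | true  = subst (_∈ B.seen) (==ᵛ-sound z y q) (B.⊆-seen (here refl))
          back {y} (s≤s r) | false = B.earlier′ r

      -- At the first visit of v, the earlier vertex u has been seen. Were the set of seen vertices
      -- closed, its neighbour w would precede v as well; so v was reached along an edge.
      search-traverses : ∀ {l} → Search [] l → ∀ {u v w} → v ∈ l → rank u l < rank v l → adj u w ≡ true →
                         ¬ (rank w l < rank v l) → ∃[ y ] rank y l < rank v l × adj y v ≡ true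
      search-traverses {l} s {u} {v} {w} v∈l ru a rw = conclude next
        where
          open Before (before s (λ ()) v∈l)
          early : ∀ {y} → y ∈ seen → rank y l < rank v l
          early i with earlier i
          ... | inj₂ r = r
          conclude : Next seen v → ∃[ y ] rank y l < rank v l × adj y v ≡ true
          conclude (visited i)    = ⊥-elim (unseen i)
          conclude (edge i e)     = _ , early i , e
          conclude (closed c)     = ⊥-elim (rw (early (c (earlier′ ru) a)))

  module Explored (Λ : Labelling) {L : ℕ} (adj : Bits (suc L) → Bits (suc L) → Bool) (adj-sym : ∀ u x → adj u x ≡ adj x u) where
    open Labelling Λ
    open Registers.Layout Λ using (Trial; Trial-Counter; k₀; w₀)
    open Program.Explorer Λ using (trace; trialVisits; startVisits; visits)
    open Nodes adj
    open Traversals adj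

    private
      Next-step : ∀ {P} p g → proj₁ p ∈ P → Next P (proj₁ (act g p))
      Next-step (u , x) ide i = visited i
      Next-step (u , x) α   i = visited i
      Next-step (u , x) β   i = visited i
      Next-step (u , x) γ   i with adj u x in e
      ... | true  = edge i e
      ... | false = visited i

      search-trace : ∀ {P} κs p → Next P (proj₁ p) → Search P (trace adj p κs)
      search-trace []       p n = n ∷ []
      search-trace (κ ∷ κs) p n = n ∷ search-trace κs (act (gen κ) p) (Next-step p (gen κ) (here refl))

      trace-head : ∀ κs p → proj₁ p ∈ trace adj p κs
      trace-head []       p = here refl
      trace-head (κ ∷ κs) p = here refl

      trace-end : ∀ κs p → proj₁ (walk adj κs p) ∈ trace adj p κs
      trace-end []       p = here refl
      trace-end (κ ∷ κs) p = there (trace-end κs (act (gen κ) p))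

      trace-reachable : ∀ {q} κs p → Reachable q p → ∀ {u} → u ∈ trace adj p κs → ∃[ x ] Reachable q (u , x)
      trace-reachable []       (u , x) r (here refl) = x , r
      trace-reachable (κ ∷ κs) (u , x) r (here refl) = x , r
      trace-reachable (κ ∷ κs) p       r (there i)   = trace-reachable κs _ (move (gen κ) r) i

      -- An edge can be crossed from the node of the path of its first end that
      -- carries it.
      cross : ∀ {q u w x} → adj u w ≡ true → Reachable q (u , x) → Reachable q (w , u)
      cross {q} {u} {w} {x} a r = subst (Reachable q) (cross-γ a)
          (move γ (flip-gray-transitive (λ y → Reachable q (u , y)) (move α) (move β) x w r))
        where
          cross-γ : adj u w ≡ true → act γ (u , w) ≡ (w , u)
          cross-γ a rewrite a = refl

      pairUp : ∀ {n} → Vec Label n → Vec Label n → Vec Trial n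
      pairUp = Vec.zipWith (λ k w → k ∷ w ∷ [])

      pairUp-k : ∀ {n} (ks ws : Vec Label n) → Vec.map k₀ (pairUp ks ws) ≡ ks
      pairUp-k []       []       = refl
      pairUp-k (k ∷ ks) (w ∷ ws) = cong (k ∷_) (pairUp-k ks ws)

      pairUp-w : ∀ {n} (ks ws : Vec Label n) → Vec.map w₀ (pairUp ks ws) ≡ ws
      pairUp-w []       []       = refl
      pairUp-w (k ∷ ks) (w ∷ ws) = cong (w ∷_) (pairUp-w ks ws)

      trials = tuples Trial-Counter (suc L)

      ∈-startVisits : ∀ s t {u} → u ∈ trialVisits adj s t → u ∈ startVisits adj s
      ∈-startVisits s t i = ∈.∈-concatMap⁺ (trialVisits adj s) (Any.map (λ { refl → i }) (∈-tuples Trial-Counter t))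

      -- A visited vertex belongs to a node reachable from the start, and `cross` then reaches a
      -- node of its neighbour. By `covers` some start coordinates and top labels lead there, and
      -- they form one of the trials.
      startVisits-closed : ∀ s {u w} → u ∈ startVisits adj s → adj u w ≡ true → w ∈ startVisits adj s
      startVisits-closed s {u} {w} i a = covered (covers adj adj-sym (s , zeros _) (cross a (proj₂ reached)))
        where
          found = Any.satisfied (∈.∈-concatMap⁻ (trialVisits adj s) {xs = trials} i)
          reached = trace-reachable _ (s , zeros _) start (proj₂ found)
          covered : _ → w ∈ startVisits adj s
          covered (ks , ws , e) = ∈-startVisits s (pairUp ks ws)
            (subst₂ (λ ks′ ws′ → w ∈ trace adj (s , zeros _) (stream ks′ (toList ws′))) (sym (pairUp-k ks ws)) (sym (pairUp-w ks ws))
              (subst (λ p → proj₁ p ∈ trace adj (s , zeros _) (stream ks (toList ws))) e (trace-end (stream ks (toList ws)) (s , zeros _))))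

      ∈-ʳ++ʳ : ∀ {A : Set} {y : A} xs {ys} → y ∈ ys → y ∈ xs ʳ++ ys
      ∈-ʳ++ʳ []       i = i
      ∈-ʳ++ʳ (x ∷ xs) i = ∈-ʳ++ʳ xs (there i)

      ∈-ʳ++ˡ : ∀ {A : Set} {y : A} xs {ys} → y ∈ xs → y ∈ xs ʳ++ ys
      ∈-ʳ++ˡ (x ∷ xs) (here refl) = ∈-ʳ++ʳ xs (here refl)
      ∈-ʳ++ˡ (x ∷ xs) (there i)   = ∈-ʳ++ˡ xs i

      ∈-ʳ++⁻ : ∀ {A : Set} {y : A} xs {ys} → y ∈ xs ʳ++ ys → y ∈ xs ⊎ y ∈ ys
      ∈-ʳ++⁻ []       i = inj₂ i
      ∈-ʳ++⁻ (x ∷ xs) i with ∈-ʳ++⁻ xs i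
      ... | inj₁ j           = inj₁ (there j)
      ... | inj₂ (here refl) = inj₁ (here refl)
      ... | inj₂ (there j)   = inj₂ j

      -- Only the first trial needs a reason for beginning at s; each later one begins at a vertex
      -- already visited.
      search-trials : ∀ {P} s ts → Next P s → Search P (concatMap (trialVisits adj s) ts)
      search-trials s []       n = []
      search-trials s (t ∷ ts) n = search-++ (search-trace κs (s , zeros _) n)
          (search-trials s ts (visited (∈-ʳ++ˡ (trialVisits adj s t) (trace-head κs (s , zeros _)))))
        where
          κs = stream (Vec.map k₀ t) (toList (Vec.map w₀ t))

      search-starts : ∀ {P} ss → Closed P → Search P (concatMap (startVisits adj) ss)
      search-starts         []       c = []
      search-starts {P = P} (s ∷ ss) c = search-++ (search-trials s trials (closed c)) (search-starts ss c′)
        where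
          c′ : Closed (startVisits adj s ʳ++ P)
          c′ i a with ∈-ʳ++⁻ (startVisits adj s) i
          ... | inj₁ j = ∈-ʳ++ˡ (startVisits adj s) (startVisits-closed s j a)
          ... | inj₂ j = ∈-ʳ++ʳ (startVisits adj s) (c j a)

    search-visits : Search [] (visits adj)
    search-visits = search-starts (tuples Bool-Counter (suc L)) (λ ())

    ∈-visits : ∀ s → s ∈ visits adj
    ∈-visits s = ∈.∈-concatMap⁺ (startVisits adj) (Any.map (λ { refl → ∈-startVisits s t (trace-head (stream (Vec.map k₀ t) (toList (Vec.map w₀ t))) (s , zeros _)) })
                   (∈-tuples Bool-Counter s))
      where
        t : Vec Trial (suc L)
        t = firsts Trial-Counter

-- The deciding machine and its space bound.

module Decide where

  open import Data.Bool.Base using (Bool; true; false; if_then_else_)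
  open import Data.List.Base as List using (List; []; _∷_; length; foldl)
  open import Data.Maybe.Base using (Maybe; just; nothing)
  open import Data.Nat.Base using (ℕ; suc; _+_; _*_; _^_; _≤_; _<_; z≤n; s≤s)
  import Data.Nat.Properties as ℕ
  open import Data.Nat.Logarithm using (⌈log₂_⌉; ⌈log₂⌉-mono-≤; ⌈log₂2*n⌉≡1+⌈log₂n⌉; ⌈log₂2^n⌉≡n)
  open import Data.Nat.Tactic.RingSolver using (solve-∀)
  open import Data.Product.Base using (_×_; _,_; proj₁; proj₂; ∃-syntax; Σ)
  open import Data.Sum.Base using (_⊎_; inj₁; inj₂)
  open import Data.Vec.Base as Vec using ([]; _∷_)
  open import Relation.Binary.PropositionalEquality
  open import Defs
  open Exploration using (Labelling)
  open Machine
  open Registers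
  open Program

  valL : List Bool → ℕ
  valL []       = 0
  valL (b ∷ bs) = (if b then 1 else 0) + 2 * valL bs

  valL-incL : ∀ bs → valL (incL bs) ≡ suc (valL bs)
  valL-incL []           = refl
  valL-incL (false ∷ bs) = refl
  valL-incL (true ∷ bs)  = trans (cong (2 *_) (valL-incL bs)) (ℕ.*-suc 2 (valL bs))

  valL-< : ∀ bs → suc (valL bs) ≤ 2 ^ length bs
  valL-< []           = s≤s z≤n
  valL-< (false ∷ bs) = ℕ.≤-trans (ℕ.n≤1+n _) (subst (_≤ 2 * 2 ^ length bs) (ℕ.*-suc 2 (valL bs)) (ℕ.*-monoʳ-≤ 2 (valL-< bs)))
  valL-< (true ∷ bs)  = subst (_≤ 2 * 2 ^ length bs) (ℕ.*-suc 2 (valL bs)) (ℕ.*-monoʳ-≤ 2 (valL-< bs))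

  length-incL : ∀ bs → length (incL bs) ≡ length bs ⊎ (length (incL bs) ≡ suc (length bs) × suc (valL bs) ≡ 2 ^ length bs)
  length-incL []           = inj₂ (refl , refl)
  length-incL (false ∷ bs) = inj₁ refl
  length-incL (true ∷ bs) with length-incL bs
  ... | inj₁ e       = inj₁ (cong suc e)
  ... | inj₂ (e , f) = inj₂ (cong suc e , trans (sym (ℕ.*-suc 2 (valL bs))) (cong (2 *_) f))

  tight-incL : ∀ bs → bs ≡ [] ⊎ 2 ^ length bs ≤ 2 * valL bs → 2 ^ length (incL bs) ≤ 2 * valL (incL bs)
  tight-incL .[] (inj₁ refl) = s≤s (s≤s z≤n)
  tight-incL bs  (inj₂ le) rewrite valL-incL bs with length-incL bs
  ... | inj₁ e       rewrite e = ℕ.≤-trans le (ℕ.*-monoʳ-≤ 2 (ℕ.n≤1+n _))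
  ... | inj₂ (e , f) rewrite e = ℕ.≤-reflexive (cong (2 *_) (sym f))

  counting : ∀ (bs acc : List Bool) → acc ≡ [] ⊎ 2 ^ length acc ≤ 2 * valL acc →
    let r = foldl (λ n _ → incL n) acc bs in
    valL r ≡ length bs + valL acc × (r ≡ [] ⊎ 2 ^ length r ≤ 2 * valL r)
  counting []       acc h = refl , h
  counting (b ∷ bs) acc h with counting bs (incL acc) (inj₂ (tight-incL acc h))
  ... | e , h′ = trans e (trans (cong (length bs +_) (valL-incL acc)) (ℕ.+-suc _ _)) , h′

  valL-counter : ∀ bs → valL (counter bs) ≡ length bs
  valL-counter bs = trans (proj₁ (counting bs [] (inj₁ refl))) (ℕ.+-identityʳ _)

  length-< : ∀ bs → length bs < 2 ^ length (counter bs)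
  length-< bs = subst (λ m → suc m ≤ 2 ^ length (counter bs)) (valL-counter bs) (valL-< (counter bs))

  log-counter : ∀ bs → length (counter bs) ≤ suc ⌈log₂ length bs ⌉
  log-counter bs with proj₂ (counting bs [] (inj₁ refl))
  ... | inj₁ e rewrite e = z≤n
  log-counter []         | inj₂ le = z≤n
  log-counter bs@(_ ∷ _) | inj₂ le = begin
    length (counter bs)                     ≡⟨ ⌈log₂2^n⌉≡n _ ⟨
    ⌈log₂ 2 ^ length (counter bs) ⌉         ≤⟨ ⌈log₂⌉-mono-≤ le ⟩
    ⌈log₂ 2 * valL (counter bs) ⌉           ≡⟨ cong (λ m → ⌈log₂ 2 * m ⌉) (valL-counter bs) ⟩
    ⌈log₂ 2 * length bs ⌉                   ≡⟨ ⌈log₂2*n⌉≡1+⌈log₂n⌉ (length bs) ⟩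
    suc ⌈log₂ length bs ⌉                   ∎
    where open ℕ.≤-Reasoning

  length-leading : ∀ xs → length (leading xs) ≤ length xs
  length-leading []           = z≤n
  length-leading (bit b ∷ xs) = s≤s (length-leading xs)
  length-leading (# ∷ xs)     = z≤n

  module Deciding (Λ : Labelling) where
    open Registers.Layout Λ
    open Program.Explorer Λ

    isTrue : Maybe Bool → Bool
    isTrue (just b) = b
    isTrue nothing  = false

    q₀ : Control
    q₀ = control false false (Counter.first Label-Counter) false nothing

    decision : Decider program q₀ (λ q → isTrue (ans q))
    decision = decider program q₀ (λ q → isTrue (ans q))

    open Decider decision using (machine) public

    private
      Result : List Symbol → Set
      Result xs = ∃[ q′ ] ∃[ p′ ] Σ (Bank (length (counter (leading xs)))) λ R′ →
        _⊢_⇓_ xs program ⟨ q₀ , 0 , [] ⟩ ⟨ q′ , p′ , Z R′ ⟩ × ans q′ ≡ answer xs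

      result : ∀ xs → Result xs
      result xs = Runs.program-run xs q₀ refl

      bounded : ∀ xs t → space machine (run machine xs t) ≤ length (counter (leading xs)) + 2
      bounded xs t = go (result xs)
        where
          go : Result xs → space machine (run machine xs t) ≤ length (counter (leading xs)) + 2
          go (q′ , p′ , R′ , r , _) = subst (λ m → space machine (run machine xs t) ≤ m + 2) (length-Z R′) (Decider.bounded decision xs r t)

      halts : ∀ xs → Halts machine xs
      halts xs = go (result xs)
        where
          go : Result xs → Halts machine xs
          go (q′ , p′ , R′ , r , _) = Decider.halts decision xs r

    accepts⇒ : ∀ xs → Accepts machine xs → answer xs ≡ just true
    accepts⇒ xs acc = go (result xs)
      where
        just-true : ∀ m → isTrue m ≡ true → m ≡ just true
        just-true (just true) _ = refl
        go : Result xs → answer xs ≡ just true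
        go (q′ , p′ , R′ , r , a) = just-true _ (trans (cong isTrue (sym a)) (Decider.accepted decision xs r acc))

    accepts⇐ : ∀ xs → answer xs ≡ just true → Accepts machine xs
    accepts⇐ xs e = go (result xs)
      where
        go : Result xs → Accepts machine xs
        go (q′ , p′ , R′ , r , a) = Decider.accepts decision xs r (cong isTrue (trans a e))

    logSpace : IsLogSpace machine
    -- The block has at most 1 + log cells, and the two blanks are covered by 2 (1 + log).
    logSpace = halts , 3 , λ xs t → ℕ.≤-trans (bounded xs t) (begin
        length (counter (leading xs)) + 2          ≤⟨ ℕ.+-monoˡ-≤ 2 (ℕ.≤-trans (log-counter (leading xs))
                                                        (s≤s (⌈log₂⌉-mono-≤ (length-leading xs)))) ⟩
        suc ⌈log₂ length xs ⌉ + 2                  ≤⟨ ℕ.m≤m+n _ (⌈log₂ length xs ⌉ + ⌈log₂ length xs ⌉) ⟩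
        suc ⌈log₂ length xs ⌉ + 2 + (⌈log₂ length xs ⌉ + ⌈log₂ length xs ⌉) ≡⟨ lem ⌈log₂ length xs ⌉ ⟩
        3 * suc ⌈log₂ length xs ⌉                  ∎)
      where
        open ℕ.≤-Reasoning
        lem : ∀ n → suc n + 2 + (n + n) ≡ 3 * suc n
        lem = solve-∀

-- Values of bit vectors and the scan of the adjacency matrix.

module Numbers where

  open import Data.Bool.Base using (Bool; true; false; _∧_; if_then_else_)
  open import Data.List.Base as List using (List; []; _∷_; _++_; length; map; concatMap; foldl)
  import Data.List.Properties as List
  open import Data.List.Membership.Propositional using (_∈_)
  open import Data.List.Relation.Unary.Any using (here; there)
  open import Data.Maybe.Base as Maybe using (Maybe; just; nothing)
  open import Data.Maybe.Properties using (just-injective)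
  open import Data.Nat.Base using (ℕ; zero; suc; _+_; _*_; _^_; _≤_; _<_; z≤n; s≤s)
  import Data.Nat.Properties as ℕ
  open import Data.Nat.Tactic.RingSolver using (solve-∀)
  open import Data.Product.Base using (_×_; _,_; proj₁; proj₂; ∃-syntax)
  open import Data.Sum.Base using (_⊎_; inj₁; inj₂)
  open import Data.Vec.Base as Vec using ([]; _∷_)
  open import Relation.Binary.Definitions using (tri<; tri≈; tri>)
  open import Relation.Binary.PropositionalEquality
  open import Relation.Nullary.Negation using (¬_; contradiction)
  open Walk using (Bits)
  open Exploration using (zeros)
  open Registers using (Bool-Counter; nexts; shiftIn; _==ᵛ_; tuples; ∈-tuples)
  open Program
  open Visits using (==ᵛ-refl; ==ᵛ-sound)

  digit : Bool → ℕ
  digit b = if b then 1 else 0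

  val : ∀ {L} → Bits L → ℕ
  val []       = 0
  val (b ∷ bs) = digit b + 2 * val bs

  val-zeros : ∀ L → val (zeros L) ≡ 0
  val-zeros zero    = refl
  val-zeros (suc L) = cong (2 *_) (val-zeros L)

  even≢odd : ∀ m n → 2 * m ≢ suc (2 * n)
  even≢odd (suc m) zero    e with () ← trans (sym (ℕ.+-suc m (m + 0))) (ℕ.suc-injective e)
  even≢odd (suc m) (suc n) e = even≢odd m n (ℕ.suc-injective (ℕ.suc-injective (trans (sym (ℕ.*-suc 2 m)) (trans e (cong suc (ℕ.*-suc 2 n))))))

  val-injective : ∀ {L} (v w : Bits L) → val v ≡ val w → v ≡ w
  val-injective []          []          e = refl
  val-injective (false ∷ v) (false ∷ w) e = cong (false ∷_) (val-injective v w (ℕ.*-cancelˡ-≡ (val v) (val w) 2 e))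
  val-injective (true ∷ v)  (true ∷ w)  e = cong (true ∷_) (val-injective v w (ℕ.*-cancelˡ-≡ (val v) (val w) 2 (ℕ.suc-injective e)))
  val-injective (false ∷ v) (true ∷ w)  e = contradiction e (even≢odd (val v) (val w))
  val-injective (true ∷ v)  (false ∷ w) e = contradiction (sym e) (even≢odd (val w) (val v))

  val-nexts : ∀ {L} (v : Bits L) →
    (∃[ v′ ] nexts Bool-Counter v ≡ just v′ × val v′ ≡ suc (val v)) ⊎ (nexts Bool-Counter v ≡ nothing × suc (val v) ≡ 2 ^ L)
  val-nexts []          = inj₂ (refl , refl)
  val-nexts (false ∷ v) = inj₁ (true ∷ v , refl , refl)
  val-nexts (true ∷ v) with val-nexts v
  ... | inj₁ (v′ , e , f) rewrite e = inj₁ (false ∷ v′ , refl , trans (cong (2 *_) f) (ℕ.*-suc 2 (val v)))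
  ... | inj₂ (e , f) rewrite e = inj₂ (refl , trans (sym (ℕ.*-suc 2 (val v))) (cong (2 *_) f))

  val-inc : ∀ {L} (v : Bits L) → suc (val v) < 2 ^ L → val (inc v) ≡ suc (val v)
  val-inc v lt with val-nexts v
  ... | inj₁ (v′ , e , f) rewrite e = f
  ... | inj₂ (e , f) = contradiction f (ℕ.<⇒≢ lt)

  val-surjective : ∀ L m → m < 2 ^ L → ∃[ v ] val {L} v ≡ m
  val-surjective L zero    lt = zeros L , val-zeros L
  val-surjective L (suc m) lt with val-surjective L m (ℕ.<-trans (ℕ.n<1+n m) lt)
  ... | v , refl = inc v , val-inc v lt

  -- The top digit falls off, whence the multiple of 2 ^ L.
  val-shiftIn : ∀ {L} b (v : Bits L) → ∃[ k ] val (shiftIn b v) + k * 2 ^ L ≡ digit b + 2 * val v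
  val-shiftIn b [] = digit b , lem (digit b)
    where
      lem : ∀ d → d * 1 ≡ d + 0
      lem = solve-∀
  val-shiftIn {suc L} b (a ∷ v) with val-shiftIn a v
  ... | k , e = k , trans (lem (digit b) (val (shiftIn a v)) k (2 ^ L)) (cong (λ z → digit b + 2 * z) e)
    where
      lem : ∀ d s k p → d + 2 * s + k * (2 * p) ≡ d + 2 * (s + k * p)
      lem = solve-∀

  val-shiftIn-< : ∀ {L} b (v : Bits L) → digit b + 2 * val v < 2 ^ L → val (shiftIn b v) ≡ digit b + 2 * val v
  val-shiftIn-< {L} b v lt with val-shiftIn b v
  ... | zero  , e = trans (sym (ℕ.+-identityʳ _)) e
  ... | suc k , e = contradiction (ℕ.≤-trans (ℕ.m≤m+n (2 ^ L) (k * 2 ^ L)) (ℕ.m≤n+m _ (val (shiftIn b v)))) (ℕ.<⇒≱ (subst (_< 2 ^ L) (sym e) lt))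

  infix 8 _!_
  _!_ : {A : Set} → List A → ℕ → Maybe A
  []       ! p     = nothing
  (x ∷ xs) ! zero  = just x
  (x ∷ xs) ! suc p = xs ! p

  !-length : {A : Set} (xs : List A) {p : ℕ} {x : A} → xs ! p ≡ just x → p < length xs
  !-length (x ∷ xs) {zero}  e = s≤s z≤n
  !-length (x ∷ xs) {suc p} e = s≤s (!-length xs e)

  !-total : {A : Set} (xs : List A) {p : ℕ} → p < length xs → ∃[ x ] xs ! p ≡ just x
  !-total (x ∷ xs) {zero}  lt       = x , refl
  !-total (x ∷ xs) {suc p} (s≤s lt) = !-total xs lt

  !-∈ : {A : Set} (xs : List A) {p : ℕ} {x : A} → xs ! p ≡ just x → x ∈ xs
  !-∈ (x ∷ xs) {zero}  refl = here refl
  !-∈ (x ∷ xs) {suc p} e    = there (!-∈ xs e)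

  ∈-! : {A : Set} (xs : List A) {x : A} → x ∈ xs → ∃[ p ] xs ! p ≡ just x
  ∈-! (x ∷ xs) (here refl) = 0 , refl
  ∈-! (x ∷ xs) (there i) with ∈-! xs i
  ... | p , e = suc p , e

  !-map : {A B : Set} (f : A → B) (xs : List A) {p : ℕ} {x : A} → xs ! p ≡ just x → map f xs ! p ≡ just (f x)
  !-map f (x ∷ xs) {zero}  refl = refl
  !-map f (x ∷ xs) {suc p} e    = !-map f xs e

  !-++ˡ : {A : Set} (xs : List A) {ys : List A} {p : ℕ} {x : A} → xs ! p ≡ just x → (xs ++ ys) ! p ≡ just x
  !-++ˡ (x ∷ xs) {p = zero}  e = e
  !-++ˡ (x ∷ xs) {p = suc p} e = !-++ˡ xs e

  !-++ʳ : {A : Set} (xs : List A) {ys : List A} (p : ℕ) → (xs ++ ys) ! (length xs + p) ≡ ys ! p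
  !-++ʳ []       p = refl
  !-++ʳ (x ∷ xs) p = !-++ʳ xs p

  row-< : ∀ n {a b c d} → a < c → b < n → a * n + b < c * n + d
  row-< n {a} {b} {c} {d} a<c b<n = begin-strict
    a * n + b     <⟨ ℕ.+-monoʳ-< (a * n) b<n ⟩
    a * n + n     ≡⟨ ℕ.+-comm (a * n) n ⟩
    suc a * n     ≤⟨ ℕ.*-monoˡ-≤ n a<c ⟩
    c * n         ≤⟨ ℕ.m≤m+n (c * n) d ⟩
    c * n + d     ∎
    where open ℕ.≤-Reasoning

  divMod-unique : ∀ n {a b c d} → b < n → d < n → a * n + b ≡ c * n + d → a ≡ c × b ≡ d
  divMod-unique n {a} {b} {c} {d} b<n d<n e with ℕ.<-cmp a c
  ... | tri< a<c _ _  = contradiction e (ℕ.<⇒≢ (row-< n a<c b<n))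
  ... | tri≈ _ refl _ = refl , ℕ.+-cancelˡ-≡ (a * n) b d e
  ... | tri> _ _ c<a  = contradiction (sym e) (ℕ.<⇒≢ (row-< n c<a d<n))

  -- The index reached after p letters of a matrix with rows of length m; for
  -- m = 0 the column index never wraps.
  Position : ∀ {L} → ℕ → ℕ → Index L → Set
  Position m p (i , j) = val i * m + val j ≡ p × (val j < m ⊎ (m ≡ 0 × val i ≡ 0))

  origin-position : ∀ L m → Position {L} m 0 origin
  origin-position L zero    rewrite val-zeros L = refl , inj₂ (refl , refl)
  origin-position L (suc m) rewrite val-zeros L = refl , inj₁ (s≤s z≤n)

  -- An index that is increased is at most p beforehand, so `suc p < 2 ^ L` prevents overflow of the
  -- rows as well as the columns.
  tick-position : ∀ {L} (M : Bits L) p ij → Position (val M) p ij → suc p < 2 ^ L → Position (val M) (suc p) (tick M ij)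
  tick-position {L} M p (i , j) (e , b) lt with val-inc j (ℕ.≤-<-trans (s≤s (subst (val j ≤_) e (ℕ.m≤n+m (val j) _))) lt) | inc j ==ᵛ M in q
  ... | inc-j | true = landed , wrapped
    where
      M≡ : val M ≡ suc (val j)
      M≡ = trans (cong val (sym (==ᵛ-sound (inc j) M q))) inc-j
      i≤ : val i ≤ p
      i≤ = subst (val i ≤_) e (ℕ.≤-trans (subst (λ m → val i ≤ val i * m) (sym M≡) (ℕ.m≤m*n (val i) (suc (val j)))) (ℕ.m≤m+n _ (val j)))
      wrapped : val (zeros L) < val M ⊎ (val M ≡ 0 × val (inc i) ≡ 0)
      wrapped = inj₁ (subst₂ _<_ (sym (val-zeros L)) (sym M≡) (s≤s z≤n))
      landed : val (inc i) * val M + val (zeros L) ≡ suc p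
      landed rewrite val-zeros L | val-inc i (ℕ.≤-<-trans (s≤s i≤) lt) = trans (ℕ.+-identityʳ _) (trans (cong (_+ val i * val M) M≡)
        (cong suc (trans (ℕ.+-comm (val j) _) e)))
  ... | inc-j | false = trans (cong (val i * val M +_) inc-j) (trans (ℕ.+-suc _ _) (cong suc e)) , still b
    where
      still : val j < val M ⊎ (val M ≡ 0 × val i ≡ 0) → val (inc j) < val M ⊎ (val M ≡ 0 × val i ≡ 0)
      still (inj₂ z)  = inj₂ z
      still (inj₁ lt) = inj₁ (ℕ.≤∧≢⇒< (subst (_≤ val M) (sym inc-j) lt)
        λ e → contradiction (trans (sym (trans (cong (_==ᵛ M) (val-injective (inc j) M e)) (==ᵛ-refl M))) q) (λ ()))

  ticks-position : ∀ {L} (M : Bits L) bs p ij → Position (val M) p ij → p + length bs < 2 ^ L →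
                   Position (val M) (p + length bs) (ticks M ij bs)
  ticks-position M []       p ij P lt = subst (λ p → Position (val M) p ij) (sym (ℕ.+-identityʳ p)) P
  ticks-position {L} M (b ∷ bs) p ij P lt = subst (λ p → Position (val M) p (ticks M (tick M ij) bs)) (sym (ℕ.+-suc p _))
    (ticks-position M bs (suc p) (tick M ij) (tick-position M p ij P (ℕ.≤-<-trans (ℕ.≤-trans (s≤s (ℕ.m≤m+n p _)) (ℕ.≤-reflexive (sym (ℕ.+-suc p _)))) lt))
      (subst (_< 2 ^ L) (ℕ.+-suc p _) lt))

  ∧-true : ∀ a {b} → (a ∧ b) ≡ true → a ≡ true × b ≡ true
  ∧-true true e = refl , e

  module _ {A : Set} (r : A → A → Bool) (vs : List A) where

    private
      n = length vs

    matrix : List A → List Bool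
    matrix = concatMap (λ a → map (r a) vs)

    length-matrix : ∀ us → length (matrix us) ≡ length us * n
    length-matrix []       = refl
    length-matrix (u ∷ us) = trans (List.length-++ (map (r u) vs)) (cong₂ _+_ (List.length-map (r u) vs) (length-matrix us))

    matrix-! : ∀ us {a b u w} → us ! a ≡ just u → vs ! b ≡ just w → matrix us ! (a * n + b) ≡ just (r u w)
    matrix-! (u ∷ us) {zero}  refl e = !-++ˡ (map (r u) vs) (!-map (r u) vs e)
    matrix-! (u ∷ us) {suc a} {b} d e = trans (cong (matrix (u ∷ us) !_) (trans (ℕ.+-assoc n _ b) (cong (_+ (a * n + b)) (sym (List.length-map (r u) vs)))))
      (trans (!-++ʳ (map (r u) vs) (a * n + b)) (matrix-! us d e))

    module _ {L : ℕ} (fits : n * n < 2 ^ L) where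

      private
        bs = matrix vs

        length-bs : length bs ≡ n * n
        length-bs = length-matrix vs

        fits′ : length bs < 2 ^ L
        fits′ = subst (_< 2 ^ L) (sym length-bs) fits

        last-position : ∀ (M : Bits L) → Position (val M) (n * n) (ticks M origin bs)
        last-position M = subst (λ p → Position (val M) p (ticks M origin bs)) length-bs
          (ticks-position M bs 0 origin (origin-position L (val M)) fits′)

        square-injective : ∀ a b → a * a ≡ b * b → a ≡ b
        square-injective a b e with ℕ.<-cmp a b
        ... | tri< lt _ _ = contradiction e (ℕ.<⇒≢ (ℕ.*-mono-< lt lt))
        ... | tri≈ _ eq _ = eq
        ... | tri> _ _ gt = contradiction (sym e) (ℕ.<⇒≢ (ℕ.*-mono-< gt gt))

      -- After all n² bits the position satisfies val i · val M + val j = n². Ending at row M,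
      -- column 0 therefore gives val M · val M = n².
      isOrder⇒ : ∀ (M : Bits L) → isOrder bs M ≡ true → val M ≡ n
      isOrder⇒ M e with ticks M origin bs | last-position M | ∧-true (proj₁ (ticks M origin bs) ==ᵛ M) e
      ... | i , j | p , _ | ei , ej = square-injective (val M) n (trans (sym (ℕ.+-identityʳ _))
        (trans (cong₂ (λ a b → a * val M + b) (cong val (sym (==ᵛ-sound i M ei))) (trans (sym (val-zeros L)) (cong val (sym (==ᵛ-sound j (zeros L) ej))))) p))

      isOrder⇐ : ∀ (M : Bits L) → val M ≡ n → isOrder bs M ≡ true
      isOrder⇐ M e with ticks M origin bs | last-position M
      ... | i , j | p , inj₁ lt = cong₂ _∧_ (trans (cong (_==ᵛ M) (val-injective i M (trans (proj₁ ij) (sym e)))) (==ᵛ-refl M))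
          (trans (cong (_==ᵛ zeros L) (val-injective j (zeros L) (trans (proj₂ ij) (sym (val-zeros L))))) (==ᵛ-refl (zeros L)))
        where
          ij : val i ≡ n × val j ≡ 0
          ij = divMod-unique n {val i} {val j} {n} {0} (subst (val j <_) e lt) (ℕ.≤-<-trans z≤n (subst (val j <_) e lt))
            (trans (cong (λ m → val i * m + val j) (sym e)) (trans p (sym (ℕ.+-identityʳ _))))
      -- The graph without vertices: no bit has been read, and both indices are 0.
      ... | i , j | p , inj₂ (m0 , i0) = cong₂ _∧_ (trans (cong (_==ᵛ M) (val-injective i M (trans i0 (sym m0)))) (==ᵛ-refl M))
          (trans (cong (_==ᵛ zeros L) (val-injective j (zeros L) (trans j0 (sym (val-zeros L))))) (==ᵛ-refl (zeros L)))
        where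
          n0 : n ≡ 0
          n0 = trans (sym e) m0
          j0 : val j ≡ 0
          j0 = trans (cong (λ a → a * val M + val j) (sym i0)) (trans p (cong₂ _*_ n0 n0))

      -- The fold keeps the last candidate that passes the test. Exactly one passes by `isOrder⇒`
      -- and `isOrder⇐`, and n is among the candidates since n ≤ n² < 2 ^ L.
      order-correct : val (order {L} bs) ≡ n
      order-correct = trans (cong val chosen) (proj₂ N̂)
        where
          n<2^L : n < 2 ^ L
          n<2^L = ℕ.≤-<-trans (square-≥ n) fits
            where
              square-≥ : ∀ n → n ≤ n * n
              square-≥ zero    = z≤n
              square-≥ (suc n) = ℕ.m≤m*n (suc n) (suc n)
          N̂ = val-surjective L n n<2^L
          N = proj₁ N̂
          sel : Bits L → Bits L → Bits L
          sel o m = if isOrder bs m then m else o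
          keep : ∀ ms → foldl sel N ms ≡ N
          keep []       = refl
          keep (m ∷ ms) with isOrder bs m in q
          ... | false = keep ms
          ... | true  = trans (cong (λ m → foldl sel m ms) (val-injective m N (trans (isOrder⇒ m q) (sym (proj₂ N̂))))) (keep ms)
          pick : ∀ ms o → N ∈ ms → foldl sel o ms ≡ N
          pick (m ∷ ms) o (here refl) rewrite isOrder⇐ N (proj₂ N̂) = keep ms
          pick (m ∷ ms) o (there i)   = pick ms (sel o m) i
          chosen : order {L} bs ≡ N
          chosen = pick (tuples Bool-Counter L) (zeros L) (∈-tuples Bool-Counter N)

      module _ (N : Bits L) (N≡ : val N ≡ n) where

        private
          match-self : ∀ (u x : Bits L) → match u x (u , x) ≡ true
          match-self u x = cong₂ _∧_ (==ᵛ-refl u) (==ᵛ-refl x)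

          match-eq : ∀ (u x : Bits L) ij → match u x ij ≡ true → ij ≡ (u , x)
          match-eq u x (i , j) e with ∧-true (i ==ᵛ u) e
          ... | a , b = cong₂ _,_ (==ᵛ-sound i u a) (==ᵛ-sound j x b)

          cons-fits : ∀ p k → p + suc k < 2 ^ L → suc p < 2 ^ L × suc p + k < 2 ^ L
          cons-fits p k lt = ℕ.≤-<-trans (ℕ.m≤m+n (suc p) k) lt′ , lt′
            where lt′ = subst (_< 2 ^ L) (ℕ.+-suc p k) lt

          step : ∀ p ij {k} → Position n p ij → p + suc k < 2 ^ L → Position n (suc p) (tick N ij)
          step p ij {k} P lt = subst (λ m → Position m (suc p) (tick N ij)) N≡
            (tick-position N p ij (subst (λ m → Position m p ij) (sym N≡) P) (proj₁ (cons-fits p k lt)))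

          passed : ∀ u x cs p ij acc → val x < n → val u * n + val x < p → Position n p ij → p + length cs < 2 ^ L →
                   find N u x ij acc cs ≡ acc
          passed u x []       p ij acc x<n t<p P lt = refl
          passed u x (c ∷ cs) p ij acc x<n t<p P lt with match u x ij in q
          ... | false = passed u x cs (suc p) (tick N ij) acc x<n (ℕ.m≤n⇒m≤1+n t<p) (step p ij P lt) (proj₂ (cons-fits p (length cs) lt))
          ... | true  = contradiction (trans (cong (λ { (i , j) → val i * n + val j }) (sym (match-eq u x ij q))) (proj₁ P)) (ℕ.<⇒≢ t<p)

          -- k is the distance from the present position to the entry sought. Once it is 0,
          -- `divMod-unique` makes the indices match, and by `passed` no later entry overwrites the
          -- result.
          hit : ∀ u x cs k p ij acc {b} → val x < n → val u * n + val x ≡ p + k → cs ! k ≡ just b → Position n p ij →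
                p + length cs < 2 ^ L → find N u x ij acc cs ≡ b
          hit u x (c ∷ cs) zero p ij@(i , j) acc x<n t e P lt = trans
              (cong (λ m → find N u x (tick N ij) (if m then c else acc) cs) (trans (cong (match u x) here-now) (match-self u x)))
              (trans (passed u x cs (suc p) (tick N ij) c x<n (ℕ.≤-reflexive (cong suc (trans t (ℕ.+-identityʳ p)))) (step p ij P lt)
                (proj₂ (cons-fits p (length cs) lt))) (just-injective e))
            where
              j<n : val j < n
              j<n = bounded (proj₂ P)
                where
                  bounded : val j < n ⊎ (n ≡ 0 × val i ≡ 0) → val j < n
                  bounded (inj₁ lt) = lt
                  bounded (inj₂ (n0 , _)) = contradiction (subst (val x <_) n0 x<n) ℕ.n≮0
              both : val i ≡ val u × val j ≡ val x
              both = divMod-unique n j<n x<n (trans (proj₁ P) (sym (trans t (ℕ.+-identityʳ p))))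
              here-now : ij ≡ (u , x)
              here-now = cong₂ _,_ (val-injective i u (proj₁ both)) (val-injective j x (proj₂ both))
          hit u x (c ∷ cs) (suc k) p ij acc x<n t e P lt =
            hit u x cs k (suc p) (tick N ij) _ x<n (trans t (ℕ.+-suc p k)) e (step p ij P lt) (proj₂ (cons-fits p (length cs) lt))

          outside : ∀ u x cs p ij acc → ¬ (val u < n × val x < n) → Position n p ij → p + length cs ≤ n * n →
                    find N u x ij acc cs ≡ acc
          outside u x []       p ij acc out P le = refl
          outside u x (c ∷ cs) p ij acc out P le with match u x ij in q
          ... | false = outside u x cs (suc p) (tick N ij) acc out (step p ij P (ℕ.≤-<-trans le fits)) (subst (_≤ n * n) (ℕ.+-suc p _) le)
          ... | true with match-eq u x ij q
          ...   | refl = contradiction (in-range (proj₂ P)) out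
            where
              p<n² : p < n * n
              p<n² = ℕ.≤-trans (ℕ.≤-trans (s≤s (ℕ.m≤m+n p _)) (ℕ.≤-reflexive (sym (ℕ.+-suc p _)))) le
              in-range : val x < n ⊎ (n ≡ 0 × val u ≡ 0) → val u < n × val x < n
              in-range (inj₁ x<n) = ℕ.*-cancelʳ-< n (val u) n (ℕ.≤-<-trans (subst (val u * n ≤_) (proj₁ P) (ℕ.m≤m+n _ (val x))) p<n²) , x<n
              in-range (inj₂ (n0 , _)) = contradiction (subst (λ m → p < m * m) n0 p<n²) ℕ.n≮0

        adjacency-! : ∀ u x {a b} → vs ! val u ≡ just a → vs ! val x ≡ just b → adjacency bs N u x ≡ r a b
        adjacency-! u x d e = hit u x bs _ 0 origin false (!-length vs e) refl (matrix-! vs d e) (origin-position L n) fits′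

        adjacency-outside : ∀ u x → ¬ (val u < n × val x < n) → adjacency bs N u x ≡ false
        adjacency-outside u x out = outside u x bs 0 origin false out (origin-position L n) (ℕ.≤-reflexive length-bs)

-- From encodings of ordered graphs to the traversal.

module Graph where

  open import Data.Bool.Base using (Bool; true; false)
  open import Data.Digit using (Bit; fromDigits; toDigits)
  open import Data.Fin.Base using (Fin; zero; suc)
  open import Data.List.Base as List using (List; []; _∷_; _++_; length; map; concatMap; drop; filter; reverse; foldl; foldr; allFin)
  import Data.List.Properties as List
  open import Data.List.Membership.Propositional using (_∈_)
  import Data.List.Membership.Propositional.Properties as ∈
  import Data.List.Relation.Binary.Permutation.Propositional as Perm
  import Data.List.Relation.Binary.Permutation.Propositional.Properties as Perm
  import Data.List.Relation.Binary.Permutation.Setoid.Properties as PermSetoid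
  open import Data.List.Relation.Unary.All as All using (All; []; _∷_)
  open import Data.List.Relation.Unary.AllPairs as AllPairs using (AllPairs; []; _∷_)
  import Data.List.Relation.Unary.Linked.Properties as Linked
  import Data.List.Relation.Unary.Unique.Propositional.Properties as Unique
  open import Data.List.Relation.Unary.Unique.Propositional using (Unique)
  import Data.List.Sort as Sort
  open import Data.Maybe.Base using (just; nothing)
  open import Data.Maybe.Properties using (just-injective)
  open import Data.Nat.Base as ℕ using (ℕ; zero; suc; _+_; _*_; _^_; _≤_; z≤n; s≤s)
  import Data.Nat.Properties as ℕ
  open import Data.Product.Base using (_×_; _,_; proj₁; proj₂; ∃-syntax)
  open import Data.Sum.Base using (inj₁; inj₂)
  open import Data.Vec.Base as Vec using ([]; _∷_)
  open import Function.Bundles using (module Inverse)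
  open import Relation.Binary.Bundles using (DecTotalOrder)
  open import Relation.Binary.Definitions using (Tri; tri<; tri≈; tri>)
  import Relation.Binary.Properties.StrictTotalOrder as StrictTotalOrderProperties
  open import Relation.Binary.PropositionalEquality
  open import Relation.Binary.Structures using (IsStrictTotalOrder)
  open import Relation.Nullary.Decidable using (Dec; does; yes; no; dec-true)
  open import Relation.Nullary.Negation using (¬_; contradiction)
  open import Defs
  open Walk using (Bits)
  open Exploration using (Labelling; zeros)
  open Registers using (shiftIn)
  open Program using (bitVal; leading; after; judge; order; adjacency; counter; load)
  open Visits
  open Numbers
  open Decide using (length-<)

  leading-++ : ∀ (bs : List Bit) ys → leading (map bit bs ++ # ∷ ys) ≡ map bitVal bs
  leading-++ []       ys = refl
  leading-++ (b ∷ bs) ys = cong (bitVal b ∷_) (leading-++ bs ys)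

  after-++ : ∀ (bs : List Bit) ys → after (map bit bs ++ # ∷ ys) ≡ # ∷ ys
  after-++ []       ys = refl
  after-++ (b ∷ bs) ys = after-++ bs ys

  leading-all : ∀ (bs : List Bit) → leading (map bit bs) ≡ map bitVal bs
  leading-all []       = refl
  leading-all (b ∷ bs) = cong (bitVal b ∷_) (leading-all bs)

  -- Undoing the reversal in `binary` turns the left fold of `load` into Horner's scheme on the
  -- digits, where every partial value is at most m and so nothing overflows.
  load-binary : ∀ {L} m → m ℕ.< 2 ^ L → val (load {L} (map bitVal (binary m))) ≡ m
  load-binary {L} m lt = trans (cong val as-foldr) (trans (value ds (subst (ℕ._< 2 ^ L) (sym (proj₂ (toDigits 2 m))) lt)) (proj₂ (toDigits 2 m)))
    where
      ds = proj₁ (toDigits 2 m)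
      digits : List Bit → Bits L
      digits = foldr (λ d v → shiftIn (bitVal d) v) (zeros L)
      as-foldr : load {L} (map bitVal (reverse ds)) ≡ digits ds
      as-foldr = trans (foldl-map (reverse ds) (zeros L)) (List.reverse-foldl (λ v d → shiftIn (bitVal d) v) (zeros L) ds)
        where
          foldl-map : ∀ ds z → foldl (λ v b → shiftIn b v) z (map bitVal ds) ≡ foldl (λ v d → shiftIn (bitVal d) v) z ds
          foldl-map []       z = refl
          foldl-map (d ∷ ds) z = foldl-map ds (shiftIn (bitVal d) z)
      digit-bit : ∀ (d : Bit) → digit (bitVal d) ≡ Data.Fin.Base.toℕ d
      digit-bit zero       = refl
      digit-bit (suc zero) = refl
      value : ∀ ds → fromDigits ds ℕ.< 2 ^ L → val (digits ds) ≡ fromDigits ds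
      value []       lt = val-zeros L
      value (d ∷ ds) lt = trans (val-shiftIn-< (bitVal d) (digits ds) (subst (ℕ._< 2 ^ L) (sym eq) lt)) eq
        where
          smaller : fromDigits ds ℕ.< 2 ^ L
          smaller = ℕ.≤-<-trans (ℕ.≤-trans (ℕ.m≤m*n (fromDigits ds) 2) (ℕ.m≤n+m _ (Data.Fin.Base.toℕ d))) lt
          eq : digit (bitVal d) + 2 * val (digits ds) ≡ fromDigits (d ∷ ds)
          eq = cong₂ _+_ (digit-bit d) (trans (cong (2 *_) (value ds smaller)) (ℕ.*-comm 2 (fromDigits ds)))

  module Vertices (G : OrderedGraph) where
    open OrderedGraph G

    private
      module STO = IsStrictTotalOrder isStrictTotalOrder
      module DTO = DecTotalOrder (StrictTotalOrderProperties.decTotalOrder strictTotalOrder)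
      open Sort (StrictTotalOrderProperties.decTotalOrder strictTotalOrder) using (sort-↭; sort-↗)

      listed : List V
      listed = map (Inverse.to finite) (allFin size)

      to-injective : ∀ {a b} → Inverse.to finite a ≡ Inverse.to finite b → a ≡ b
      to-injective {a} {b} e = trans (sym (Inverse.strictlyInverseʳ finite a)) (trans (cong (Inverse.from finite) e) (Inverse.strictlyInverseʳ finite b))

      listed-unique : Unique listed
      listed-unique = Unique.map⁺ to-injective (Unique.allFin⁺ size)

    vertices-complete : ∀ v → v ∈ vertices
    vertices-complete v = Perm.∈-resp-↭ (Perm.↭-sym (sort-↭ listed))
      (subst (_∈ listed) (Inverse.strictlyInverseˡ finite v) (∈.∈-map⁺ (Inverse.to finite) (∈.∈-allFin (Inverse.from finite v))))

    ascending : AllPairs _<_ vertices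
    ascending = AllPairs.zipWith strict (Linked.Linked⇒AllPairs DTO.trans (sort-↗ listed) ,
        PermSetoid.Unique-resp-↭ (setoid V) (Perm.↭⇒↭ₛ (Perm.↭-sym (sort-↭ listed))) listed-unique)
      where
        strict : ∀ {a b} → (a DTO.≤ b) × a ≢ b → a < b
        strict (inj₁ lt , _)  = lt
        strict (inj₂ eq , ne) = contradiction eq ne

    -- In an ascending list the vertices smaller than the one at position p are precisely those
    -- before it.
    position-index : ∀ vs → AllPairs _<_ vs → ∀ {p v} → vs ! p ≡ just v → length (filter (_<? v) vs) ≡ p
    position-index (a ∷ vs) (a< ∷ asc) {zero} refl = trans (cong length (List.filter-reject (_<? a) (STO.irrefl refl)))
      (cong length (List.filter-none (_<? a) (All.map (λ a<y y<a → STO.asym a<y y<a) a<)))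
    position-index (a ∷ vs) (a< ∷ asc) {suc p} {v} e = trans (cong length (List.filter-accept (_<? v) (All.lookup a< (!-∈ vs e))))
      (cong suc (position-index vs asc e))

    vertices-index : ∀ v → vertices ! index v ≡ just v
    vertices-index v with ∈-! vertices (vertices-complete v)
    ... | p , e = trans (cong (vertices !_) (position-index vertices ascending e)) e

  module Theorem (Λ : Labelling) where
    open Decide.Deciding Λ

    module _ (G : OrderedGraph) where
      open OrderedGraph G
      open Vertices G

      private
        n = length vertices
        r : V → V → Bool
        r a b = does (a ~? b)
        bs = matrix r vertices vertices
        L = length (counter bs)
        visits : ∀ {L} → (Bits L → Bits L → Bool) → List (Bits L)
        visits = Program.Explorer.visits Λ

        bitVal-bool : ∀ b → bitVal (boolToBit b) ≡ b
        bitVal-bool true  = refl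
        bitVal-bool false = refl

        encoded-bits : map bitVal (encodeGraph G) ≡ bs
        encoded-bits = rows vertices
          where
            row : ∀ a ws → map bitVal (map (λ w → boolToBit (r a w)) ws) ≡ map (r a) ws
            row a ws = trans (sym (List.map-∘ ws)) (List.map-cong (λ w → bitVal-bool (r a w)) ws)
            rows : ∀ us → map bitVal (concatMap (λ a → map (λ w → boolToBit (r a w)) vertices) us) ≡ matrix r vertices us
            rows []       = refl
            rows (a ∷ us) = trans (List.map-++ bitVal (map (λ w → boolToBit (r a w)) vertices) _) (cong₂ _++_ (row a vertices) (rows us))

        fits : n * n ℕ.< 2 ^ L
        fits = subst (ℕ._< 2 ^ L) (length-matrix r vertices vertices) (length-< bs)

        index-< : ∀ v → index v ℕ.< n
        index-< v = !-length vertices (vertices-index v)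

        index-fits : ∀ v → index v ℕ.< 2 ^ L
        index-fits v = ℕ.<-trans (index-< v) (ℕ.≤-<-trans (square-≥ n) fits)
          where
            square-≥ : ∀ n → n ≤ n * n
            square-≥ zero    = z≤n
            square-≥ (suc n) = ℕ.m≤m*n (suc n) (suc n)

        code : V → Bits L
        code v = load (map bitVal (binary (index v)))

        val-code : ∀ v → val (code v) ≡ index v
        val-code v = load-binary (index v) (index-fits v)

        at-code : ∀ v → vertices ! val (code v) ≡ just v
        at-code v = trans (cong (vertices !_) (val-code v)) (vertices-index v)

        code-injective : ∀ {v w} → code v ≡ code w → v ≡ w
        code-injective {v} {w} e = just-injective (trans (sym (at-code v)) (trans (cong (λ c → vertices ! val c) e) (at-code w)))

        adj : Bits L → Bits L → Bool
        adj = adjacency bs (order bs)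

        order≡ : val (order {L} bs) ≡ n
        order≡ = order-correct r vertices {L} fits

        adj-code : ∀ a b → adj (code a) (code b) ≡ r a b
        adj-code a b = adjacency-! r vertices {L} fits (order bs) order≡ (code a) (code b) (at-code a) (at-code b)

        decode : ∀ x → val x ℕ.< n → ∃[ v ] x ≡ code v
        decode x lt with !-total vertices lt
        ... | v , e = v , val-injective x (code v) (sym (trans (val-code v) (position-index vertices ascending e)))

        -- The list of visits also contains words which are the code of no vertex. They are
        -- isolated, so that both ends of every edge found can be decoded.
        adj-vertices : ∀ u x → adj u x ≡ true → ∃[ a ] ∃[ b ] u ≡ code a × x ≡ code b × a ~ b
        adj-vertices u x e = decide (val u ℕ.<? n) (val x ℕ.<? n)
          where
            adjacent : ∀ a b → r a b ≡ true → a ~ b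
            adjacent a b e with a ~? b
            ... | yes s = s
            Result : Set
            Result = ∃[ a ] ∃[ b ] u ≡ code a × x ≡ code b × a ~ b
            decoded : (∃[ v ] u ≡ code v) → (∃[ v ] x ≡ code v) → Result
            decoded (a , e₁) (b , e₂) = a , b , e₁ , e₂ , adjacent a b (trans (sym (adj-code a b)) (trans (cong₂ adj (sym e₁) (sym e₂)) e))
            outside : ¬ (val u ℕ.< n × val x ℕ.< n) → Result
            outside out = contradiction (trans (sym e) (adjacency-outside r vertices {L} fits (order bs) order≡ u x out)) (λ ())
            decide : Dec (val u ℕ.< n) → Dec (val x ℕ.< n) → Result
            decide (no ¬p) _       = outside (λ lt → ¬p (proj₁ lt))
            decide (yes _) (no ¬p) = outside (λ lt → ¬p (proj₂ lt))
            decide (yes p) (yes q) = decoded (decode u p) (decode x q)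

        adj-true : ∀ {a b} → a ~ b → adj (code a) (code b) ≡ true
        adj-true {a} {b} s = trans (adj-code a b) (dec-true (a ~? b) s)

        adj-flip : ∀ u x → adj u x ≡ true → adj x u ≡ true
        adj-flip u x e = flipped (adj-vertices u x e)
          where
            flipped : (∃[ a ] ∃[ b ] u ≡ code a × x ≡ code b × a ~ b) → adj x u ≡ true
            flipped (a , b , e₁ , e₂ , s) = trans (cong₂ adj e₂ e₁) (adj-true (~-sym s))

        adj-sym : ∀ u x → adj u x ≡ adj x u
        adj-sym u x = same (adj u x) (adj x u) (adj-flip u x) (adj-flip x u)
          where
            same : ∀ p q → (p ≡ true → q ≡ true) → (q ≡ true → p ≡ true) → p ≡ q
            same true  q     f g = sym (f refl)
            same false true  f g = g refl
            same false false f g = refl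

        answer-encode : ∀ v w → Program.Explorer.answer Λ (encode G v w) ≡ foldl (judge (code v) (code w)) nothing (visits adj)
        answer-encode v w = from-parts (leading xs) (leading xs₁) (leading (drop 1 (after xs₁))) bits₀ bits₁ bits₂
          where
            xs = encode G v w
            xs₁ = drop 1 (after xs)
            ys = map bit (binary (index v)) ++ # ∷ map bit (binary (index w))
            bits₀ : leading xs ≡ bs
            bits₀ = trans (leading-++ (encodeGraph G) ys) encoded-bits
            xs₁≡ : xs₁ ≡ ys
            xs₁≡ = cong (drop 1) (after-++ (encodeGraph G) ys)
            bits₁ : leading xs₁ ≡ map bitVal (binary (index v))
            bits₁ = trans (cong leading xs₁≡) (leading-++ (binary (index v)) _)
            bits₂ : leading (drop 1 (after xs₁)) ≡ map bitVal (binary (index w))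
            bits₂ = trans (cong (λ z → leading (drop 1 (after z))) xs₁≡)
              (trans (cong (λ z → leading (drop 1 z)) (after-++ (binary (index v)) _)) (leading-all (binary (index w))))
            -- The length of the words is computed from the first part of the input and occurs in
            -- the types. The three parts are therefore abstracted before the equations are matched.
            from-parts : ∀ b₀ b₁ b₂ → b₀ ≡ bs → b₁ ≡ map bitVal (binary (index v)) → b₂ ≡ map bitVal (binary (index w)) →
              foldl (judge (load {length (counter b₀)} b₁) (load b₂)) nothing (visits (adjacency b₀ (order b₀))) ≡
              foldl (judge (code v) (code w)) nothing (visits adj)
            from-parts _ _ _ refl refl refl = refl

        module Search {L : ℕ} (0<L : 0 ℕ.< L) (A : Bits L → Bits L → Bool) (A-sym : ∀ u x → A u x ≡ A x u) where

          -- Stated for any positive L, as `Explored` expects a successor and the length at hand is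
          -- not one syntactically.
          complete-search : Traversals.Search A [] (visits A) × (∀ s → s ∈ visits A)
          complete-search = go L 0<L A A-sym
            where
              go : ∀ L → 0 ℕ.< L → (A : Bits L → Bits L → Bool) → (∀ u x → A u x ≡ A x u) →
                   Traversals.Search A [] (visits A) × (∀ s → s ∈ visits A)
              go (suc L) _ A A-sym = Visits.Explored.search-visits Λ A A-sym , Visits.Explored.∈-visits Λ A A-sym

        -- A vertex gives 1 ≤ n² < 2 ^ L.
        0<L : V → 0 ℕ.< L
        0<L v = positive L (ℕ.≤-<-trans (ℕ.*-mono-≤ 1≤n 1≤n) fits)
          where
            1≤n : 1 ≤ n
            1≤n = ℕ.≤-trans (s≤s z≤n) (index-< v)
            positive : ∀ L → 1 ℕ.< 2 ^ L → 0 ℕ.< L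
            positive zero    (s≤s ())
            positive (suc L) _ = s≤s z≤n

        rk : V → ℕ
        rk v = rank (code v) (visits adj)

        visited : ∀ v → code v ∈ visits adj
        visited v = proj₂ (Search.complete-search (0<L v) adj adj-sym) (code v)

        _≺_ : V → V → Set
        _≺_ = DefinedBy G machine

        ≺⇒ : ∀ {v w} → v ≺ w → rk v ℕ.< rk w
        ≺⇒ {v} {w} a = judge⇒rank (code v) (code w) (visits adj) (visited v) (trans (sym (answer-encode v w)) (accepts⇒ (encode G v w) a))

        ≺⇐ : ∀ {v w} → rk v ℕ.< rk w → v ≺ w
        ≺⇐ {v} {w} lt = accepts⇐ (encode G v w) (trans (answer-encode v w) (rank⇒judge (code v) (code w) (visits adj) lt))

      linear : IsStrictTotalOrder _≡_ _≺_
      linear = record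
        { isStrictPartialOrder = record
          { isEquivalence = isEquivalence
          ; irrefl = λ e a → ℕ.<-irrefl (cong rk e) (≺⇒ a)
          ; trans = λ a b → ≺⇐ (ℕ.<-trans (≺⇒ a) (≺⇒ b))
          ; <-resp-≈ = (λ {x} e a → subst (x ≺_) e a) , (λ {x} e a → subst (_≺ x) e a) }
        ; compare = compare }
        where
          compare : ∀ v w → Tri (v ≺ w) (v ≡ w) (w ≺ v)
          compare v w = from-ranks (ℕ.<-cmp (rk v) (rk w))
            where
              from-ranks : Tri (rk v ℕ.< rk w) (rk v ≡ rk w) (rk w ℕ.< rk v) → Tri (v ≺ w) (v ≡ w) (w ≺ v)
              from-ranks (tri< lt ¬eq ¬gt) = tri< (≺⇐ lt) (λ e → ¬eq (cong rk e)) (λ a → ¬gt (≺⇒ a))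
              -- Every code is visited, so equal ranks mean equal codes, and codes determine their
              -- vertices.
              from-ranks (tri≈ ¬lt eq ¬gt) = tri≈ (λ a → ¬lt (≺⇒ a)) (code-injective (rank-injective (visits adj) (visited v) eq)) (λ a → ¬gt (≺⇒ a))
              from-ranks (tri> ¬lt ¬eq gt) = tri> (λ a → ¬lt (≺⇒ a)) (λ e → ¬eq (cong rk e)) (≺⇐ gt)

      traversal : IsTraversal G _≺_
      traversal v (u , w , u≺v , u~w , w⊀v) = neighbour
        (Traversals.search-traverses adj (proj₁ (Search.complete-search (0<L v) adj adj-sym)) {code u} {code v} {code w}
          (visited v) (≺⇒ u≺v) (adj-true u~w) (λ lt → w⊀v (≺⇐ lt)))
        where
          neighbour : (∃[ y ] rank y (visits adj) ℕ.< rk v × adj y (code v) ≡ true) → ∃[ x ] x ≺ v × v ~ x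
          neighbour (y , lt , a) = named (adj-vertices y (code v) a)
            where
              named : (∃[ x ] ∃[ b ] y ≡ code x × code v ≡ code b × x ~ b) → ∃[ x ] x ≺ v × v ~ x
              named (x , b , e′ , e , s) = x , ≺⇐ (subst (λ y → rank y (visits adj) ℕ.< rk v) e′ lt) , ~-sym (subst (x ~_) (sym (code-injective e)) s)

open import Defs
open import Data.Product.Base using (∃-syntax; _×_; _,_)
open import Relation.Binary.PropositionalEquality.Core using (_≡_)
open import Relation.Binary.Structures using (IsStrictTotalOrder)

theorem6 : ∃[ M ] IsLogSpace {Symbol} M ×
    ((G : OrderedGraph) →
    IsStrictTotalOrder _≡_ (DefinedBy G M) × IsTraversal G (DefinedBy G M))
theorem6 = machine , logSpace , λ G → linear G , traversal G
  where
    open Decide.Deciding Exploration.the-labelling using (machine; logSpace)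
    open Graph.Theorem Exploration.the-labelling using (linear; traversal)
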